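{- Let $r,j\in\mathbb{N}$ with $\gcd(r,j)=1$ and let $1\leqslant H\leqslant M\leqslant r$. Then for every $\varepsilon>0$, $$E_2(r,j,M,H)\ll\left(\frac{H^3M^2}{r}+HM\right)r^{\varepsilon}$$ and $$E_4(r,j,M,H)\ll H^2M^2\left(\frac{H^3M^2}{r}+HM\right)r^{\varepsilon},$$ where the implied constants depend only on $\varepsilon$.
   Context: A modular square root of $s$ modulo $r$ is a residue $k$ modulo $r$ with $k^2\equiv s\pmod r$. $E_2(r,j,M,H)$ is the number of tuples $(m_1,m_2,m_3,m_4,k_1,k_2,k_3,k_4)$ where $m_i$ are integers with $1\leqslant m_i\leqslant M$, $k_i$ are residues modulo $r$ with $k_i^2\equiv jm_i\pmod r$, $1\leqslant|m_1-m_2|\leqslant H$, $1\leqslant|m_3-m_4|\leqslant H$, and $k_1-k_2\equiv k_3-k_4\pmod r$. $E_4(r,j,M,H)$ is the number of tuples $(m_1,\dots,m_8,k_1,\dots,k_8)$ where $m_i$ are integers with $1\leqslant m_i\leqslant M$, $k_i$ are residues modulo $r$ with $k_i^2\equiv jm_i\pmod r$, $1\leqslant|m_i-m_{i+1}|\leqslant H$ for $i=1,3,5,7$, and $k_1-k_2+k_3-k_4\equiv k_5-k_6+k_7-k_8\pmod r$. -}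

module Defs where

open import Data.Bool using (Bool; true; false; _∧_)
open import Data.Nat as ℕ using (ℕ; zero; suc; _≡ᵇ_; _≤ᵇ_; ∣_-_∣; _%_)
open import Data.Integer as ℤ using (ℤ; +_)
open import Data.Integer.DivMod using (_%ℕ_)
open import Data.List using (List; filterᵇ; cartesianProduct; map; upTo; length)
open import Data.Product using (_×_; _,_)

_≡ℤ[_]ᵇ_ : ℤ → ℕ → ℤ → Bool
a ≡ℤ[ zero ]ᵇ b = ℤ.∣ a ℤ.- b ∣ ≡ᵇ 0
a ≡ℤ[ suc n ]ᵇ b = (a %ℕ suc n) ≡ᵇ (b %ℕ suc n)

_≡[_]ᵇ_ : ℕ → ℕ → ℕ → Bool
a ≡[ zero ]ᵇ b = a ≡ᵇ b
a ≡[ suc n ]ᵇ b = (a % suc n) ≡ᵇ (b % suc n)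

-- A point (m , k): 1 ≤ m ≤ M, k a residue mod r (represented by 0 ≤ k < r)
-- with k² ≡ j m (mod r).
Pt : Set
Pt = ℕ × ℕ

points : (r j M : ℕ) → List Pt
points r j M =
  filterᵇ (λ { (m , k) → (1 ≤ᵇ m) ∧ ((k ℕ.* k) ≡[ r ]ᵇ (j ℕ.* m)) })
    (cartesianProduct (map suc (upTo M)) (upTo r))

adm : (r j M H : ℕ) → List (Pt × Pt)
adm r j M H =
  filterᵇ (λ { ((m₁ , _) , (m₂ , _)) → (1 ≤ᵇ ∣ m₁ - m₂ ∣) ∧ (∣ m₁ - m₂ ∣ ≤ᵇ H) })
    (cartesianProduct (points r j M) (points r j M))

dif : Pt × Pt → ℤ
dif ((_ , k₁) , (_ , k₂)) = + k₁ ℤ.- + k₂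

E₂ : (r j M H : ℕ) → ℕ
E₂ r j M H =
  length (filterᵇ (λ { (a , b) → dif a ≡ℤ[ r ]ᵇ dif b })
    (cartesianProduct (adm r j M H) (adm r j M H)))

E₄ : (r j M H : ℕ) → ℕ
E₄ r j M H =
  length (filterᵇ (λ { ((a , b) , (c , d)) → (dif a ℤ.+ dif b) ≡ℤ[ r ]ᵇ (dif c ℤ.+ dif d) })
    (cartesianProduct (cartesianProduct (adm r j M H) (adm r j M H))
                      (cartesianProduct (adm r j M H) (adm r j M H))))

{-# OPTIONS --safe #-}

-- Let f(λ) count the admissible pairs of roots with k₁ - k₂ ≡ λ, so that E₂ = Σ f(λ)² and,
-- by Cauchy–Schwarz, E₄ ≤ (Σ f)² E₂; counting square roots gives Σ f ≪ HM r^ε.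
-- Write h = m₁ - m₂ and s = m₁ + m₂. Two pairs with the same λ satisfy
-- 2λ²(s - s′) ≡ j(h² - h′²) (mod r), so (s - s′, h² - h′²) lies in a lattice of determinant r.
-- After cutting the range of s into about 1 + H²M/r blocks (Cauchy–Schwarz again) these vectors
-- are so short that for fixed λ they are all multiples of a single vector (Δ, D).
-- From (h - h′)(h + h′) = tD one gets D = δδ′ with δ ∣ h - h′ and δ′ ∣ h + h′: thus h′ determines
-- h up to H / lcm(δ, δ′) choices, and s′ runs through a progression of difference Δ. If
-- lcm(δ, δ′) > H, a pair has only O(r^ε) partners of this kind; otherwise one counts (λ, Δ, δ, δ′)
-- together with multiples of Δ and of lcm(δ, δ′) not exceeding the block length and 2H.
-- All gcd's are handled by the observation that dd′ = n, d ∣ x - a, d′ ∣ x + a confine x to a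
-- class modulo n / gcd(d, d′) while gcd(d, d′) ∣ 2a. If H² > r, f(λ) ≪ H is already enough.
-- Common factors v of k₁, k₂ and r are removed first, by passing to the modulus r / gcd(v², r).

module Submission where

open import Defs
open import Data.Bool using (Bool; true; false; _∧_; T; T?)
import Data.Bool as Bool
open import Data.Bool.Properties using (T-∧)
open import Data.Integer as ℤ using (ℤ; +_; -[1+_])
  renaming (_+_ to _+ᶻ_; _*_ to _*ᶻ_; _-_ to _-ᶻ_; -_ to -ᶻ_; ∣_∣ to abs)
open import Data.Integer.DivMod using (_%ℕ_; _/ℕ_; n%ℕd<d; a≡a%ℕn+[a/ℕn]*n)
import Data.Integer.Divisibility.Signed as S
import Data.Integer.Properties as ℤₚ
import Data.Integer.Tactic.RingSolver as ℤ-Solver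
open import Data.List using (List; []; _∷_; _++_; length; map; filterᵇ; cartesianProduct; upTo; deduplicate)
open import Data.List.Membership.Propositional using (_∈_)
open import Data.List.Membership.Propositional.Properties
  using (∈-filter⁻; ∈-map⁻; ∈-map⁺; ∈-upTo⁻; ∈-cartesianProduct⁻; ∈-deduplicate⁻; ∈-deduplicate⁺)
open import Data.List.Properties using (length-map)
open import Data.List.Relation.Unary.All as All using (All; []; _∷_)
import Data.List.Relation.Unary.All.Properties as Allₚ
open import Data.List.Relation.Unary.Any using (here; there)
import Data.List.Relation.Unary.Unique.DecPropositional.Properties as DecUnique
open import Data.List.Relation.Unary.Unique.Propositional using (Unique; []; _∷_)
import Data.List.Relation.Unary.Unique.Propositional.Properties as Unique
open import Data.Nat
open import Data.Nat.Coprimality using (Coprime; coprime-divisor; coprime-/gcd)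
import Data.Nat.Coprimality as Coprimality
open import Data.Nat.DivMod using (m≡m%n+[m/n]*n; m%n<n; m*n/n≡m; m/n*n≤m)
open import Data.Nat.Divisibility
open import Data.Nat.GCD
open import Data.Nat.Induction using (<-wellFounded)
open import Data.Nat.LCM using (lcm; m∣lcm[m,n]; n∣lcm[m,n]; lcm-least; gcd*lcm)
open import Data.Nat.ListAction using (product)
open import Data.Nat.Primality using (Prime; _Rough_; 2-rough; rough∧∣⇒prime; rough∧∣⇒rough; rough⇒≤; ∤⇒rough-suc;
  prime⇒irreducible; prime⇒nonZero; prime⇒nonTrivial)
open import Data.Nat.Primality.Factorisation using (factorise; PrimeFactorisation)
open import Data.Nat.Properties
open import Data.Nat.Tactic.RingSolver using (solve-∀)
open import Data.Product using (Σ; ∃; ∃₂; _×_; _,_; proj₁; proj₂)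
open import Data.Product.Properties using (≡-dec)
open import Data.Sum using (_⊎_; inj₁; inj₂)
open import Function using (_∘_)
open import Function.Bundles using (Equivalence)
open import Induction.WellFounded using (Acc; acc)
open import Relation.Binary.Definitions using (DecidableEquality; Tri; tri<; tri≈; tri>)
open import Relation.Binary.PropositionalEquality
open import Relation.Nullary using (¬_; Dec; yes; no; does; contradiction)
open import Relation.Nullary.Decidable using (map′)

-- Bounds for the number of elements

-- Two losses shape the proof. Modulo a composite r an integer m can have many roots; comparing each
-- of them with a fixed one costs a factor gcd(d, d′), where dd′ = r. This loss is won back on
-- average, since gcd(d, d′)² divides 4m, so that such m are sparse; the count of λ works in the
-- same way. For prescribed λ, m and h there is nothing to average over, and only the absence of a
-- common factor of k₁, k₂ and r helps. Removing a common factor v puts a coefficient into the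
-- congruence: with V = gcd(v², r), v² = Vc, k = vκ, it becomes cκ² ≡ j(m / V) modulo r / V. Hence
-- everything is proved for ck² ≡ jm with c prime to the modulus. No power r^ε occurs in the
-- counting. A single τ bounds the number of divisors of every n ≤ 4r, and E₂ and E₄ receive the
-- factors τ⁹ and τ¹³; for ε = p/q the estimate τ^(13q) ≪ r is inserted at the very end.

module Cardinality where

  private variable
    A B C : Set
    P Q : A → Set
    m n : ℕ

  -- Testing duplicate-free lists means that `P` need neither be decidable nor come with an
  -- enumeration.
  AtMost : ℕ → (A → Set) → Set
  AtMost n P = ∀ xs → Unique xs → All P xs → length xs ≤ n

  AtMost-weaken : m ≤ n → AtMost m P → AtMost n P
  AtMost-weaken m≤n bnd xs u ps = ≤-trans (bnd xs u ps) m≤n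

  AtMost-⊆ : (∀ {x} → P x → Q x) → AtMost n Q → AtMost n P
  AtMost-⊆ sub bnd xs u ps = bnd xs u (All.map sub ps)

  AtMost-subsingleton : (∀ {x y} → P x → P y → x ≡ y) → AtMost 1 P
  AtMost-subsingleton eq [] _ _ = z≤n
  AtMost-subsingleton eq (_ ∷ []) _ _ = ≤-refl
  AtMost-subsingleton eq (_ ∷ _ ∷ _) ((x≢y ∷ _) ∷ _) (px ∷ py ∷ _) = contradiction (eq px py) x≢y

  -- An empty list is trivial and any other list supplies a member, so a bound may be proved
  -- relative to a reference member. This is how reference solutions are fixed below.
  AtMost-rebase : (∀ {x} → P x → AtMost n P) → AtMost n P
  AtMost-rebase f [] _ _ = z≤n
  AtMost-rebase f (x ∷ xs) u (px ∷ ps) = f px (x ∷ xs) u (px ∷ ps)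

  module _ {P : A → Set} (f : A → B) where

    private
      map-fresh : (∀ {x y} → P x → P y → f x ≡ f y → x ≡ y) → ∀ {x} → P x →
        ∀ {xs} → All P xs → All (x ≢_) xs → All (f x ≢_) (map f xs)
      map-fresh inj px [] [] = []
      map-fresh inj px (py ∷ ps) (x≢y ∷ ne) = (x≢y ∘ inj px py) ∷ map-fresh inj px ps ne

      map-unique : (∀ {x y} → P x → P y → f x ≡ f y → x ≡ y) →
        ∀ {xs} → All P xs → Unique xs → Unique (map f xs)
      map-unique inj [] [] = []
      map-unique inj (px ∷ ps) (ne ∷ u) = map-fresh inj px ps ne ∷ map-unique inj ps u

    AtMost-injection : (∀ {x} → P x → Q (f x)) →
      (∀ {x y} → P x → P y → f x ≡ f y → x ≡ y) → AtMost n Q → AtMost n P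
    AtMost-injection into inj bnd xs u ps =
      subst (_≤ _) (length-map f xs)
        (bnd (map f xs) (map-unique inj ps u) (Allₚ.map⁺ (All.map into ps)))

  AtMost-⊎ : AtMost m P → AtMost n Q → AtMost (m + n) (λ x → P x ⊎ Q x)
  AtMost-⊎ {P = P} {Q = Q} bp bq xs u pqs with split xs u pqs
    where
    split : ∀ xs → Unique xs → All (λ x → P x ⊎ Q x) xs →
      Σ (List _) λ ys → Σ (List _) λ zs → (Unique ys × All P ys × Unique zs × All Q zs)
        × length xs ≡ length ys + length zs
        × (∀ {R : _ → Set} → All R xs → All R ys × All R zs)
    split [] [] [] = [] , [] , ([] , [] , [] , []) , refl , λ _ → [] , []
    split (x ∷ xs) (ne ∷ u) (inj₁ p ∷ ps) with split xs u ps
    ... | ys , zs , (uy , py , uz , qz) , len , sub =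
      x ∷ ys , zs , (proj₁ (sub ne) ∷ uy , p ∷ py , uz , qz) , cong suc len ,
        λ { (r ∷ rs) → r ∷ proj₁ (sub rs) , proj₂ (sub rs) }
    split (x ∷ xs) (ne ∷ u) (inj₂ q ∷ ps) with split xs u ps
    ... | ys , zs , (uy , py , uz , qz) , len , sub =
      ys , x ∷ zs , (uy , py , proj₂ (sub ne) ∷ uz , q ∷ qz) ,
        trans (cong suc len) (sym (+-suc _ _)) ,
        λ { (r ∷ rs) → proj₁ (sub rs) , r ∷ proj₂ (sub rs) }
  ... | ys , zs , (uy , py , uz , qz) , len , _ =
    subst (_≤ _) (sym len) (+-mono-≤ (bp ys uy py) (bq zs uz qz))

  AtMost-remove : ∀ {b} → AtMost n Q → Q b → AtMost (pred n) (λ x → Q x × b ≢ x)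
  AtMost-remove {n = n} {b = b} bnd qb xs u ps =
    pred-mono-≤ (bnd (b ∷ xs) (All.map proj₂ ps ∷ u) (qb ∷ All.map proj₁ ps))

  -- Labels are attached by a relation, so that they may be chosen existentially
  -- and need not be functions of the labelled object.
  AtMost-fiber : DecidableEquality B → {P : A → Set} {Q : B → Set} (R : A → B → Set) →
    (∀ {x} → P x → ∃ λ b → Q b × R x b) →
    AtMost n Q → (∀ {b} → Q b → AtMost m (λ x → P x × R x b)) → AtMost (n * m) P
  AtMost-fiber {B = B} {A = A} {n = n} {m = m} _≟_ {P} {Q} R label bq fib =
    AtMost-⊆ (λ p → p , label p) (go n Q bq fib)
    where
    go : ∀ n (Q : B → Set) → AtMost n Q →
      (∀ {b} → Q b → AtMost m (λ x → P x × R x b)) →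
      AtMost (n * m) (λ x → P x × ∃ λ b → Q b × R x b)
    go n Q bq fib [] u ps = z≤n
    go zero Q bq fib (_ ∷ _) u ((_ , b , q , _) ∷ _) = contradiction (bq (b ∷ []) ([] ∷ []) (q ∷ [])) λ ()
    -- Induction on the number of labels: the fibre over the label `b` of the first element is split
    -- off, and all other elements carry a label different from `b`.
    go (suc n) Q bq fib (x ∷ xs) u ps@((_ , b , q , _) ∷ _) =
      AtMost-⊆ classify
        (AtMost-⊎ (fib q) (go n (λ c → Q c × b ≢ c) (AtMost-remove bq q) (λ { (q′ , _) → fib q′ })))
        (x ∷ xs) u ps
      where
      classify : ∀ {x} → (P x × ∃ λ c → Q c × R x c) →
        (P x × R x b) ⊎ (P x × ∃ λ c → (Q c × b ≢ c) × R x c)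
      classify (p , c , qc , r) with b ≟ c
      ... | yes refl = inj₁ (p , r)
      ... | no b≢c = inj₂ (p , c , (qc , b≢c) , r)

  AtMost-× : DecidableEquality A → {P : A → Set} {Q : B → Set} → AtMost m P → AtMost n Q →
    AtMost (m * n) (λ (x : A × B) → P (proj₁ x) × Q (proj₂ x))
  AtMost-× _≟_ {P} {Q} bp bq = AtMost-fiber _≟_ (λ x a → proj₁ x ≡ a) (λ {x} (p , q) → proj₁ x , p , refl) bp
    λ p → AtMost-injection proj₂ (λ ((_ , q) , _) → q)
      (λ { (_ , refl) (_ , refl) refl → refl }) bq

  AtMost-< : ∀ n → AtMost n (_< n)
  AtMost-< zero [] _ _ = z≤n
  AtMost-< zero (_ ∷ _) _ (() ∷ _)
  AtMost-< (suc n) = AtMost-weaken (≤-reflexive (+-comm n 1)) (AtMost-⊆ classify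
      (AtMost-⊎ (AtMost-< n) (AtMost-subsingleton {P = _≡ n} λ { refl refl → refl })))
    where
    classify : ∀ {k} → k < suc n → k < n ⊎ k ≡ n
    classify (s≤s k≤n) = m≤n⇒m<n∨m≡n k≤n

open Cardinality

-- Divisibility and congruences

-- n ÷ 0 = 0 and hence n mod 0 = n.
infixl 7 _÷_
_÷_ : ℕ → ℕ → ℕ
n ÷ zero = 0
n ÷ d@(suc _) = n / d

÷-*-≤ : ∀ n d → n ÷ d * d ≤ n
÷-*-≤ n zero = z≤n
÷-*-≤ n d@(suc _) = m/n*n≤m n d

*-÷ : ∀ n d → 1 ≤ d → n * d ÷ d ≡ n
*-÷ n d@(suc _) _ = m*n/n≡m n d

÷-remainder : ∀ n d → 1 ≤ d → ∃ λ ρ → ρ < d × n ≡ ρ + n ÷ d * d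
÷-remainder n d@(suc _) _ = n % d , m%n<n n d , m≡m%n+[m/n]*n n d

infixl 7 _mod_
_mod_ : ℕ → ℕ → ℕ
n mod d = n ∸ n ÷ d * d

mod-÷ : ∀ n d → n ≡ n mod d + n ÷ d * d
mod-÷ n d = sym (m∸n+n≡m (÷-*-≤ n d))

mod-< : ∀ n d → 1 ≤ d → n mod d < d
mod-< n d 1≤d =
  let (ρ , ρ<d , eq) = ÷-remainder n d 1≤d
  in subst (_< d) (sym (trans (cong (_∸ n ÷ d * d) eq) (m+n∸n≡m ρ (n ÷ d * d)))) ρ<d

<-suc÷-* : ∀ n d → 1 ≤ d → n < suc (n ÷ d) * d
<-suc÷-* n d 1≤d with ÷-remainder n d 1≤d
... | ρ , ρ<d , eq = subst (_< d + n ÷ d * d) (sym eq) (+-monoˡ-< (n ÷ d * d) ρ<d)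

÷-greatest : ∀ {a n} d → 1 ≤ d → a * d ≤ n → a ≤ n ÷ d
÷-greatest {a} {n} d 1≤d a*d≤n =
  ≤-pred (*-cancelʳ-< d a _ (≤-<-trans a*d≤n (<-suc÷-* n d 1≤d)))

÷-< : ∀ {n a} d → 1 ≤ d → n < a * d → n ÷ d < a
÷-< {n} {a} d 1≤d lt = *-cancelʳ-< d (n ÷ d) a (≤-<-trans (÷-*-≤ n d) lt)

infix 4 _∣ᶻ_
_∣ᶻ_ : ℕ → ℤ → Set
n ∣ᶻ z = (+ n) S.∣ z

∣⇒∣ᶻ : ∀ {n} z → n ∣ abs z → n ∣ᶻ z
∣⇒∣ᶻ z = S.∣ᵤ⇒∣

∣ᶻ⇒∣ : ∀ {n z} → n ∣ᶻ z → n ∣ abs z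
∣ᶻ⇒∣ = S.∣⇒∣ᵤ

∣-∣ᶻ-trans : ∀ {m n z} → m ∣ n → n ∣ᶻ z → m ∣ᶻ z
∣-∣ᶻ-trans m∣n n∣z = ∣⇒∣ᶻ _ (∣-trans m∣n (∣ᶻ⇒∣ n∣z))

∣ᶻ-* : ∀ {n x z} a → n ∣ᶻ x → z ≡ a *ᶻ x → n ∣ᶻ z
∣ᶻ-* a n∣x refl = S.∣n⇒∣m*n a n∣x

∣ᶻ-lin : ∀ {n x y z} a b → n ∣ᶻ x → n ∣ᶻ y → z ≡ a *ᶻ x +ᶻ b *ᶻ y → n ∣ᶻ z
∣ᶻ-lin a b n∣x n∣y refl = S.∣m∣n⇒∣m+n (S.∣n⇒∣m*n a n∣x) (S.∣n⇒∣m*n b n∣y)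

∣ᶻ-lin₃ : ∀ {n x y z w} a b c → n ∣ᶻ x → n ∣ᶻ y → n ∣ᶻ z → w ≡ a *ᶻ x +ᶻ b *ᶻ y +ᶻ c *ᶻ z → n ∣ᶻ w
∣ᶻ-lin₃ a b c n∣x n∣y n∣z refl = S.∣m∣n⇒∣m+n (∣ᶻ-lin a b n∣x n∣y refl) (S.∣n⇒∣m*n c n∣z)

∣ᶻ-cancel : ∀ {n c} → Coprime n c → ∀ z → n ∣ᶻ + c *ᶻ z → n ∣ᶻ z
∣ᶻ-cancel {c = c} cop z n∣cz = ∣⇒∣ᶻ z (coprime-divisor cop (subst (_ ∣_) (ℤₚ.abs-* (+ c) z) (∣ᶻ⇒∣ n∣cz)))

∣-small : ∀ {n m} → n ∣ m → m < n → m ≡ 0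
∣-small {m = zero} _ _ = refl
∣-small {m = suc _} n∣m m<n = contradiction (∣⇒≤ n∣m) (<⇒≱ m<n)

∣ᶻ-small : ∀ {n z} → n ∣ᶻ z → abs z < n → z ≡ + 0
∣ᶻ-small n∣z z<n = ℤₚ.∣i∣≡0⇒i≡0 (∣-small (∣ᶻ⇒∣ n∣z) z<n)

abs-diff-≤ : ∀ {m n k} → m ≤ n + k → n ≤ m + k → abs (+ m -ᶻ + n) ≤ k
abs-diff-≤ {m} {n} {k} m≤ n≤ rewrite ℤₚ.m-n≡m⊖n m n with ≤-total m n
... | inj₁ m≤n rewrite ℤₚ.∣⊖∣-≤ m≤n = m≤n+o⇒m∸n≤o n m n≤
... | inj₂ n≤m rewrite ℤₚ.∣m⊖n∣≡∣n⊖m∣ m n | ℤₚ.∣⊖∣-≤ n≤m = m≤n+o⇒m∸n≤o m n m≤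

abs-diff-< : ∀ {m n d} → m < d + n → n < d + m → abs (+ m -ᶻ + n) < d
abs-diff-< {d = zero} m<n n<m = contradiction m<n (<-asym n<m)
abs-diff-< {m} {n} {suc d} (s≤s m<) (s≤s n<) =
  s≤s (abs-diff-≤ (subst (m ≤_) (+-comm d n) m<) (subst (n ≤_) (+-comm d m) n<))

abs-diff-bound : ∀ {m n d} → m < d → n < d → abs (+ m -ᶻ + n) < d
abs-diff-bound {d = d} m<d n<d = abs-diff-< (≤-trans m<d (m≤m+n d _)) (≤-trans n<d (m≤m+n d _))

diff≡0 : ∀ {m n} → + m -ᶻ + n ≡ + 0 → m ≡ n
diff≡0 {m} {n} eq = ℤₚ.+-injective (ℤₚ.i-j≡0⇒i≡j (+ m) (+ n) eq)

cong-small : ∀ {d m n} → d ∣ᶻ + m -ᶻ + n → m < d → n < d → m ≡ n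
cong-small d∣ m<d n<d = diff≡0 (∣ᶻ-small d∣ (abs-diff-bound m<d n<d))

÷-close : ∀ {m n} d → 1 ≤ d → m ÷ d ≡ n ÷ d → abs (+ m -ᶻ + n) < d
÷-close {m} {n} d 1≤d eq = abs-diff-<
  (≤-trans (subst (λ q → m < d + q * d) eq (<-suc÷-* m d 1≤d)) (+-monoʳ-≤ d (÷-*-≤ n d)))
  (≤-trans (subst (λ q → n < d + q * d) (sym eq) (<-suc÷-* n d 1≤d)) (+-monoʳ-≤ d (÷-*-≤ m d)))

cong-÷ : ∀ {d m n} → 1 ≤ d → d ∣ᶻ + m -ᶻ + n → m ÷ d ≡ n ÷ d → m ≡ n
cong-÷ {d} 1≤d d∣ eq = diff≡0 (∣ᶻ-small d∣ (÷-close d 1≤d eq))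

pos-* : ∀ {m n} → 1 ≤ m → 1 ≤ n → 1 ≤ m * n
pos-* = *-mono-≤

pos-factorˡ : ∀ {m n k} → m * n ≡ k → 1 ≤ k → 1 ≤ m
pos-factorˡ {zero} refl ()
pos-factorˡ {suc _} _ _ = s≤s z≤n

pos-factorʳ : ∀ {m n k} → m * n ≡ k → 1 ≤ k → 1 ≤ n
pos-factorʳ {m} {n} eq = pos-factorˡ {n} {m} (trans (*-comm n m) eq)

∣-pos-≤ : ∀ {d n} → 1 ≤ n → d ∣ n → d ≤ n
∣-pos-≤ {n = suc _} _ d∣n = ∣⇒≤ d∣n

∣-pos : ∀ {d n} → 1 ≤ n → d ∣ n → 1 ≤ d
∣-pos 1≤n (divides q eq) = pos-factorʳ {q} (sym eq) 1≤n

record GCDView (m n : ℕ) : Set where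
  constructor gcdView
  field
    a b : ℕ
    m≡ : m ≡ gcd m n * a
    n≡ : n ≡ gcd m n * b
    coprime : Coprime a b

gcd-view : ∀ m n → 1 ≤ n → GCDView m n
gcd-view m n 1≤n = gcdView (m / g) (n / g) (eq (gcd[m,n]∣m m n)) (eq (gcd[m,n]∣n m n)) (coprime-/gcd m n)
  where
  g = gcd m n
  instance
    g≢0 : NonZero g
    g≢0 = >-nonZero (∣-pos 1≤n (gcd[m,n]∣n m n))
  eq : ∀ {k} → g ∣ k → k ≡ g * (k / g)
  eq {k} (divides q refl) = trans (*-comm q g) (cong (g *_) (sym (m*n/n≡m q g)))

-- Take d = gcd(|x|, n) and d′ = n / d. The cofactor depends on x alone, so one d′ serves every y;
-- `class-label` applies it to two values, and the order `t₀` of a lattice defect is such a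
-- cofactor.
∣ᶻ-split : ∀ {n} x → 1 ≤ n → ∃₂ λ d d′ → d * d′ ≡ n × d ∣ᶻ x × (∀ y → n ∣ᶻ x *ᶻ y → d′ ∣ᶻ y)
∣ᶻ-split {n} x 1≤n = g , b , sym n≡ , ∣⇒∣ᶻ x (gcd[m,n]∣m (abs x) n) , cofactor
  where
  open GCDView (gcd-view (abs x) n 1≤n)
  g = gcd (abs x) n
  cofactor : ∀ y → n ∣ᶻ x *ᶻ y → b ∣ᶻ y
  cofactor y n∣xy = ∣⇒∣ᶻ y (coprime-divisor (Coprimality.sym coprime)
    (*-cancelˡ-∣ g {{>-nonZero (∣-pos 1≤n (gcd[m,n]∣n (abs x) n))}}
      (subst₂ _∣_ n≡ (trans (ℤₚ.abs-* x y) (trans (cong (_* abs y) m≡) (*-assoc g a (abs y)))) (∣ᶻ⇒∣ n∣xy))))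

-- After division by the gcd the coprime parts satisfy a′² ∣ b′², which forces a′ = 1.
∣-sq : ∀ {a b} → 1 ≤ a → a * a ∣ b * b → a ∣ b
∣-sq {a} {b} 1≤a aa∣bb = subst (_∣ b) (sym a≡g) (gcd[m,n]∣m b a)
  where
  open GCDView (gcd-view b a 1≤a) renaming (a to b′; b to a′; m≡ to b≡; n≡ to a≡; coprime to cop)
  g = gcd b a
  1≤g : 1 ≤ g
  1≤g = ∣-pos 1≤a (gcd[m,n]∣n b a)
  regroup : ∀ g x → g * x * (g * x) ≡ g * g * (x * x)
  regroup = solve-∀
  a′a′∣b′b′ : a′ * a′ ∣ b′ * b′
  a′a′∣b′b′ = *-cancelˡ-∣ (g * g) {{>-nonZero (pos-* 1≤g 1≤g)}}
    (subst₂ _∣_ (trans (cong₂ _*_ a≡ a≡) (regroup g a′)) (trans (cong₂ _*_ b≡ b≡) (regroup g b′)) aa∣bb)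
  a′≡1 : a′ ≡ 1
  a′≡1 = cop (coprime-divisor (Coprimality.sym cop) (∣-trans (m∣m*n a′) a′a′∣b′b′) , ∣-refl)
  a≡g : a ≡ g
  a≡g = trans a≡ (trans (cong (g *_) a′≡1) (*-identityʳ g))

AtMost-[1‥] : ∀ n → AtMost n (λ k → 1 ≤ k × k ≤ n)
AtMost-[1‥] n = AtMost-injection pred (λ { {suc k} (_ , k<n) → k<n })
  (λ { {suc k} {suc l} _ _ refl → refl ; {zero} (() , _) ; {suc _} {zero} _ (() , _) }) (AtMost-< n)

-- The applications know that d divides 2x, 4x or a multiple of 2x, not x itself; counting through
-- `f` keeps the prime 2 from needing a separate treatment.
AtMost-multiples : ∀ {P : ℕ → Set} N d → 1 ≤ d →
  (f : ℕ → ℕ) → (∀ {x y} → f x ≡ f y → x ≡ y) →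
  (∀ {x} → P x → 1 ≤ f x × f x ≤ N × d ∣ f x) → AtMost (N ÷ d) P
AtMost-multiples {P} N d 1≤d f f-inj mult =
  AtMost-injection (λ x → f x ÷ d) into inj (AtMost-[1‥] (N ÷ d))
  where
  exact : ∀ {x} → P x → f x ÷ d * d ≡ f x
  exact {x} p with mult p
  ... | _ , _ , divides q eq rewrite eq = cong (_* d) (*-÷ q d 1≤d)
  into : ∀ {x} → P x → 1 ≤ f x ÷ d × f x ÷ d ≤ N ÷ d
  into p = pos-factorˡ (exact p) (proj₁ (mult p)) ,
    ÷-greatest d 1≤d (subst (_≤ N) (sym (exact p)) (proj₁ (proj₂ (mult p))))
  inj : ∀ {x y} → P x → P y → f x ÷ d ≡ f y ÷ d → x ≡ y
  inj px py eq = f-inj (trans (sym (exact px)) (trans (cong (_* d) eq) (exact py)))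

AtMost-spaced : ∀ {P : ℕ → Set} ℓ e → 1 ≤ ℓ → (∀ {x} → P x → x < e * ℓ) →
  (∀ {x y} → P x → P y → ℓ ∣ᶻ + x -ᶻ + y) → AtMost e P
AtMost-spaced ℓ e 1≤ℓ bound close = AtMost-injection (_÷ ℓ)
  (λ p → ÷-< ℓ 1≤ℓ (bound p)) (λ px py → cong-÷ 1≤ℓ (close px py)) (AtMost-< e)

lcm-least-∣ᶻ : ∀ {d d′} z → d ∣ᶻ z → d′ ∣ᶻ z → lcm d d′ ∣ᶻ z
lcm-least-∣ᶻ z d∣z d′∣z = ∣⇒∣ᶻ z (lcm-least (∣ᶻ⇒∣ d∣z) (∣ᶻ⇒∣ d′∣z))

lcm-pos : ∀ {d d′} → 1 ≤ d → 1 ≤ d′ → 1 ≤ lcm d d′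
lcm-pos {d} {d′} 1≤d 1≤d′ = pos-factorʳ {gcd d d′} (gcd*lcm d d′) (pos-* 1≤d 1≤d′)

-- All elements lie in one class modulo lcm(d, d′), and r = lcm(d, d′) · gcd(d, d′) · q. The factor
-- q is the part of the modulus that dd′ does not cover.
AtMost-two-moduli : ∀ {P : ℕ → Set} {r d d′ q} → d * d′ * q ≡ r → 1 ≤ r → (∀ {x} → P x → x < r) →
  (∀ {x y} → P x → P y → d ∣ᶻ + x -ᶻ + y × d′ ∣ᶻ + x -ᶻ + y) → AtMost (gcd d d′ * q) P
AtMost-two-moduli {P} {r} {d} {d′} {q} dd′q≡r 1≤r bound close =
  AtMost-spaced (lcm d d′) (gcd d d′ * q) (lcm-pos (pos-factorˡ {d} refl 1≤dd′) (pos-factorʳ {d} refl 1≤dd′))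
    (λ p → subst (_ <_) r≡ (bound p))
    (λ px py → lcm-least-∣ᶻ _ (proj₁ (close px py)) (proj₂ (close px py)))
  where
  1≤dd′ : 1 ≤ d * d′
  1≤dd′ = pos-factorˡ dd′q≡r 1≤r
  swap : ∀ a b c → a * c * b ≡ a * b * c
  swap = solve-∀
  r≡ : r ≡ gcd d d′ * q * lcm d d′
  r≡ = trans (sym dd′q≡r) (trans (cong (_* q) (sym (gcd*lcm d d′))) (swap (gcd d d′) q (lcm d d′)))

-- Two solutions x and y of d ∣ x - a, d′ ∣ x + a agree modulo both d and d′.
AtMost-roots : ∀ {r d d′ q} a → d * d′ * q ≡ r → 1 ≤ r →
  AtMost (gcd d d′ * q) (λ x → x < r × d ∣ᶻ + x -ᶻ a × d′ ∣ᶻ + x +ᶻ a)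
AtMost-roots a eq 1≤r = AtMost-two-moduli eq 1≤r proj₁
  λ {x} {y} (_ , p , p′) (_ , q , q′) →
    ∣ᶻ-lin (+ 1) (-ᶻ + 1) p q (minus (+ x) (+ y) a) , ∣ᶻ-lin (+ 1) (-ᶻ + 1) p′ q′ (plus (+ x) (+ y) a)
  where
  minus : ∀ x y a → x -ᶻ y ≡ + 1 *ᶻ (x -ᶻ a) +ᶻ (-ᶻ + 1) *ᶻ (y -ᶻ a)
  minus = ℤ-Solver.solve-∀
  plus : ∀ x y a → x -ᶻ y ≡ + 1 *ᶻ (x +ᶻ a) +ᶻ (-ᶻ + 1) *ᶻ (y +ᶻ a)
  plus = ℤ-Solver.solve-∀

-- With N = 4r one τ covers the divisors of r, of the numbers D₁ ≤ H² ≤ r on lattice lines, and of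
-- the multiples x ≤ 4M and y ≤ 2H in the labels.
DivisorBound : ℕ → ℕ → Set
DivisorBound N τ = ∀ n → 1 ≤ n → n ≤ N → AtMost τ (_∣ n)

AtMost-factorisations : ∀ {N τ n} → DivisorBound N τ → 1 ≤ n → n ≤ N →
  AtMost τ (λ ((d , d′) : ℕ × ℕ) → d * d′ ≡ n)
AtMost-factorisations {n = n} τ-bd 1≤n n≤N = AtMost-injection proj₁
  (λ { {d , d′} refl → m∣m*n d′ })
  (λ { {d , d′} {.d , e′} refl eq refl → cong (d ,_)
    (sym (*-cancelˡ-≡ e′ d′ d {{>-nonZero (pos-factorˡ {d} refl 1≤n)}} eq)) })
  (τ-bd n 1≤n n≤N)

module Search {P : ℕ → Set} (P? : ∀ n → Dec (P n)) where

  -- Chooses a reference element that depends on the predicate only and not on the element to be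
  -- compared with it. The default 0 is harmless: soundness is invoked only with a witness below the
  -- bound at hand.
  search : ℕ → ℕ
  search zero = 0
  search (suc n) with P? n
  ... | yes _ = n
  ... | no _ = search n

  search-sound : ∀ {x} n → x < n → P x → P (search n)
  search-sound (suc n) x<1+n px with P? n
  ... | yes pn = pn
  ... | no ¬pn with m≤n⇒m<n∨m≡n (≤-pred x<1+n)
  ...   | inj₁ x<n = search-sound n x<n px
  ...   | inj₂ refl = contradiction px ¬pn

-- The congruences satisfied by a pair of roots

-- Throughout, k₂ = a and k₁ ≡ a + l are the two roots, h = m₁ - m₂ and s = m₁ + m₂.
module Congruences {n : ℕ} (c j l : ℤ) where

  -- For k₂ = a and k₁ = a + l this is c(k₁² - k₂²) ≡ jh, and `Total` is c(k₁² + k₂²) ≡ js.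
  Difference : ℤ → ℤ → Set
  Difference a h = n ∣ᶻ c *ᶻ l *ᶻ (+ 2 *ᶻ a +ᶻ l) -ᶻ j *ᶻ h

  Total : ℤ → ℤ → Set
  Total a s = n ∣ᶻ c *ᶻ (+ 2 *ᶻ a *ᶻ a +ᶻ + 2 *ᶻ a *ᶻ l +ᶻ l *ᶻ l) -ᶻ j *ᶻ s

  Relation : ℤ → ℤ → Set
  Relation Δ D = n ∣ᶻ + 2 *ᶻ c *ᶻ l *ᶻ l *ᶻ Δ -ᶻ j *ᶻ D

  difference : ∀ k₁ a m h → n ∣ᶻ c *ᶻ (k₁ *ᶻ k₁) -ᶻ j *ᶻ (m +ᶻ h) → n ∣ᶻ c *ᶻ (a *ᶻ a) -ᶻ j *ᶻ m →
    n ∣ᶻ (k₁ -ᶻ a) -ᶻ l → Difference a h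
  difference k₁ a m h p q x = ∣ᶻ-lin₃ (+ 1) (-ᶻ + 1) (-ᶻ (c *ᶻ (k₁ +ᶻ a +ᶻ l))) p q x (identity c j l k₁ a m h)
    where
    identity : ∀ c j l k₁ a m h → c *ᶻ l *ᶻ (+ 2 *ᶻ a +ᶻ l) -ᶻ j *ᶻ h ≡
      + 1 *ᶻ (c *ᶻ (k₁ *ᶻ k₁) -ᶻ j *ᶻ (m +ᶻ h)) +ᶻ (-ᶻ + 1) *ᶻ (c *ᶻ (a *ᶻ a) -ᶻ j *ᶻ m) +ᶻ (-ᶻ (c *ᶻ (k₁ +ᶻ a +ᶻ l))) *ᶻ ((k₁ -ᶻ a) -ᶻ l)
    identity = ℤ-Solver.solve-∀

  total : ∀ k₁ a m h → n ∣ᶻ c *ᶻ (k₁ *ᶻ k₁) -ᶻ j *ᶻ (m +ᶻ h) → n ∣ᶻ c *ᶻ (a *ᶻ a) -ᶻ j *ᶻ m →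
    n ∣ᶻ (k₁ -ᶻ a) -ᶻ l → Total a (+ 2 *ᶻ m +ᶻ h)
  total k₁ a m h p q x = ∣ᶻ-lin₃ (+ 1) (+ 1) (-ᶻ (c *ᶻ (k₁ +ᶻ a +ᶻ l))) p q x (identity c j l k₁ a m h)
    where
    identity : ∀ c j l k₁ a m h → c *ᶻ (+ 2 *ᶻ a *ᶻ a +ᶻ + 2 *ᶻ a *ᶻ l +ᶻ l *ᶻ l) -ᶻ j *ᶻ (+ 2 *ᶻ m +ᶻ h) ≡
      + 1 *ᶻ (c *ᶻ (k₁ *ᶻ k₁) -ᶻ j *ᶻ (m +ᶻ h)) +ᶻ + 1 *ᶻ (c *ᶻ (a *ᶻ a) -ᶻ j *ᶻ m) +ᶻ (-ᶻ (c *ᶻ (k₁ +ᶻ a +ᶻ l))) *ᶻ ((k₁ -ᶻ a) -ᶻ l)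
    identity = ℤ-Solver.solve-∀

  -- The root is eliminated by 2(2a² + 2al + l²) = (2a + l)² + l²: this gives 2cl² · js ≡ (jh)² +
  -- c²l⁴, and the last term cancels between the two pairs. The factor j in front is removed later
  -- by coprimality.
  relation : ∀ a b s s′ h h′ → Difference a h → Difference b h′ → Total a s → Total b s′ →
    n ∣ᶻ j *ᶻ (+ 2 *ᶻ c *ᶻ l *ᶻ l *ᶻ (s -ᶻ s′) -ᶻ j *ᶻ (h *ᶻ h -ᶻ h′ *ᶻ h′))
  relation a b s s′ h h′ p p′ q q′ =
    ∣ᶻ-lin₃ (-ᶻ (+ 2 *ᶻ c *ᶻ l *ᶻ l)) (c *ᶻ l *ᶻ (+ 2 *ᶻ a +ᶻ l) +ᶻ j *ᶻ h) (-ᶻ (c *ᶻ l *ᶻ (+ 2 *ᶻ b +ᶻ l) +ᶻ j *ᶻ h′))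
      (∣ᶻ-lin (+ 1) (-ᶻ + 1) q q′ refl) p p′ (identity c j l a b s s′ h h′)
    where
    identity : ∀ c j l a b s s′ h h′ → j *ᶻ (+ 2 *ᶻ c *ᶻ l *ᶻ l *ᶻ (s -ᶻ s′) -ᶻ j *ᶻ (h *ᶻ h -ᶻ h′ *ᶻ h′)) ≡
      (-ᶻ (+ 2 *ᶻ c *ᶻ l *ᶻ l)) *ᶻ (+ 1 *ᶻ (c *ᶻ (+ 2 *ᶻ a *ᶻ a +ᶻ + 2 *ᶻ a *ᶻ l +ᶻ l *ᶻ l) -ᶻ j *ᶻ s)
                        +ᶻ (-ᶻ + 1) *ᶻ (c *ᶻ (+ 2 *ᶻ b *ᶻ b +ᶻ + 2 *ᶻ b *ᶻ l +ᶻ l *ᶻ l) -ᶻ j *ᶻ s′))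
        +ᶻ (c *ᶻ l *ᶻ (+ 2 *ᶻ a +ᶻ l) +ᶻ j *ᶻ h) *ᶻ (c *ᶻ l *ᶻ (+ 2 *ᶻ a +ᶻ l) -ᶻ j *ᶻ h)
        +ᶻ (-ᶻ (c *ᶻ l *ᶻ (+ 2 *ᶻ b +ᶻ l) +ᶻ j *ᶻ h′)) *ᶻ (c *ᶻ l *ᶻ (+ 2 *ᶻ b +ᶻ l) -ᶻ j *ᶻ h′)
    identity = ℤ-Solver.solve-∀

  -- Equal h gives 2cl(a - b) ≡ 0, while j(s - s′) ≡ 2c(a - b)(a + b + l). Multiplication of the
  -- latter by jh ≡ cl(2a + l) supplies the missing l.
  equal-differences : ∀ a b s s′ h → Difference a h → Difference b h → Total a s → Total b s′ →
    n ∣ᶻ j *ᶻ (j *ᶻ (h *ᶻ (s -ᶻ s′)))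
  equal-differences a b s s′ h p p′ q q′ =
    ∣ᶻ-lin₃ (c *ᶻ (+ 2 *ᶻ a +ᶻ l) *ᶻ (a +ᶻ b +ᶻ l) -ᶻ j *ᶻ (s -ᶻ s′)) (-ᶻ (c *ᶻ (+ 2 *ᶻ a +ᶻ l) *ᶻ (a +ᶻ b +ᶻ l))) (-ᶻ (c *ᶻ (+ 2 *ᶻ a +ᶻ l) *ᶻ l))
      p p′ (∣ᶻ-lin (+ 1) (-ᶻ + 1) q q′ refl) (identity c j l a b s s′ h)
    where
    identity : ∀ c j l a b s s′ h → j *ᶻ (j *ᶻ (h *ᶻ (s -ᶻ s′))) ≡
      (c *ᶻ (+ 2 *ᶻ a +ᶻ l) *ᶻ (a +ᶻ b +ᶻ l) -ᶻ j *ᶻ (s -ᶻ s′)) *ᶻ (c *ᶻ l *ᶻ (+ 2 *ᶻ a +ᶻ l) -ᶻ j *ᶻ h)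
        +ᶻ (-ᶻ (c *ᶻ (+ 2 *ᶻ a +ᶻ l) *ᶻ (a +ᶻ b +ᶻ l))) *ᶻ (c *ᶻ l *ᶻ (+ 2 *ᶻ b +ᶻ l) -ᶻ j *ᶻ h)
        +ᶻ (-ᶻ (c *ᶻ (+ 2 *ᶻ a +ᶻ l) *ᶻ l)) *ᶻ (+ 1 *ᶻ (c *ᶻ (+ 2 *ᶻ a *ᶻ a +ᶻ + 2 *ᶻ a *ᶻ l +ᶻ l *ᶻ l) -ᶻ j *ᶻ s)
                        +ᶻ (-ᶻ + 1) *ᶻ (c *ᶻ (+ 2 *ᶻ b *ᶻ b +ᶻ + 2 *ᶻ b *ᶻ l +ᶻ l *ᶻ l) -ᶻ j *ᶻ s′))
    identity = ℤ-Solver.solve-∀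

  parallel : ∀ Δ D Δ′ D′ → Relation Δ D → Relation Δ′ D′ → n ∣ᶻ j *ᶻ (D *ᶻ Δ′ -ᶻ D′ *ᶻ Δ)
  parallel Δ D Δ′ D′ p p′ = ∣ᶻ-lin (-ᶻ Δ′) Δ p p′ (identity c j l Δ D Δ′ D′)
    where
    identity : ∀ c j l Δ D Δ′ D′ → j *ᶻ (D *ᶻ Δ′ -ᶻ D′ *ᶻ Δ) ≡
      (-ᶻ Δ′) *ᶻ (+ 2 *ᶻ c *ᶻ l *ᶻ l *ᶻ Δ -ᶻ j *ᶻ D) +ᶻ Δ *ᶻ (+ 2 *ᶻ c *ᶻ l *ᶻ l *ᶻ Δ′ -ᶻ j *ᶻ D′)
    identity = ℤ-Solver.solve-∀

roots-agree : ∀ {n} c j k k′ m → n ∣ᶻ c *ᶻ (k *ᶻ k) -ᶻ j *ᶻ m → n ∣ᶻ c *ᶻ (k′ *ᶻ k′) -ᶻ j *ᶻ m →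
  n ∣ᶻ c *ᶻ ((k -ᶻ k′) *ᶻ (k +ᶻ k′))
roots-agree c j k k′ m p q = ∣ᶻ-lin (+ 1) (-ᶻ + 1) p q (identity c j k k′ m)
  where
  identity : ∀ c j k k′ m → c *ᶻ ((k -ᶻ k′) *ᶻ (k +ᶻ k′)) ≡
    + 1 *ᶻ (c *ᶻ (k *ᶻ k) -ᶻ j *ᶻ m) +ᶻ (-ᶻ + 1) *ᶻ (c *ᶻ (k′ *ᶻ k′) -ᶻ j *ᶻ m)
  identity = ℤ-Solver.solve-∀

-- Solutions

-- (k₁ , k₂ , m , h) stands for the roots k₁, k₂ of m₁ = m + h and m₂ = m.
Quad : Set
Quad = ℕ × ℕ × ℕ × ℕ

_≟²_ : DecidableEquality (ℕ × ℕ)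
_≟²_ = ≡-dec _≟_ _≟_

_≟⁴_ : DecidableEquality Quad
_≟⁴_ = ≡-dec _≟_ (≡-dec _≟_ _≟²_)

%ℕ-∣ : ∀ z r .{{_ : NonZero r}} → r ∣ᶻ z -ᶻ + (z %ℕ r)
%ℕ-∣ z r = S.divides (z /ℕ r) (trans (cong (_-ᶻ + (z %ℕ r)) (a≡a%ℕn+[a/ℕn]*n z r)) (cancel (+ (z %ℕ r)) _))
  where
  cancel : ∀ x y → (x +ᶻ y) -ᶻ x ≡ y
  cancel = ℤ-Solver.solve-∀

%ℕ-≡⇒∣ : ∀ x y r .{{_ : NonZero r}} → x %ℕ r ≡ y %ℕ r → r ∣ᶻ x -ᶻ y
%ℕ-≡⇒∣ x y r eq = ∣ᶻ-lin (+ 1) (-ᶻ + 1) (%ℕ-∣ x r) (subst (λ ρ → r ∣ᶻ y -ᶻ + ρ) (sym eq) (%ℕ-∣ y r)) (identity x y (+ (x %ℕ r)))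
  where
  identity : ∀ x y ρ → x -ᶻ y ≡ + 1 *ᶻ (x -ᶻ ρ) +ᶻ (-ᶻ + 1) *ᶻ (y -ᶻ ρ)
  identity = ℤ-Solver.solve-∀

∣⇒%ℕ-≡ : ∀ x y r .{{_ : NonZero r}} → r ∣ᶻ x -ᶻ y → x %ℕ r ≡ y %ℕ r
∣⇒%ℕ-≡ x y r r∣ = cong-small
  (∣ᶻ-lin₃ (+ 1) (-ᶻ + 1) (+ 1) r∣ (%ℕ-∣ x r) (%ℕ-∣ y r) (identity x y (+ (x %ℕ r)) (+ (y %ℕ r))))
  (n%ℕd<d x r) (n%ℕd<d y r)
  where
  identity : ∀ x y ρ σ → ρ -ᶻ σ ≡ + 1 *ᶻ (x -ᶻ y) +ᶻ (-ᶻ + 1) *ᶻ (x -ᶻ ρ) +ᶻ + 1 *ᶻ (y -ᶻ σ)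
  identity = ℤ-Solver.solve-∀

Coprime-∣ : ∀ {m n k} → m ∣ n → Coprime n k → Coprime m k
Coprime-∣ m∣n cop (d∣m , d∣k) = cop (∣-trans d∣m m∣n , d∣k)

gcd∣ᶻˡ : ∀ {d d′ z} → d ∣ᶻ z → gcd d d′ ∣ᶻ z
gcd∣ᶻˡ {d} {d′} = ∣-∣ᶻ-trans (gcd[m,n]∣m d d′)

gcd∣ᶻʳ : ∀ {d d′ z} → d′ ∣ᶻ z → gcd d d′ ∣ᶻ z
gcd∣ᶻʳ {d} {d′} = ∣-∣ᶻ-trans (gcd[m,n]∣n d d′)

gcd²∣ : ∀ {d d′ n} → d * d′ ≡ n → gcd d d′ * gcd d d′ ∣ n
gcd²∣ {d} {d′} refl = *-pres-∣ (gcd[m,n]∣m d d′) (gcd[m,n]∣n d d′)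

-- The gcd e divides (k + a) - (k - a) = 2a, so e² divides 4ca² ≡ 4jm modulo e². The factor e lost
-- in `AtMost-roots` is thereby paid for by the sparsity of m.
root-square : ∀ {r c j d d′ m} k a → Coprime r j → d * d′ ≡ r → d ∣ᶻ k -ᶻ a → d′ ∣ᶻ k +ᶻ a →
  r ∣ᶻ c *ᶻ (a *ᶻ a) -ᶻ + j *ᶻ + m → gcd d d′ * gcd d d′ ∣ 4 * m
root-square {r} {c} {j} {d} {d′} {m} k a cop eq d∣ d′∣ r∣ =
  subst (e * e ∣_) (ℤₚ.abs-* (+ 4) (+ m)) (∣ᶻ⇒∣ (∣ᶻ-cancel (Coprime-∣ ee∣r cop) (+ 4 *ᶻ + m)
    (∣ᶻ-lin c (-ᶻ + 4) (∣⇒∣ᶻ _ ee∣4aa) (∣-∣ᶻ-trans ee∣r r∣) (identity c (+ j) a (+ m)))))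
  where
  e = gcd d d′
  ee∣r = gcd²∣ {d} {d′} eq
  twice : ∀ k a → + 2 *ᶻ a ≡ + 1 *ᶻ (k +ᶻ a) +ᶻ (-ᶻ + 1) *ᶻ (k -ᶻ a)
  twice = ℤ-Solver.solve-∀
  e∣2a : e ∣ abs (+ 2 *ᶻ a)
  e∣2a = ∣ᶻ⇒∣ {e} {+ 2 *ᶻ a} (∣ᶻ-lin (+ 1) (-ᶻ + 1) (gcd∣ᶻʳ {d} d′∣) (gcd∣ᶻˡ {d} {d′} d∣) (twice k a))
  ee∣4aa : e * e ∣ abs ((+ 2 *ᶻ a) *ᶻ (+ 2 *ᶻ a))
  ee∣4aa = subst (e * e ∣_) (sym (ℤₚ.abs-* (+ 2 *ᶻ a) (+ 2 *ᶻ a))) (*-pres-∣ e∣2a e∣2a)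
  identity : ∀ c j a m → j *ᶻ (+ 4 *ᶻ m) ≡
    c *ᶻ ((+ 2 *ᶻ a) *ᶻ (+ 2 *ᶻ a)) +ᶻ (-ᶻ + 4) *ᶻ (c *ᶻ (a *ᶻ a) -ᶻ j *ᶻ m)
  identity = ℤ-Solver.solve-∀

-- The quotient e / gcd(e, 2) divides k₁, k₂ and r, hence equals 1.
primitive-double : ∀ {r k₁ k₂ e} → 1 ≤ r → (∀ {d} → d ∣ k₁ → d ∣ k₂ → d ∣ r → d ≡ 1) →
  e ∣ 2 * k₁ → e ∣ 2 * k₂ → e ∣ r → e ≤ 2
primitive-double {r} {k₁} {k₂} {e} 1≤r prim e∣2k₁ e∣2k₂ e∣r =
  ∣-pos-≤ (s≤s z≤n) (subst (_∣ 2) (sym e≡g) (gcd[m,n]∣n e 2))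
  where
  open GCDView (gcd-view e 2 (s≤s z≤n)) renaming (a to e′)
  g = gcd e 2
  reduce : ∀ {k} → e ∣ 2 * k → e′ ∣ k
  reduce {k} e∣2k = coprime-divisor coprime (*-cancelˡ-∣ g {{>-nonZero (∣-pos (s≤s z≤n) (gcd[m,n]∣n e 2))}}
    (subst₂ _∣_ m≡ (trans (cong (_* k) n≡) (*-assoc g b k)) e∣2k))
  e≡g : e ≡ g
  e≡g = trans m≡ (trans (cong (g *_)
    (prim (reduce e∣2k₁) (reduce e∣2k₂) (∣-trans (subst (e′ ∣_) (sym m≡) (n∣m*n g)) e∣r))) (*-identityʳ g))

module _ (M H : ℕ) where

  private
    bound : ∀ x e₁ e₂ → e₁ * e₂ ≤ x → 4 * M ÷ x * H * (e₁ * e₂) ≤ 4 * M * H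
    bound x e₁ e₂ le = begin
      4 * M ÷ x * H * (e₁ * e₂) ≤⟨ *-monoʳ-≤ (4 * M ÷ x * H) le ⟩
      4 * M ÷ x * H * x         ≡⟨ swap (4 * M ÷ x) H x ⟩
      4 * M ÷ x * x * H         ≤⟨ *-monoˡ-≤ H (÷-*-≤ (4 * M) x) ⟩
      4 * M * H                 ∎
      where
      open ≤-Reasoning
      swap : ∀ a b c → a * b * c ≡ a * c * b
      swap = solve-∀

    multiples : ∀ x → 1 ≤ x → AtMost (4 * M ÷ x * H) (λ ((m , h) : ℕ × ℕ) → (1 ≤ m × m ≤ M × x ∣ 4 * m) × (1 ≤ h × h ≤ H))
    multiples x 1≤x = AtMost-× _≟_
      (AtMost-multiples (4 * M) x 1≤x (4 *_) (λ {m} {n} → *-cancelˡ-≡ m n 4)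
        λ {m} (1≤m , m≤M , x∣) → ≤-trans 1≤m (m≤n*m m 4) , *-monoʳ-≤ 4 m≤M , x∣)
      (AtMost-[1‥] H)

  -- The larger of e₁, e₂ decides which of the two integers carries the divisibility.
  AtMost-root-pairs : (Near₁ Near₂ : ℕ → ℕ → Set) (e₁ e₂ : ℕ) → 1 ≤ e₁ → 1 ≤ e₂ →
    (∀ m → AtMost e₁ (Near₁ m)) → (∀ m → AtMost e₂ (Near₂ m)) →
    (∀ {m k} → Near₁ m k → e₁ * e₁ ∣ 4 * m) → (∀ {m k} → Near₂ m k → e₂ * e₂ ∣ 4 * m) →
    AtMost (4 * M * H) (λ ((k₁ , k₂ , m , h) : Quad) →
      (Near₁ (m + h) k₁ × Near₂ m k₂) × (1 ≤ m × m + h ≤ M) × (1 ≤ h × h ≤ H))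
  AtMost-root-pairs Near₁ Near₂ e₁ e₂ 1≤e₁ 1≤e₂ roots₁ roots₂ div₁ div₂ with ≤-total e₁ e₂
  ... | inj₁ e₁≤e₂ = AtMost-weaken (bound (e₂ * e₂) e₁ e₂ (*-monoˡ-≤ e₂ e₁≤e₂))
    (AtMost-fiber _≟²_ (λ t b → proj₂ (proj₂ t) ≡ b)
      (λ { {_ , _ , m , h} ((_ , n₂) , (1≤m , m+h≤M) , h-range) →
        (m , h) , ((1≤m , ≤-trans (m≤m+n m h) m+h≤M , div₂ n₂) , h-range) , refl })
      (multiples (e₂ * e₂) (pos-* 1≤e₂ 1≤e₂))
      λ { {m , h} _ → AtMost-injection (λ t → proj₁ t , proj₁ (proj₂ t))
        (λ { ((n , _) , refl) → n })
        (λ { (_ , refl) (_ , refl) refl → refl })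
        (AtMost-× _≟_ (roots₁ (m + h)) (roots₂ m)) })
  ... | inj₂ e₂≤e₁ = AtMost-weaken (bound (e₁ * e₁) e₁ e₂ (*-monoʳ-≤ e₁ e₂≤e₁))
    -- Here the divisibility sits on m₁ = m + h, so m₁ replaces m in the label and m is recovered by
    -- subtracting h.
    (AtMost-fiber _≟²_ (λ t b → sum t ≡ b)
      (λ { {_ , _ , m , h} ((n₁ , _) , (1≤m , m+h≤M) , h-range) →
        (m + h , h) , ((≤-trans 1≤m (m≤m+n m h) , m+h≤M , div₁ n₁) , h-range) , refl })
      (multiples (e₁ * e₁) (pos-* 1≤e₁ 1≤e₁))
      λ { {x , h} _ → AtMost-injection (λ t → proj₁ t , proj₁ (proj₂ t))
        (λ { {_ , _ , m , _} (((n₁ , n₂) , _) , refl) → n₁ , subst (λ y → Near₂ y _) (sym (m+n∸n≡m m h)) n₂ })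
        (λ { {k₁ , k₂ , m , .h} {_ , _ , m′ , h′} (_ , refl) (_ , eq) refl →
          cong (λ y → k₁ , k₂ , y) (inj m m′ h h′ eq) })
        (AtMost-× _≟_ (roots₁ x) (roots₂ (x ∸ h))) })
    where
    sum : Quad → ℕ × ℕ
    sum (_ , _ , m , h) = m + h , h
    inj : ∀ m m′ h h′ → (m′ + h′ , h′) ≡ (m + h , h) → (m , h) ≡ (m′ , h′)
    inj m m′ h h′ eq with cong proj₂ eq
    ... | refl = cong (_, h) (sym (+-cancelʳ-≡ h m′ m (cong proj₁ eq)))

-- Solutions for one modulus and their total number

module Solutions (r c j M H : ℕ) .{{_ : NonZero r}} (cop-c : Coprime r c) (cop-j : Coprime r j) where

  1≤r : 1 ≤ r
  1≤r = >-nonZero⁻¹ r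

  -- A record rather than a synonym, so that m and k can be inferred by unification.
  record IsRoot (m k : ℕ) : Set where
    constructor isRoot
    field root-∣ : r ∣ᶻ + c *ᶻ (+ k *ᶻ + k) -ᶻ + j *ᶻ + m
  open IsRoot

  IsRoot? : ∀ m k → Dec (IsRoot m k)
  IsRoot? m k = map′ isRoot root-∣ ((+ r) S.∣? (+ c *ᶻ (+ k *ᶻ + k) -ᶻ + j *ᶻ + m))

  split-roots : ∀ m k a → IsRoot m k → IsRoot m a →
    ∃ λ ((d , d′) : ℕ × ℕ) → d * d′ ≡ r × d ∣ᶻ + k -ᶻ + a × d′ ∣ᶻ + k +ᶻ + a
  split-roots m k a root root′ =
    let (d , d′ , eq , d∣ , d′∣) = ∣ᶻ-split (+ k -ᶻ + a) 1≤r in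
    (d , d′) , eq , d∣ , d′∣ (+ k +ᶻ + a) (∣ᶻ-cancel cop-c ((+ k -ᶻ + a) *ᶻ (+ k +ᶻ + a)) (roots-agree (+ c) (+ j) (+ k) (+ a) (+ m) (root-∣ root) (root-∣ root′)))

  record Solution (t : Quad) : Set where
    constructor solution
    k₁ = proj₁ t
    k₂ = proj₁ (proj₂ t)
    m = proj₁ (proj₂ (proj₂ t))
    h = proj₂ (proj₂ (proj₂ t))
    field
      k₁< : k₁ < r
      k₂< : k₂ < r
      1≤m : 1 ≤ m
      m+h≤M : m + h ≤ M
      1≤h : 1 ≤ h
      h≤H : h ≤ H
      root₁ : IsRoot (m + h) k₁
      root₂ : IsRoot m k₂

  Primitive : Quad → Set
  Primitive (k₁ , k₂ , _) = ∀ {d} → d ∣ k₁ → d ∣ k₂ → d ∣ r → d ≡ 1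

  shift : Quad → ℕ
  shift (k₁ , k₂ , _) = (+ k₁ -ᶻ + k₂) %ℕ r

  shift-∣ : ∀ t → r ∣ᶻ (+ proj₁ t -ᶻ + proj₁ (proj₂ t)) -ᶻ + shift t
  shift-∣ (k₁ , k₂ , _) = %ℕ-∣ (+ k₁ -ᶻ + k₂) r

  k₁-determined : ∀ k₂ {k₁ k₁′} → k₁ < r → k₁′ < r → (+ k₁ -ᶻ + k₂) %ℕ r ≡ (+ k₁′ -ᶻ + k₂) %ℕ r → k₁ ≡ k₁′
  k₁-determined k₂ {k₁} {k₁′} k₁< k₁′< eq = cong-small
    (∣ᶻ-* (+ 1) (%ℕ-≡⇒∣ (+ k₁ -ᶻ + k₂) (+ k₁′ -ᶻ + k₂) r eq) (identity (+ k₁) (+ k₁′) (+ k₂))) k₁< k₁′<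
    where
    identity : ∀ x y z → x -ᶻ y ≡ + 1 *ᶻ ((x -ᶻ z) -ᶻ (y -ᶻ z))
    identity = ℤ-Solver.solve-∀

  cancel-j : ∀ {z} → r ∣ᶻ + j *ᶻ z → r ∣ᶻ z
  cancel-j = ∣ᶻ-cancel cop-j _

  module Facts {t : Quad} (sol : Solution t) where
    open Solution sol
    open Congruences {r} (+ c) (+ j) (+ shift t)
    diff : Difference (+ k₂) (+ h)
    diff = difference (+ k₁) (+ k₂) (+ m) (+ h) (root-∣ root₁) (root-∣ root₂) (shift-∣ t)
    tot : Total (+ k₂) (+ 2 *ᶻ + m +ᶻ + h)
    tot = total (+ k₁) (+ k₂) (+ m) (+ h) (root-∣ root₁) (root-∣ root₂) (shift-∣ t)

  module Counting {τ} (τ-bd : DivisorBound (4 * r) τ) where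

    factorisations : AtMost τ (λ ((d , d′) : ℕ × ℕ) → d * d′ ≡ r)
    factorisations = AtMost-factorisations τ-bd 1≤r (m≤n*m r 4)

    -- Each root is compared with the reference root of its own m, and the label records the two
    -- resulting factorisations of r. For one label the e₁e₂ choices of roots are offset by e₁² ∣
    -- 4m₁ or e₂² ∣ 4m₂.
    AtMost-Solution : AtMost (τ * τ * (4 * M * H)) Solution
    AtMost-Solution = AtMost-fiber (≡-dec _≟²_ _≟²_) R label
      (AtMost-× _≟²_ factorisations factorisations) fib
      where
      base : ℕ → ℕ
      base m = Search.search (IsRoot? m) r

      base-root : ∀ {m k} → k < r → IsRoot m k → IsRoot m (base m)
      base-root {m} = Search.search-sound (IsRoot? m) r

      Near : ℕ × ℕ → ℕ → ℕ → Set
      Near (d , d′) m k = (k < r × d ∣ᶻ + k -ᶻ + base m × d′ ∣ᶻ + k +ᶻ + base m) × IsRoot m k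

      R : Quad → (ℕ × ℕ) × (ℕ × ℕ) → Set
      R (k₁ , k₂ , m , h) (f₁ , f₂) = Near f₁ (m + h) k₁ × Near f₂ m k₂

      Factors : ℕ × ℕ → Set
      Factors (d , d′) = d * d′ ≡ r

      near : ∀ m {k} → k < r → IsRoot m k → ∃ λ f → Factors f × Near f m k
      near m {k} k< root =
        let (f , eq , close) = split-roots m k (base m) root (base-root k< root)
        in f , eq , (k< , close) , root

      label : ∀ {t} → Solution t → ∃ λ f → (Factors (proj₁ f) × Factors (proj₂ f)) × R t f
      label sol =
        let open Solution sol
            (f₁ , eq₁ , n₁) = near _ k₁< root₁
            (f₂ , eq₂ , n₂) = near _ k₂< root₂
        in (f₁ , f₂) , (eq₁ , eq₂) , n₁ , n₂

      e : ℕ × ℕ → ℕ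
      e (d , d′) = gcd d d′

      1≤e : ∀ f → Factors f → 1 ≤ e f
      1≤e (d , d′) eq = ∣-pos (pos-factorˡ {d} eq 1≤r) (gcd[m,n]∣m d d′)

      roots : ∀ {f} → Factors f → ∀ m → AtMost (e f) (Near f m)
      roots {d , d′} eq m = AtMost-weaken (≤-reflexive (*-identityʳ (gcd d d′)))
        (AtMost-⊆ proj₁ (AtMost-roots (+ base m) (trans (*-identityʳ (d * d′)) eq) 1≤r))

      divisible : ∀ {f} → Factors f → ∀ {m k} → Near f m k → e f * e f ∣ 4 * m
      divisible eq {m} {k} ((k< , d∣ , d′∣) , root) =
        root-square {c = + c} {m = m} (+ k) (+ base m) cop-j eq d∣ d′∣ (root-∣ (base-root k< root))

      fib : ∀ {f} → Factors (proj₁ f) × Factors (proj₂ f) → AtMost (4 * M * H) (λ t → Solution t × R t f)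
      fib {f₁ , f₂} (eq₁ , eq₂) = AtMost-⊆
        (λ (sol , n) → let open Solution sol in n , (1≤m , m+h≤M) , 1≤h , h≤H)
        (AtMost-root-pairs M H (Near f₁) (Near f₂) (e f₁) (e f₂) (1≤e f₁ eq₁) (1≤e f₂ eq₂)
          (roots eq₁) (roots eq₂) (divisible eq₁) (divisible eq₂))

-- Solutions with a prescribed difference of roots

module Classes (r c j M H : ℕ) .{{_ : NonZero r}} (cop-c : Coprime r c) (cop-j : Coprime r j)
  {τ : ℕ} (τ-bd : DivisorBound (4 * r) τ) where

  open Solutions r c j M H cop-c cop-j
  open Counting τ-bd

  ∣ᶻ-double : ∀ {e} k → e ∣ᶻ + 2 *ᶻ + k → e ∣ 2 * k
  ∣ᶻ-double k e∣ = subst (_ ∣_) (ℤₚ.abs-* (+ 2) (+ k)) (∣ᶻ⇒∣ e∣)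

  private
    -- Since k ≡ a + l and k′ ≡ a′ + l, the factors k - k′ and k + k′ become a - a′ and a + a′ + 2l.
    shifted-roots : ∀ k a k′ a′ l → r ∣ᶻ (k -ᶻ a) -ᶻ l → r ∣ᶻ (k′ -ᶻ a′) -ᶻ l →
      r ∣ᶻ + c *ᶻ ((k -ᶻ k′) *ᶻ (k +ᶻ k′)) → r ∣ᶻ + c *ᶻ ((a -ᶻ a′) *ᶻ ((a +ᶻ a′) +ᶻ + 2 *ᶻ l))
    shifted-roots k a k′ a′ l p q s = ∣ᶻ-lin₃ (+ 1)
      (-ᶻ (+ c *ᶻ ((k -ᶻ k′) +ᶻ ((a +ᶻ a′) +ᶻ + 2 *ᶻ l))))
      (+ c *ᶻ (((a +ᶻ a′) +ᶻ + 2 *ᶻ l) -ᶻ (k -ᶻ k′))) s p q (identity (+ c) k a k′ a′ l)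
      where
      identity : ∀ c k a k′ a′ l → c *ᶻ ((a -ᶻ a′) *ᶻ ((a +ᶻ a′) +ᶻ + 2 *ᶻ l)) ≡
        + 1 *ᶻ (c *ᶻ ((k -ᶻ k′) *ᶻ (k +ᶻ k′)))
        +ᶻ (-ᶻ (c *ᶻ ((k -ᶻ k′) +ᶻ ((a +ᶻ a′) +ᶻ + 2 *ᶻ l)))) *ᶻ ((k -ᶻ a) -ᶻ l)
        +ᶻ (c *ᶻ (((a +ᶻ a′) +ᶻ + 2 *ᶻ l) -ᶻ (k -ᶻ k′))) *ᶻ ((k′ -ᶻ a′) -ᶻ l)
      identity = ℤ-Solver.solve-∀

    twice-a : ∀ {e} a a′ → e ∣ᶻ a -ᶻ a′ → e ∣ᶻ a +ᶻ a′ → e ∣ᶻ + 2 *ᶻ a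
    twice-a a a′ p q = ∣ᶻ-lin (+ 1) (+ 1) p q (identity a a′)
      where
      identity : ∀ a a′ → + 2 *ᶻ a ≡ + 1 *ᶻ (a -ᶻ a′) +ᶻ + 1 *ᶻ (a +ᶻ a′)
      identity = ℤ-Solver.solve-∀

    twice-k : ∀ {e} k a a′ l → e ∣ᶻ a -ᶻ a′ → e ∣ᶻ (a +ᶻ a′) +ᶻ + 2 *ᶻ l → e ∣ᶻ (k -ᶻ a) -ᶻ l → e ∣ᶻ + 2 *ᶻ k
    twice-k k a a′ l p q s = ∣ᶻ-lin₃ (+ 1) (+ 1) (+ 2) p q s (identity k a a′ l)
      where
      identity : ∀ k a a′ l → + 2 *ᶻ k ≡
        + 1 *ᶻ (a -ᶻ a′) +ᶻ + 1 *ᶻ ((a +ᶻ a′) +ᶻ + 2 *ᶻ l) +ᶻ + 2 *ᶻ ((k -ᶻ a) -ᶻ l)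
      identity = ℤ-Solver.solve-∀

  InClass : ℕ → ℕ × ℕ → Quad → Set
  InClass l mh t = (Solution t × Primitive t) × shift t ≡ l × proj₂ (proj₂ t) ≡ mh

  private
    Near : ℕ → Quad → ℕ × ℕ → Set
    Near a (_ , k₂ , _) (d , d′) = d ∣ᶻ + k₂ -ᶻ + a × d′ ∣ᶻ + k₂ +ᶻ + a

    Small : ℕ × ℕ → Set
    Small (d , d′) = d * d′ ≡ r × gcd d d′ ≤ 2

    -- The comparison of k₁ with k₀ and that of k₂ = a with a₀ lead to products with the same factor
    -- a - a₀. So d′ divides both a + a₀ and a + a₀ + 2l, and gcd(d, d′) divides 2k₁, 2k₂ and r;
    -- primitivity bounds it by 2.
    class-label : ∀ {l mh t₀ t} → InClass l mh t₀ → InClass l mh t → ∃ λ f → Small f × Near (proj₁ (proj₂ t₀)) t f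
    class-label {l} {m , h} {k₀ , a₀ , _} {k , a , _} ((sol₀ , _) , refl , refl) ((sol , prim) , sh , refl) =
      (d , d′) , (eq , gcd≤2) , d∣ , d′∣sum
      where
      module S₀ = Solution sol₀
      module S₁ = Solution sol
      open IsRoot
      split = ∣ᶻ-split (+ a -ᶻ + a₀) 1≤r
      d = proj₁ split
      d′ = proj₁ (proj₂ split)
      eq = proj₁ (proj₂ (proj₂ split))
      d∣ = proj₁ (proj₂ (proj₂ (proj₂ split)))
      cofactor = proj₂ (proj₂ (proj₂ (proj₂ split)))
      e = gcd d d′
      l∣ : r ∣ᶻ (+ k -ᶻ + a) -ᶻ + l
      l∣ = subst (λ y → r ∣ᶻ (+ k -ᶻ + a) -ᶻ + y) sh (shift-∣ (k , a , m , h))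
      l₀∣ : r ∣ᶻ (+ k₀ -ᶻ + a₀) -ᶻ + l
      l₀∣ = shift-∣ (k₀ , a₀ , m , h)
      d′∣sum : d′ ∣ᶻ + a +ᶻ + a₀
      d′∣sum = cofactor (+ a +ᶻ + a₀) (∣ᶻ-cancel cop-c ((+ a -ᶻ + a₀) *ᶻ (+ a +ᶻ + a₀))
        (roots-agree (+ c) (+ j) (+ a) (+ a₀) (+ m) (root-∣ S₁.root₂) (root-∣ S₀.root₂)))
      d′∣shifted : d′ ∣ᶻ (+ a +ᶻ + a₀) +ᶻ + 2 *ᶻ + l
      d′∣shifted = cofactor ((+ a +ᶻ + a₀) +ᶻ + 2 *ᶻ + l) (∣ᶻ-cancel cop-c ((+ a -ᶻ + a₀) *ᶻ ((+ a +ᶻ + a₀) +ᶻ + 2 *ᶻ + l))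
        (shifted-roots (+ k) (+ a) (+ k₀) (+ a₀) (+ l) l∣ l₀∣
          (roots-agree (+ c) (+ j) (+ k) (+ k₀) (+ (m + h)) (root-∣ S₁.root₁) (root-∣ S₀.root₁))))
      e∣r : e ∣ r
      e∣r = ∣-trans (m∣m*n e) (gcd²∣ {d} {d′} eq)
      gcd≤2 : e ≤ 2
      gcd≤2 = primitive-double 1≤r prim
        (∣ᶻ-double k (twice-k (+ k) (+ a) (+ a₀) (+ l) (gcd∣ᶻˡ {d} {d′} d∣) (gcd∣ᶻʳ {d} d′∣shifted) (∣-∣ᶻ-trans e∣r l∣)))
        (∣ᶻ-double a (twice-a (+ a) (+ a₀) (gcd∣ᶻˡ {d} {d′} d∣) (gcd∣ᶻʳ {d} d′∣sum)))
        e∣r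

  AtMost-InClass : ∀ l mh → AtMost (τ * 2) (InClass l mh)
  AtMost-InClass l mh = AtMost-rebase λ {t₀} p₀ →
    AtMost-fiber _≟²_ (Near (proj₁ (proj₂ t₀))) (class-label p₀)
      (AtMost-⊆ proj₁ factorisations)
      λ {f} (eq , e≤2) → AtMost-weaken (≤-trans (≤-reflexive (*-identityʳ _)) e≤2)
        (AtMost-injection (λ t → proj₁ (proj₂ t))
          (λ (((sol , _) , _) , near) → Solution.k₂< sol , near)
          inj
          (AtMost-roots {q = 1} (+ proj₁ (proj₂ t₀)) (trans (*-identityʳ _) eq) 1≤r))
    where
    inj : ∀ {P : Quad → Set} {x y} → InClass l mh x × P x → InClass l mh y × P y → proj₁ (proj₂ x) ≡ proj₁ (proj₂ y) → x ≡ y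
    inj {x = _ , k₂ , _} (((sol , _) , sh , refl) , _) (((sol′ , _) , sh′ , refl) , _) refl =
      cong (λ k → k , k₂ , mh) (k₁-determined k₂ (Solution.k₁< sol) (Solution.k₁< sol′) (trans sh (sym sh′)))

  double-shift : ∀ {l t t′} → Solution t → Solution t′ → shift t ≡ l → shift t′ ≡ l → proj₂ (proj₂ (proj₂ t)) ≡ proj₂ (proj₂ (proj₂ t′)) →
    r ∣ᶻ + 2 *ᶻ + l *ᶻ (+ proj₁ (proj₂ t) -ᶻ + proj₁ (proj₂ t′))
  double-shift {t = t@(_ , a , _ , h)} {t′@(_ , b , _ , .h)} sol sol′ refl sh′ refl =
    ∣ᶻ-cancel cop-c (+ 2 *ᶻ + l *ᶻ (+ a -ᶻ + b))
      (∣ᶻ-lin (+ 1) (-ᶻ + 1) (Facts.diff sol) diff′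
        (identity (+ c) (+ j) (+ l) (+ a) (+ b) (+ h)))
    where
    l = shift t
    diff′ : Congruences.Difference (+ c) (+ j) (+ l) (+ b) (+ h)
    diff′ = subst (λ y → Congruences.Difference (+ c) (+ j) (+ y) (+ b) (+ h)) sh′ (Facts.diff sol′)
    identity : ∀ c j l a b h → c *ᶻ (+ 2 *ᶻ l *ᶻ (a -ᶻ b)) ≡
      + 1 *ᶻ (c *ᶻ l *ᶻ (+ 2 *ᶻ a +ᶻ l) -ᶻ j *ᶻ h) +ᶻ (-ᶻ + 1) *ᶻ (c *ᶻ l *ᶻ (+ 2 *ᶻ b +ᶻ l) -ᶻ j *ᶻ h)
    identity = ℤ-Solver.solve-∀

  m-determined : ∀ {m m′ k} → M ≤ r → 1 ≤ m → m ≤ M → 1 ≤ m′ → m′ ≤ M → IsRoot m k → IsRoot m′ k → m ≡ m′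
  m-determined {suc m} {suc m′} {k} M≤r 1≤m m≤M 1≤m′ m′≤M root root′ =
    diff≡0 (∣ᶻ-small (cancel-j (∣ᶻ-lin (-ᶻ + 1) (+ 1) (root-∣ root) (root-∣ root′) (identity (+ c) (+ j) (+ k) (+ suc m) (+ suc m′))))
      (abs-diff-< (close m′ m≤M) (close m m′≤M)))
    where
    open IsRoot
    close : ∀ {x} y → x ≤ M → x < r + suc y
    close y x≤M = ≤-<-trans (≤-trans x≤M M≤r) (m<m+n r (s≤s z≤n))
    identity : ∀ c j k m m′ → j *ᶻ (m -ᶻ m′) ≡ (-ᶻ + 1) *ᶻ (c *ᶻ (k *ᶻ k) -ᶻ j *ᶻ m) +ᶻ + 1 *ᶻ (c *ᶻ (k *ᶻ k) -ᶻ j *ᶻ m′)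
    identity = ℤ-Solver.solve-∀

  -- Let g = gcd(2l, r). From jh ≡ cl(2a + l) one gets g ∣ 2h, which leaves 2H / g values of h. For
  -- each of them `double-shift` fixes a modulo r / g, that is, up to g values, and a determines k₁
  -- and m.
  AtMost-shift : M ≤ r → ∀ l → AtMost (2 * H) (λ t → Solution t × shift t ≡ l)
  AtMost-shift M≤r l = AtMost-weaken (÷-*-≤ (2 * H) g)
    (AtMost-fiber _≟_ (λ t h → proj₂ (proj₂ (proj₂ t)) ≡ h)
      (λ {t} (sol , sh) → let open Solution sol in h , (1≤h , h≤H , g∣2h sol sh) , refl)
      (AtMost-multiples (2 * H) g 1≤g (2 *_) (λ {x} {y} → *-cancelˡ-≡ x y 2)
        (λ {h} (1≤h , h≤H , g∣) → ≤-trans 1≤h (m≤n*m h 2) , *-monoʳ-≤ 2 h≤H , g∣))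
      λ {h} _ → AtMost-fiber-h h)
    where
    open GCDView (gcd-view (2 * l) r 1≤r)
    open IsRoot
    g = gcd (2 * l) r
    1≤g : 1 ≤ g
    1≤g = ∣-pos 1≤r (gcd[m,n]∣n (2 * l) r)
    1≤b : 1 ≤ b
    1≤b = pos-factorʳ {g} (sym n≡) 1≤r
    g∣2l : g ∣ᶻ + 2 *ᶻ + l
    g∣2l = ∣⇒∣ᶻ (+ 2 *ᶻ + l) (subst (g ∣_) (sym (ℤₚ.abs-* (+ 2) (+ l))) (gcd[m,n]∣m (2 * l) r))
    g∣2h : ∀ {t} → Solution t → shift t ≡ l → g ∣ 2 * proj₂ (proj₂ (proj₂ t))
    g∣2h {t@(_ , a , _ , h)} sol sh = ∣ᶻ-double h (∣ᶻ-cancel (Coprime-∣ (gcd[m,n]∣n (2 * l) r) cop-j) (+ 2 *ᶻ + h)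
      (∣ᶻ-lin (+ c *ᶻ (+ 2 *ᶻ + a +ᶻ + l)) (-ᶻ + 2) g∣2l
        (∣-∣ᶻ-trans (gcd[m,n]∣n (2 * l) r) (subst (λ y → Congruences.Difference (+ c) (+ j) (+ y) (+ a) (+ h)) sh (Facts.diff sol)))
        (identity (+ c) (+ j) (+ l) (+ a) (+ h))))
      where
      identity : ∀ c j l a h → j *ᶻ (+ 2 *ᶻ h) ≡
        (c *ᶻ (+ 2 *ᶻ a +ᶻ l)) *ᶻ (+ 2 *ᶻ l) +ᶻ (-ᶻ + 2) *ᶻ (c *ᶻ l *ᶻ (+ 2 *ᶻ a +ᶻ l) -ᶻ j *ᶻ h)
      identity = ℤ-Solver.solve-∀
    b∣ : ∀ z → r ∣ᶻ + 2 *ᶻ + l *ᶻ z → b ∣ᶻ z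
    b∣ z r∣ = ∣⇒∣ᶻ z (coprime-divisor (Coprimality.sym coprime)
      (*-cancelˡ-∣ g {{>-nonZero 1≤g}} (subst₂ _∣_ n≡
        (trans (ℤₚ.abs-* (+ 2 *ᶻ + l) z) (trans (cong (_* abs z) (trans (ℤₚ.abs-* (+ 2) (+ l)) m≡)) (*-assoc g a (abs z))))
        (∣ᶻ⇒∣ r∣))))
    AtMost-fiber-h : ∀ h → AtMost g (λ t → (Solution t × shift t ≡ l) × proj₂ (proj₂ (proj₂ t)) ≡ h)
    AtMost-fiber-h h = AtMost-injection (λ t → proj₁ (proj₂ t))
      {Q = λ k → ∃ λ t → (Solution t × shift t ≡ l) × proj₂ (proj₂ (proj₂ t)) ≡ h × k ≡ proj₁ (proj₂ t)}
      (λ {t} (p , eq) → t , p , eq , refl)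
      inj
      (AtMost-spaced b g 1≤b
        (λ { (_ , (sol , _) , _ , refl) → subst (_ <_) n≡ (Solution.k₂< sol) })
        (λ { (t , (sol , sh) , eq , refl) (t′ , (sol′ , sh′) , eq′ , refl) →
          b∣ _ (double-shift sol sol′ sh sh′ (trans eq (sym eq′))) }))
      where
      inj : ∀ {x y} → (Solution x × shift x ≡ l) × proj₂ (proj₂ (proj₂ x)) ≡ h → (Solution y × shift y ≡ l) × proj₂ (proj₂ (proj₂ y)) ≡ h →
        proj₁ (proj₂ x) ≡ proj₁ (proj₂ y) → x ≡ y
      inj {k₁ , k₂ , m , _} {k₁′ , .k₂ , m′ , _} ((sol , sh) , refl) ((sol′ , sh′) , refl) refl =
        cong₂ (λ x y → x , k₂ , y , h) (k₁-determined k₂ X.k₁< Y.k₁< (trans sh (sym sh′)))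
          (m-determined M≤r X.1≤m (≤-trans (m≤m+n _ _) X.m+h≤M) Y.1≤m (≤-trans (m≤m+n _ _) Y.m+h≤M) X.root₂ Y.root₂)
        where
        module X = Solution sol
        module Y = Solution sol′

-- Counting lattice lines

AtMost-ℤ-divisors : ∀ {τ x} → AtMost τ (_∣ x) → AtMost (τ * 2) (λ z → abs z ∣ x)
AtMost-ℤ-divisors bd = AtMost-fiber _≟_ (λ z n → abs z ≡ n) (λ {z} z∣x → abs z , z∣x , refl) bd
  λ {n} _ → AtMost-⊆ (λ (_ , eq) → signs eq)
    (AtMost-⊎ (AtMost-subsingleton {P = _≡ + n} λ { refl refl → refl })
      (AtMost-subsingleton {P = _≡ -ᶻ + n} λ { refl refl → refl }))
  where
  signs : ∀ {z n} → abs z ≡ n → z ≡ + n ⊎ z ≡ -ᶻ + n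
  signs {+ n} refl = inj₁ refl
  signs { -[1+ n ]} refl = inj₂ refl

module Labels (r c j M H K : ℕ) .{{_ : NonZero r}} (cop-c : Coprime r c) (cop-j : Coprime r j)
  (M≤r : M ≤ r) (H≤r : H ≤ r) (1≤K : 1 ≤ K) {τ : ℕ} (τ-bd : DivisorBound (4 * r) τ) where

  private
    1≤r : 1 ≤ r
    1≤r = >-nonZero⁻¹ r

  record LatticeVector (v : ℤ × ℕ × ℕ) (l : ℕ) : Set where
    constructor latticeVector
    field relation : Congruences.Relation {r} (+ c) (+ j) (+ l) (proj₁ v) (+ (proj₁ (proj₂ v) * proj₂ (proj₂ v)))
  open LatticeVector

  LatticeVector? : ∀ v l → Dec (LatticeVector v l)
  LatticeVector? (Δ , δ , δ′) l = map′ latticeVector relation ((+ r) S.∣? (+ 2 *ᶻ + c *ᶻ + l *ᶻ + l *ᶻ Δ -ᶻ + j *ᶻ + (δ * δ′)))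

  Bounds : ℕ × ℕ → Set
  Bounds (x , y) = (1 ≤ x × K * x ≤ 4 * M) × (1 ≤ y × y ≤ 2 * H)

  Divides : ℤ × ℕ × ℕ → ℕ × ℕ → Set
  Divides (Δ , δ , δ′) (x , y) = abs Δ ∣ x × δ ∣ y × δ′ ∣ y

  -- (l , (Δ , δ , δ′) , (x , y)): x and y are multiples of Δ and of lcm δ δ′ that locate
  -- s′ in its block and h in [1, H].
  Label : Set
  Label = ℕ × (ℤ × ℕ × ℕ) × (ℕ × ℕ)

  IsLabel : Label → Set
  IsLabel (l , v , xy) = (l < r × LatticeVector v l) × Bounds xy × Divides v xy

  _≟ᵛ_ : DecidableEquality ((ℤ × ℕ × ℕ) × (ℕ × ℕ))
  _≟ᵛ_ = ≡-dec (≡-dec ℤ._≟_ _≟²_) _≟²_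

  -- For given q, d, d′ and e = gcd(d, d′) there are 8M / (Kq) values of x, 4H / e values of y, 2τ ·
  -- τ² vectors and eq values of l; in the product e and q cancel.
  factor-bound : ℕ
  factor-bound = 8 * M * (4 * H) * (τ * 2 * (τ * τ)) ÷ K

  private
    Factors : ℕ × ℕ × ℕ → Set
    Factors (q , d , d′) = q * (d * d′) ≡ r

    AtMost-Factors : AtMost (τ * τ) Factors
    AtMost-Factors = AtMost-fiber _≟_ (λ f q → proj₁ f ≡ q)
      (λ { {q , dd} refl → q , m∣m*n _ , refl })
      (τ-bd r 1≤r (m≤n*m r 4))
      λ {q} (divides R r≡) → AtMost-injection proj₂
        (λ { {_ , d , d′} (eq , refl) → *-cancelˡ-≡ (d * d′) R q {{>-nonZero (pos-factorˡ {q} eq 1≤r)}}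
          (trans eq (trans r≡ (*-comm R q))) })
        (λ { (_ , refl) (_ , refl) refl → refl })
        (AtMost-factorisations τ-bd (pos-factorˡ {R} (sym r≡) 1≤r)
          (≤-trans (∣-pos-≤ 1≤r (divides q (trans r≡ (*-comm R q)))) (m≤n*m r 4)))

    -- One chosen solution l₀ of the lattice condition; all others have R ∣ (l - l₀)(l + l₀)
    -- for R = r / gcd(2Δ, r).
    base : ℤ × ℕ × ℕ → ℕ
    base v = Search.search (LatticeVector? v) r

    base-lattice : ∀ {v l} → l < r → LatticeVector v l → LatticeVector v (base v)
    base-lattice {v} = Search.search-sound (LatticeVector? v) r

    Near : Label → ℕ × ℕ × ℕ → Set
    Near (l , v , _) (q , d , d′) = q ∣ᶻ + 2 *ᶻ proj₁ v × d ∣ᶻ + l -ᶻ + base v × d′ ∣ᶻ + l +ᶻ + base v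

    squares : ∀ Δ D l l₀ → Congruences.Relation {r} (+ c) (+ j) l Δ D → Congruences.Relation {r} (+ c) (+ j) l₀ Δ D →
      r ∣ᶻ + c *ᶻ ((+ 2 *ᶻ Δ) *ᶻ ((l -ᶻ l₀) *ᶻ (l +ᶻ l₀)))
    squares Δ D l l₀ p q = ∣ᶻ-lin (+ 1) (-ᶻ + 1) p q (identity (+ c) (+ j) Δ D l l₀)
      where
      identity : ∀ c j Δ D l l₀ → c *ᶻ ((+ 2 *ᶻ Δ) *ᶻ ((l -ᶻ l₀) *ᶻ (l +ᶻ l₀))) ≡
        + 1 *ᶻ (+ 2 *ᶻ c *ᶻ l *ᶻ l *ᶻ Δ -ᶻ j *ᶻ D) +ᶻ (-ᶻ + 1) *ᶻ (+ 2 *ᶻ c *ᶻ l₀ *ᶻ l₀ *ᶻ Δ -ᶻ j *ᶻ D)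
      identity = ℤ-Solver.solve-∀

    label : ∀ {L} → IsLabel L → ∃ λ f → Factors f × Near L f
    label {l , v@(Δ , δ , δ′) , _} ((l< , lat) , _) =
      let (q , R , qR≡r , q∣ , R∣) = ∣ᶻ-split (+ 2 *ᶻ Δ) 1≤r
          (d , d′ , dd′≡R , d∣ , d′∣) = ∣ᶻ-split (+ l -ᶻ + base v) (pos-factorʳ {q} qR≡r 1≤r)
          l₀ = base v
      in (q , d , d′) , trans (cong (q *_) dd′≡R) qR≡r , q∣ , d∣ ,
        d′∣ (+ l +ᶻ + l₀) (R∣ ((+ l -ᶻ + l₀) *ᶻ (+ l +ᶻ + l₀))
          (∣ᶻ-cancel cop-c ((+ 2 *ᶻ Δ) *ᶻ ((+ l -ᶻ + l₀) *ᶻ (+ l +ᶻ + l₀)))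
            (squares Δ (+ (δ * δ′)) (+ l) (+ l₀) (relation lat) (relation (base-lattice l< lat)))))

    four-D : ∀ {n} Δ D l₀ → n ∣ᶻ (+ 2 *ᶻ l₀) *ᶻ (+ 2 *ᶻ l₀) → Congruences.Relation {n} (+ c) (+ j) l₀ Δ D → n ∣ᶻ + j *ᶻ (+ 4 *ᶻ D)
    four-D Δ D l₀ p q = ∣ᶻ-lin (+ 2 *ᶻ + c *ᶻ Δ) (-ᶻ + 4) p q (identity (+ c) (+ j) Δ D l₀)
      where
      identity : ∀ c j Δ D l₀ → j *ᶻ (+ 4 *ᶻ D) ≡
        (+ 2 *ᶻ c *ᶻ Δ) *ᶻ ((+ 2 *ᶻ l₀) *ᶻ (+ 2 *ᶻ l₀)) +ᶻ (-ᶻ + 4) *ᶻ (+ 2 *ᶻ c *ᶻ l₀ *ᶻ l₀ *ᶻ Δ -ᶻ j *ᶻ D)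
      identity = ℤ-Solver.solve-∀

    twice : ∀ {e} k a → e ∣ᶻ k -ᶻ a → e ∣ᶻ k +ᶻ a → e ∣ᶻ + 2 *ᶻ a
    twice k a p q = ∣ᶻ-lin (-ᶻ + 1) (+ 1) p q (identity k a)
      where
      identity : ∀ k a → + 2 *ᶻ a ≡ (-ᶻ + 1) *ᶻ (k -ᶻ a) +ᶻ + 1 *ᶻ (k +ᶻ a)
      identity = ℤ-Solver.solve-∀

    -- The gcd e divides 2l₀, so e² divides 4l₀² and, by the lattice relation for l₀, also 4δδ′. As
    -- δ and δ′ divide y, this gives e² ∣ (2y)².
    gcd∣2y : ∀ {L f} → Factors f → IsLabel L → Near L f → gcd (proj₁ (proj₂ f)) (proj₂ (proj₂ f)) ∣ 2 * proj₂ (proj₂ (proj₂ L))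
    gcd∣2y {l , v@(Δ , δ , δ′) , x , y} {q , d , d′} eq ((l< , lat) , _ , _ , δ∣y , δ′∣y) (_ , d∣ , d′∣) =
      ∣-sq 1≤e (∣-trans ee∣4δδ′ (subst (4 * (δ * δ′) ∣_) (four y) (*-monoʳ-∣ 4 (*-pres-∣ δ∣y δ′∣y))))
      where
      four : ∀ y → 4 * (y * y) ≡ 2 * y * (2 * y)
      four = solve-∀
      e = gcd d d′
      l₀ = base v
      1≤dd′ : 1 ≤ d * d′
      1≤dd′ = pos-factorʳ {q} eq 1≤r
      1≤e : 1 ≤ e
      1≤e = ∣-pos (pos-factorˡ {d} refl 1≤dd′) (gcd[m,n]∣m d d′)
      ee∣r : e * e ∣ r
      ee∣r = ∣-trans (gcd²∣ {d} {d′} refl) (divides q (sym eq))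
      e∣2l₀ : e ∣ᶻ + 2 *ᶻ + l₀
      e∣2l₀ = twice (+ l) (+ l₀) (gcd∣ᶻˡ {d} {d′} d∣) (gcd∣ᶻʳ {d} d′∣)
      ee∣ : e * e ∣ᶻ (+ 2 *ᶻ + l₀) *ᶻ (+ 2 *ᶻ + l₀)
      ee∣ = ∣⇒∣ᶻ _ (subst (e * e ∣_) (sym (ℤₚ.abs-* (+ 2 *ᶻ + l₀) (+ 2 *ᶻ + l₀))) (*-pres-∣ (∣ᶻ⇒∣ e∣2l₀) (∣ᶻ⇒∣ e∣2l₀)))
      ee∣4δδ′ : e * e ∣ 4 * (δ * δ′)
      ee∣4δδ′ = subst (e * e ∣_) (ℤₚ.abs-* (+ 4) (+ (δ * δ′))) (∣ᶻ⇒∣ (∣ᶻ-cancel (Coprime-∣ ee∣r cop-j) (+ 4 *ᶻ + (δ * δ′))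
        (four-D Δ (+ (δ * δ′)) (+ l₀) ee∣ (∣-∣ᶻ-trans ee∣r (relation (base-lattice l< lat))))))

    Scaled : ℕ → ℕ → ℕ × ℕ → Set
    Scaled q e (x , y) = ((1 ≤ x × K * x ≤ 4 * M) × q ∣ 2 * x) × ((1 ≤ y × y ≤ 2 * H) × e ∣ 2 * y)

    AtMost-Scaled : ∀ q e → 1 ≤ q → 1 ≤ e → AtMost ((8 * M ÷ (K * q)) * (4 * H ÷ e)) (Scaled q e)
    AtMost-Scaled q e 1≤q 1≤e = AtMost-× _≟_
      (AtMost-multiples (8 * M) (K * q) (pos-* 1≤K 1≤q) (λ x → K * (2 * x))
        (λ {x} {y} eq → *-cancelˡ-≡ x y 2 (*-cancelˡ-≡ (2 * x) (2 * y) K {{>-nonZero 1≤K}} eq))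
        λ {x} ((1≤x , Kx≤) , q∣) → pos-* 1≤K (≤-trans 1≤x (m≤n*m x 2)) ,
          subst₂ _≤_ (double K x) (eight M) (*-monoʳ-≤ 2 Kx≤) , *-monoʳ-∣ K q∣)
      (AtMost-multiples (4 * H) e 1≤e (2 *_) (λ {x} {y} → *-cancelˡ-≡ x y 2)
        λ {y} ((1≤y , y≤) , e∣) → ≤-trans 1≤y (m≤n*m y 2) , subst (2 * y ≤_) (quadruple H) (*-monoʳ-≤ 2 y≤) , e∣)
      where
      double : ∀ K x → 2 * (K * x) ≡ K * (2 * x)
      double = solve-∀
      eight : ∀ M → 2 * (4 * M) ≡ 8 * M
      eight = solve-∀
      quadruple : ∀ H → 2 * (2 * H) ≡ 4 * H
      quadruple = solve-∀

    divisors-≤ : ∀ {n} → 1 ≤ n → n ≤ 4 * r → AtMost τ (_∣ n)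
    divisors-≤ {n} = τ-bd n

    -- The multiples x and y are chosen first. Then Δ, δ, δ′ are mere divisors of them and
    -- contribute 2τ · τ², the 2 being the sign of Δ.
    AtMost-vectors : ∀ q e → 1 ≤ q → 1 ≤ e →
      AtMost ((8 * M ÷ (K * q)) * (4 * H ÷ e) * (τ * 2 * (τ * τ))) (λ ((v , xy) : (ℤ × ℕ × ℕ) × (ℕ × ℕ)) → Scaled q e xy × Divides v xy)
    AtMost-vectors q e 1≤q 1≤e = AtMost-fiber _≟²_ (λ a b → proj₂ a ≡ b)
      (λ {a} (s , _) → proj₂ a , s , refl) (AtMost-Scaled q e 1≤q 1≤e)
      λ { {x , y} (((1≤x , Kx≤) , _) , ((1≤y , y≤) , _)) → AtMost-injection proj₁
        (λ { ((_ , d) , refl) → d })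
        (λ { (_ , refl) (_ , refl) refl → refl })
        (AtMost-× ℤ._≟_ (AtMost-ℤ-divisors (divisors-≤ 1≤x (≤-trans (m≤n*m x K {{>-nonZero 1≤K}}) (≤-trans Kx≤ (*-monoʳ-≤ 4 M≤r)))))
          (AtMost-× _≟_ (y-divisors 1≤y y≤) (y-divisors 1≤y y≤))) }
      where
      y-divisors : ∀ {y} → 1 ≤ y → y ≤ 2 * H → AtMost τ (_∣ y)
      y-divisors 1≤y y≤ = divisors-≤ 1≤y (≤-trans y≤ (*-mono-≤ {2} {4} (s≤s (s≤s z≤n)) H≤r))

    combine : ∀ q e → (8 * M ÷ (K * q)) * (4 * H ÷ e) * (τ * 2 * (τ * τ)) * (e * q) ≤ factor-bound
    combine q e = ÷-greatest K 1≤K (begin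
      A * B * P * (e * q) * K       ≡⟨ rearrange A B P e q K ⟩
      (A * (K * q)) * (B * e) * P   ≤⟨ *-monoˡ-≤ P (*-mono-≤ (÷-*-≤ (8 * M) (K * q)) (÷-*-≤ (4 * H) e)) ⟩
      8 * M * (4 * H) * P           ∎)
      where
      open ≤-Reasoning
      A = 8 * M ÷ (K * q)
      B = 4 * H ÷ e
      P = τ * 2 * (τ * τ)
      rearrange : ∀ A B P e q K → A * B * P * (e * q) * K ≡ (A * (K * q)) * (B * e) * P
      rearrange = solve-∀

    factor-fiber : ∀ {f} → Factors f → AtMost factor-bound (λ L → IsLabel L × Near L f)
    factor-fiber {q , d , d′} eq = AtMost-weaken (combine q (gcd d d′))
      (AtMost-fiber _≟ᵛ_ (λ L b → proj₂ L ≡ b)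
        (λ {L} p → proj₂ L , scaled p , refl)
        (AtMost-vectors q (gcd d d′) 1≤q 1≤e)
        λ {b} _ → AtMost-injection proj₁
          (λ { ((((l< , _) , _) , (_ , d∣ , d′∣)) , refl) → l< , d∣ , d′∣ })
          (λ { (_ , refl) (_ , refl) refl → refl })
          (AtMost-roots (+ base (proj₁ b)) (trans (*-comm (d * d′) q) eq) 1≤r))
      where
      1≤q : 1 ≤ q
      1≤q = pos-factorˡ {q} eq 1≤r
      1≤e : 1 ≤ gcd d d′
      1≤e = ∣-pos (pos-factorˡ {d} refl (pos-factorʳ {q} eq 1≤r)) (gcd[m,n]∣m d d′)
      scaled : ∀ {L} → IsLabel L × Near L (q , d , d′) → Scaled q (gcd d d′) (proj₂ (proj₂ L)) × Divides (proj₁ (proj₂ L)) (proj₂ (proj₂ L))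
      scaled {l , (Δ , δ , δ′) , x , y} (lab@(_ , (bx , by) , div@(Δ∣x , _)) , near@(q∣ , _)) =
        ((bx , ∣-trans (subst (q ∣_) (ℤₚ.abs-* (+ 2) Δ) (∣ᶻ⇒∣ q∣)) (*-monoʳ-∣ 2 Δ∣x)) , (by , gcd∣2y eq lab near)) , div

  AtMost-IsLabel : AtMost (τ * τ * factor-bound) IsLabel
  AtMost-IsLabel = AtMost-fiber (≡-dec _≟_ _≟²_) Near label AtMost-Factors factor-fiber

-- Short vectors of the lattice

quarter-sum : ∀ {n} x y → 4 * x < n → 4 * y < n → x + y < n
quarter-sum x y 4x< 4y< = go (≤-total x y)
  where
  double : ∀ x → x + x ≤ 4 * x
  double x = +-monoʳ-≤ x (m≤m+n x _)
  go : x ≤ y ⊎ y ≤ x → x + y < _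
  go (inj₁ x≤y) = ≤-<-trans (≤-trans (+-monoˡ-≤ y x≤y) (double y)) 4y<
  go (inj₂ y≤x) = ≤-<-trans (≤-trans (+-monoʳ-≤ x y≤x) (double x)) 4x<

module Lines (r c j H : ℕ) .{{_ : NonZero r}} (cop-c : Coprime r c) (cop-j : Coprime r j) where

  private
    1≤r : 1 ≤ r
    1≤r = >-nonZero⁻¹ r

  Box : ℤ → ℤ → Set
  Box Δ D = 4 * (abs Δ * (H * H)) < r × abs D ≤ H * H

  Relation : ℕ → ℤ → ℤ → Set
  Relation l = Congruences.Relation {r} (+ c) (+ j) (+ l)

  -- All short vectors of the lattice attached to l lie on one line, hence are
  -- multiples of a single primitive lattice vector.
  record Line (l : ℕ) (Δ₁ : ℤ) (D₁ : ℕ) : Set where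
    field
      1≤Δ₁ : 1 ≤ abs Δ₁
      1≤D₁ : 1 ≤ D₁
      box : Box Δ₁ (+ D₁)
      relation : Relation l Δ₁ (+ D₁)
      multiple : ∀ Δ D → Box Δ D → Relation l Δ D → ∃ λ t → Δ ≡ t *ᶻ Δ₁ × D ≡ t *ᶻ + D₁

  -- Inside the box |DΔ′ - D′Δ| ≤ H²(|Δ| + |Δ′|) < r, whereas this determinant is a multiple of r.
  parallel-≡ : ∀ l Δ D Δ′ D′ → Box Δ D → Box Δ′ D′ → Relation l Δ D → Relation l Δ′ D′ → D *ᶻ Δ′ ≡ D′ *ᶻ Δ
  parallel-≡ l Δ D Δ′ D′ (Δ< , D≤) (Δ′< , D′≤) rel rel′ =
    ℤₚ.i-j≡0⇒i≡j (D *ᶻ Δ′) (D′ *ᶻ Δ) (∣ᶻ-small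
      (∣ᶻ-cancel cop-j (D *ᶻ Δ′ -ᶻ D′ *ᶻ Δ) (Congruences.parallel (+ c) (+ j) (+ l) Δ D Δ′ D′ rel rel′))
      (≤-<-trans (≤-trans (ℤₚ.∣i-j∣≤∣i∣+∣j∣ (D *ᶻ Δ′) (D′ *ᶻ Δ))
          (+-mono-≤ (bound D Δ′ D≤) (bound D′ Δ D′≤)))
        (quarter-sum (abs Δ′ * (H * H)) (abs Δ * (H * H)) Δ′< Δ<)))
    where
    bound : ∀ D Δ → abs D ≤ H * H → abs (D *ᶻ Δ) ≤ abs Δ * (H * H)
    bound D Δ D≤ = ≤-trans (≤-reflexive (trans (ℤₚ.abs-* D Δ) (*-comm (abs D) (abs Δ)))) (*-monoʳ-≤ (abs Δ) D≤)

  -- `Δ⁎` and `D⁎` span the integral points of the line, `e` is the defect of this vector in the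
  -- lattice congruence, and `t₀` is the order of `e` in ℤ/r. A multiple t of the vector is
  -- therefore in the lattice only if t₀ ∣ t, and t₀ times it is the generator sought.
  module Primitive-vector (l : ℕ) (Δ : ℤ) (D : ℕ) (b : Box Δ (+ D)) (rel : Relation l Δ (+ D)) (1≤Δ : 1 ≤ abs Δ) (1≤D : 1 ≤ D) where

    open GCDView (gcd-view (abs Δ) D 1≤D) renaming (b to D⁎; n≡ to D≡; m≡ to absΔ≡)
    g = gcd (abs Δ) D
    1≤g : 1 ≤ g
    1≤g = ∣-pos 1≤D (gcd[m,n]∣n (abs Δ) D)
    instance
      g≢0 : NonZero g
      g≢0 = >-nonZero 1≤g

    g∣Δ : g ∣ᶻ Δ
    g∣Δ = ∣⇒∣ᶻ Δ (gcd[m,n]∣m (abs Δ) D)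
    Δ⁎ : ℤ
    Δ⁎ = S._∣_.quotient g∣Δ
    Δ≡ : Δ ≡ Δ⁎ *ᶻ + g
    Δ≡ = S._∣_.equality g∣Δ

    absΔ⁎≡ : abs Δ⁎ ≡ a
    absΔ⁎≡ = *-cancelʳ-≡ (abs Δ⁎) a g (trans (sym (trans (cong abs Δ≡) (ℤₚ.abs-* Δ⁎ (+ g)))) (trans absΔ≡ (*-comm g a)))

    1≤D⁎ : 1 ≤ D⁎
    1≤D⁎ = pos-factorʳ {g} (sym D≡) 1≤D

    e : ℤ
    e = + 2 *ᶻ + c *ᶻ + l *ᶻ + l *ᶻ Δ⁎ -ᶻ + j *ᶻ + D⁎

    order = ∣ᶻ-split {r} e 1≤r
    t₀ : ℕ
    t₀ = proj₁ (proj₂ order)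
    r≡ : proj₁ order * t₀ ≡ r
    r≡ = proj₁ (proj₂ (proj₂ order))
    e∣ : proj₁ order ∣ᶻ e
    e∣ = proj₁ (proj₂ (proj₂ (proj₂ order)))
    t₀-least : ∀ y → r ∣ᶻ e *ᶻ y → t₀ ∣ᶻ y
    t₀-least = proj₂ (proj₂ (proj₂ (proj₂ order)))

    Δ₁ : ℤ
    Δ₁ = + t₀ *ᶻ Δ⁎
    D₁ : ℕ
    D₁ = t₀ * D⁎

    r∣t₀e : r ∣ᶻ + t₀ *ᶻ e
    r∣t₀e = ∣⇒∣ᶻ (+ t₀ *ᶻ e) (subst₂ _∣_ (trans (*-comm t₀ _) r≡) (sym (ℤₚ.abs-* (+ t₀) e)) (*-monoʳ-∣ t₀ (∣ᶻ⇒∣ e∣)))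

    relation₁ : Relation l Δ₁ (+ D₁)
    relation₁ = ∣ᶻ-* (+ 1) r∣t₀e (trans (cong (λ x → + 2 *ᶻ + c *ᶻ + l *ᶻ + l *ᶻ Δ₁ -ᶻ + j *ᶻ x) (ℤₚ.pos-* t₀ D⁎))
      (identity (+ c) (+ j) (+ l) (+ t₀) Δ⁎ (+ D⁎)))
      where
      identity : ∀ c j l t Δ D → + 2 *ᶻ c *ᶻ l *ᶻ l *ᶻ (t *ᶻ Δ) -ᶻ j *ᶻ (t *ᶻ D) ≡
        + 1 *ᶻ (t *ᶻ (+ 2 *ᶻ c *ᶻ l *ᶻ l *ᶻ Δ -ᶻ j *ᶻ D))
      identity = ℤ-Solver.solve-∀

    multiple₁ : ∀ Δ′ D′ → Box Δ′ D′ → Relation l Δ′ D′ → ∃ λ t → Δ′ ≡ t *ᶻ Δ₁ × D′ ≡ t *ᶻ + D₁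
    multiple₁ Δ′ D′ b′ rel′ = u , Δ′≡u , D′≡u
      where
      open ≡-Reasoning
      cross : + D *ᶻ Δ′ ≡ D′ *ᶻ Δ
      cross = parallel-≡ l Δ (+ D) Δ′ D′ b b′ rel rel′
      +D≡ : + D ≡ + g *ᶻ + D⁎
      +D≡ = trans (cong +_ D≡) (ℤₚ.pos-* g D⁎)
      cross⁎ : + D⁎ *ᶻ Δ′ ≡ D′ *ᶻ Δ⁎
      cross⁎ = ℤₚ.*-cancelˡ-≡ (+ g) (+ D⁎ *ᶻ Δ′) (D′ *ᶻ Δ⁎) (begin
        + g *ᶻ (+ D⁎ *ᶻ Δ′)   ≡⟨ ℤₚ.*-assoc (+ g) (+ D⁎) Δ′ ⟨
        + g *ᶻ + D⁎ *ᶻ Δ′     ≡⟨ cong (_*ᶻ Δ′) +D≡ ⟨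
        + D *ᶻ Δ′             ≡⟨ cross ⟩
        D′ *ᶻ Δ               ≡⟨ cong (D′ *ᶻ_) Δ≡ ⟩
        D′ *ᶻ (Δ⁎ *ᶻ + g)     ≡⟨ swap D′ Δ⁎ (+ g) ⟩
        + g *ᶻ (D′ *ᶻ Δ⁎)     ∎)
        where
        swap : ∀ x y z → x *ᶻ (y *ᶻ z) ≡ z *ᶻ (x *ᶻ y)
        swap = ℤ-Solver.solve-∀
      D⁎∣D′ : D⁎ ∣ᶻ D′
      D⁎∣D′ = ∣⇒∣ᶻ D′ (coprime-divisor (Coprimality.sym coprime)
        (subst (D⁎ ∣_) (trans (cong abs cross⁎) (trans (ℤₚ.abs-* D′ Δ⁎) (trans (cong (abs D′ *_) absΔ⁎≡) (*-comm (abs D′) a))))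
          (subst (D⁎ ∣_) (sym (ℤₚ.abs-* (+ D⁎) Δ′)) (m∣m*n (abs Δ′)))))
      t : ℤ
      t = S._∣_.quotient D⁎∣D′
      D′≡ : D′ ≡ t *ᶻ + D⁎
      D′≡ = S._∣_.equality D⁎∣D′
      Δ′≡ : Δ′ ≡ t *ᶻ Δ⁎
      Δ′≡ = ℤₚ.*-cancelˡ-≡ (+ D⁎) Δ′ (t *ᶻ Δ⁎) {{>-nonZero 1≤D⁎}}
        (trans cross⁎ (trans (cong (_*ᶻ Δ⁎) D′≡) (swap t (+ D⁎) Δ⁎)))
        where
        swap : ∀ x y z → x *ᶻ y *ᶻ z ≡ y *ᶻ (x *ᶻ z)
        swap = ℤ-Solver.solve-∀
      t₀∣t : t₀ ∣ᶻ t
      t₀∣t = t₀-least t (∣ᶻ-* (+ 1) rel′ (trans (identity (+ c) (+ j) (+ l) t Δ⁎ (+ D⁎))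
        (cong₂ (λ x y → + 1 *ᶻ (+ 2 *ᶻ + c *ᶻ + l *ᶻ + l *ᶻ x -ᶻ + j *ᶻ y)) (sym Δ′≡) (sym D′≡))))
        where
        identity : ∀ c j l t Δ D → (+ 2 *ᶻ c *ᶻ l *ᶻ l *ᶻ Δ -ᶻ j *ᶻ D) *ᶻ t ≡
          + 1 *ᶻ (+ 2 *ᶻ c *ᶻ l *ᶻ l *ᶻ (t *ᶻ Δ) -ᶻ j *ᶻ (t *ᶻ D))
        identity = ℤ-Solver.solve-∀
      u : ℤ
      u = S._∣_.quotient t₀∣t
      t≡ : t ≡ u *ᶻ + t₀
      t≡ = S._∣_.equality t₀∣t
      Δ′≡u : Δ′ ≡ u *ᶻ Δ₁
      Δ′≡u = trans Δ′≡ (trans (cong (_*ᶻ Δ⁎) t≡) (ℤₚ.*-assoc u (+ t₀) Δ⁎))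
      D′≡u : D′ ≡ u *ᶻ + D₁
      D′≡u = trans D′≡ (trans (cong (_*ᶻ + D⁎) t≡) (trans (ℤₚ.*-assoc u (+ t₀) (+ D⁎)) (cong (u *ᶻ_) (sym (ℤₚ.pos-* t₀ D⁎)))))

    line : Line l Δ₁ D₁
    line = record
      { 1≤Δ₁ = pos-factorʳ {abs u} absΔ≡u 1≤Δ
      ; 1≤D₁ = pos-factorʳ {abs u} D≡u 1≤D
      ; box = ≤-<-trans (*-monoʳ-≤ 4 (*-monoˡ-≤ (H * H) (factor-≤ absΔ≡u))) (proj₁ b) ,
              ≤-trans (factor-≤ D≡u) (proj₂ b)
      ; relation = relation₁
      ; multiple = multiple₁
      }
      where
      self = multiple₁ Δ (+ D) b rel
      u = proj₁ self
      absΔ≡u : abs u * abs Δ₁ ≡ abs Δ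
      absΔ≡u = sym (trans (cong abs (proj₁ (proj₂ self))) (ℤₚ.abs-* u Δ₁))
      D≡u : abs u * D₁ ≡ D
      D≡u = sym (trans (cong abs (proj₂ (proj₂ self))) (ℤₚ.abs-* u (+ D₁)))
      factor-≤ : ∀ {x y} → abs u * x ≡ y → x ≤ y
      factor-≤ {x} eq = subst (x ≤_) eq (m≤n*m x (abs u) {{>-nonZero (pos-factorˡ {abs u} absΔ≡u 1≤Δ)}})

  -- A change of sign makes D positive, so that D₁ is a natural number that can be factored and that
  -- `line-unique` can identify.
  line-exists : ∀ l Δ D → Box Δ D → Relation l Δ D → 1 ≤ abs Δ → 1 ≤ abs D → ∃₂ (Line l)
  line-exists l Δ (+ D) b rel 1≤Δ 1≤D = _ , _ , Primitive-vector.line l Δ D b rel 1≤Δ 1≤D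
  line-exists l Δ -[1+ n ] (Δ< , D≤) rel 1≤Δ 1≤D = _ , _ ,
    Primitive-vector.line l (-ᶻ Δ) (suc n)
      (subst (λ x → 4 * (x * (H * H)) < r) (sym (ℤₚ.∣-i∣≡∣i∣ Δ)) Δ< , D≤)
      (∣ᶻ-* (-ᶻ + 1) rel (identity (+ c) (+ j) (+ l) Δ -[1+ n ]))
      (subst (1 ≤_) (sym (ℤₚ.∣-i∣≡∣i∣ Δ)) 1≤Δ) 1≤D
    where
    identity : ∀ c j l Δ D → + 2 *ᶻ c *ᶻ l *ᶻ l *ᶻ (-ᶻ Δ) -ᶻ j *ᶻ (-ᶻ D) ≡
      (-ᶻ + 1) *ᶻ (+ 2 *ᶻ c *ᶻ l *ᶻ l *ᶻ Δ -ᶻ j *ᶻ D)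
    identity = ℤ-Solver.solve-∀

  -- Each generator is a multiple of the other. In `AtMost-sparse` this makes the factorisations δδ′
  -- found with different partners factorisations of one number.
  line-unique : ∀ {l Δ Δ′ D D′} → Line l Δ D → Line l Δ′ D′ → D ≡ D′
  line-unique L L′ = ∣-antisym (divides-one L L′) (divides-one L′ L)
    where
    divides-one : ∀ {l Δ Δ′ D D′} → Line l Δ D → Line l Δ′ D′ → D ∣ D′
    divides-one {D = D} L L′ =
      let (t , _ , eq) = Line.multiple L _ _ (Line.box L′) (Line.relation L′)
      in divides (abs t) (trans (cong abs eq) (ℤₚ.abs-* t (+ D)))

-- Pairs of primitive solutions with the same difference of roots

sq-injective : ∀ {m n} → m * m ≡ n * n → m ≡ n
sq-injective {m} {n} eq = go (<-cmp m n)
  where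
  go : Tri (m < n) (m ≡ n) (m > n) → m ≡ n
  go (tri< m<n _ _) = contradiction eq (<⇒≢ (*-mono-< m<n m<n))
  go (tri≈ _ m≡n _) = m≡n
  go (tri> _ _ n<m) = contradiction (sym eq) (<⇒≢ (*-mono-< n<m n<m))

module Pairs (r c j M H K : ℕ) .{{_ : NonZero r}} (cop-c : Coprime r c) (cop-j : Coprime r j)
  (M≤r : M ≤ r) (HH≤r : H * H ≤ r) (1≤K : 1 ≤ K) (many-blocks : 8 * (H * H * M) < K * r)
  {τ : ℕ} (τ-bd : DivisorBound (4 * r) τ) where

  open Solutions r c j M H cop-c cop-j
  open Counting τ-bd
  open Classes r c j M H cop-c cop-j τ-bd
  open Lines r c j H cop-c cop-j

  H≤HH : H ≤ H * H
  H≤HH = go H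
    where
    go : ∀ n → n ≤ n * n
    go zero = z≤n
    go n@(suc _) = m≤m*n n n

  open Labels r c j M H K cop-c cop-j M≤r (≤-trans H≤HH HH≤r) 1≤K τ-bd

  hOf mOf sOf : Quad → ℕ
  hOf t = proj₂ (proj₂ (proj₂ t))
  mOf t = proj₁ (proj₂ (proj₂ t))
  sOf t = 2 * mOf t + hOf t

  -- At most K blocks cover s ≤ 2M, and inside one of them |Δ| ≤ 2M / K, whence 4|Δ|H² ≤ 8H²M / K <
  -- r. This is the origin of the 8 in `many-blocks`.
  blockLength : ℕ
  blockLength = suc (2 * M ÷ K)

  block : Quad → ℕ
  block t = sOf t ÷ blockLength

  Δ D : Quad → Quad → ℤ
  Δ t t′ = + sOf t -ᶻ + sOf t′
  D t t′ = + (hOf t * hOf t) -ᶻ + (hOf t′ * hOf t′)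

  block-< : ∀ {t} → Solution t → block t < K
  block-< {_ , _ , m , h} sol = ÷-< blockLength (s≤s z≤n)
    (≤-<-trans (begin
      2 * m + h       ≤⟨ +-monoʳ-≤ (2 * m) (m≤n*m h 2) ⟩
      2 * m + 2 * h   ≡⟨ *-distribˡ-+ 2 m h ⟨
      2 * (m + h)     ≤⟨ *-monoʳ-≤ 2 (Solution.m+h≤M sol) ⟩
      2 * M           ∎)
    (subst (2 * M <_) (*-comm blockLength K) (<-suc÷-* (2 * M) K 1≤K)))
    where open ≤-Reasoning

  record SameClass (t t′ : Quad) : Set where
    constructor sameClass
    field
      sol : Solution t
      sol′ : Solution t′
      same-shift : shift t ≡ shift t′
      same-block : block t ≡ block t′

  module _ {t t′ : Quad} (same : SameClass t t′) where

    open SameClass same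
    private
      l = shift t
      k = proj₁ (proj₂ t)
      k′ = proj₁ (proj₂ t′)
      h = hOf t
      h′ = hOf t′
      module S₁ = Solution sol
      module S₂ = Solution sol′
      open Congruences {r} (+ c) (+ j) (+ l) hiding (Relation)

    Δ-short : abs (Δ t t′) ≤ 2 * M ÷ K
    Δ-short = ≤-pred (÷-close {sOf t} {sOf t′} blockLength (s≤s z≤n) same-block)

    Δ-small : 4 * (abs (Δ t t′) * (H * H)) < r
    Δ-small = *-cancelˡ-< K _ r (≤-<-trans (begin
      K * (4 * (abs (Δ t t′) * (H * H)))   ≡⟨ rearrange K (abs (Δ t t′)) (H * H) ⟩
      4 * (abs (Δ t t′) * K * (H * H))     ≤⟨ *-monoʳ-≤ 4 (*-monoˡ-≤ (H * H) (≤-trans (*-monoˡ-≤ K Δ-short) (÷-*-≤ (2 * M) K))) ⟩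
      4 * (2 * M * (H * H))                ≡⟨ eight M (H * H) ⟩
      8 * (H * H * M)                      ∎) many-blocks)
      where
      open ≤-Reasoning
      rearrange : ∀ K x y → K * (4 * (x * y)) ≡ 4 * (x * K * y)
      rearrange = solve-∀
      eight : ∀ M y → 4 * (2 * M * y) ≡ 8 * (y * M)
      eight = solve-∀

    D-small : abs (D t t′) < H * H
    D-small = abs-diff-< (square S₁.h≤H S₂.1≤h) (square S₂.h≤H S₁.1≤h)
      where
      square : ∀ {x y} → x ≤ H → 1 ≤ y → x * x < H * H + y * y
      square x≤H 1≤y = ≤-<-trans (*-mono-≤ x≤H x≤H) (m<m+n (H * H) (pos-* 1≤y 1≤y))

    private
      s-cast : ∀ u → + 2 *ᶻ + mOf u +ᶻ + hOf u ≡ + sOf u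
      s-cast u = cong (_+ᶻ + hOf u) (sym (ℤₚ.pos-* 2 (mOf u)))

      total₁ : Total (+ k) (+ sOf t)
      total₁ = subst (Total (+ k)) (s-cast t) (Facts.tot sol)
      total₂ : Total (+ k′) (+ sOf t′)
      total₂ = subst₂ (λ y s → Congruences.Total {r} (+ c) (+ j) (+ y) (+ k′) s) (sym same-shift) (s-cast t′) (Facts.tot sol′)
      difference₂ : Difference (+ k′) (+ h′)
      difference₂ = subst (λ y → Congruences.Difference {r} (+ c) (+ j) (+ y) (+ k′) (+ h′)) (sym same-shift) (Facts.diff sol′)

    lattice : Relation l (Δ t t′) (D t t′)
    lattice = subst (λ x → r ∣ᶻ + 2 *ᶻ + c *ᶻ + l *ᶻ + l *ᶻ Δ t t′ -ᶻ + j *ᶻ x)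
      (cong₂ _-ᶻ_ (sym (ℤₚ.pos-* h h)) (sym (ℤₚ.pos-* h′ h′)))
      (cancel-j (relation (+ k) (+ k′) (+ sOf t) (+ sOf t′) (+ h) (+ h′) (Facts.diff sol) difference₂ total₁ total₂))

    -- By `equal-differences` r divides hΔ, and |hΔ| ≤ H²|Δ| < r; so Δ = 0.
    same-h⇒same-m : h ≡ h′ → mOf t ≡ mOf t′
    same-h⇒same-m h≡h′ = *-cancelˡ-≡ (mOf t) (mOf t′) 2
      (+-cancelʳ-≡ h (2 * mOf t) (2 * mOf t′) (trans s≡s′ (cong (λ y → 2 * mOf t′ + y) (sym h≡h′))))
      where
      r∣hΔ : r ∣ᶻ + h *ᶻ Δ t t′
      r∣hΔ = cancel-j (cancel-j (equal-differences (+ k) (+ k′) (+ sOf t) (+ sOf t′) (+ h) (Facts.diff sol)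
        (subst (λ y → Difference (+ k′) (+ y)) (sym h≡h′) difference₂) total₁ total₂))
      habsΔ≡0 : h * abs (Δ t t′) ≡ 0
      habsΔ≡0 = ∣-small (subst (r ∣_) (ℤₚ.abs-* (+ h) (Δ t t′)) (∣ᶻ⇒∣ r∣hΔ))
        (≤-<-trans (≤-trans (≤-reflexive (*-comm h _))
          (≤-trans (*-monoʳ-≤ (abs (Δ t t′)) (≤-trans S₁.h≤H H≤HH)) (m≤n*m _ 4))) Δ-small)
      s≡s′ : sOf t ≡ sOf t′
      s≡s′ = diff≡0 (ℤₚ.∣i∣≡0⇒i≡0 (*-cancelˡ-≡ (abs (Δ t t′)) 0 h {{>-nonZero S₁.1≤h}} (trans habsΔ≡0 (sym (*-zeroʳ h)))))

    -- For Δ = 0 the lattice relation reads r ∣ jD, while |D| < H² ≤ r. The strict inequality comes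
    -- from h, h′ ≥ 1.
    same-s⇒same-h : Δ t t′ ≡ + 0 → h ≡ h′
    same-s⇒same-h Δ≡0 = sq-injective (diff≡0 (∣ᶻ-small
      (cancel-j (∣ᶻ-* (-ᶻ + 1) (subst (λ x → Relation l x (D t t′)) Δ≡0 lattice) (identity (+ c) (+ j) (+ l) (D t t′))))
      (<-≤-trans D-small HH≤r)))
      where
      identity : ∀ c j l D → j *ᶻ D ≡ (-ᶻ + 1) *ᶻ (+ 2 *ᶻ c *ᶻ l *ᶻ l *ᶻ + 0 -ᶻ j *ᶻ D)
      identity = ℤ-Solver.solve-∀

    pair-box : Box (Δ t t′) (D t t′)
    pair-box = Δ-small , <⇒≤ D-small

    record Splitting (v : ℤ × ℕ × ℕ) : Set where
      δ = proj₁ (proj₂ v)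
      δ′ = proj₂ (proj₂ v)
      field
        line : Line l (proj₁ v) (δ * δ′)
        δ∣ : δ ∣ᶻ + h -ᶻ + h′
        δ′∣ : δ′ ∣ᶻ + h +ᶻ + h′
        Δ₁-short : abs (proj₁ v) ≤ 2 * M ÷ K

    private
      positive : ∀ z → z ≢ + 0 → 1 ≤ abs z
      positive (+ zero) z≢0 = contradiction refl z≢0
      positive (+ suc _) _ = s≤s z≤n
      positive -[1+ _ ] _ = s≤s z≤n

      D-factors : D t t′ ≡ (+ h -ᶻ + h′) *ᶻ (+ h +ᶻ + h′)
      D-factors = trans (cong₂ _-ᶻ_ (ℤₚ.pos-* h h) (ℤₚ.pos-* h′ h′)) (identity (+ h) (+ h′))
        where
        identity : ∀ x y → x *ᶻ x -ᶻ y *ᶻ y ≡ (x -ᶻ y) *ᶻ (x +ᶻ y)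
        identity = ℤ-Solver.solve-∀

    -- The assumption makes Δ and D nonzero, so there is a line. Its D₁ divides D = (h - h′)(h + h′)
    -- and is split along these two factors; Δ₁ divides Δ and inherits its bound.
    splitting : h ≢ h′ → ∃ Splitting
    splitting h≢h′ =
      let Δ≢0 = λ eq → h≢h′ (same-s⇒same-h eq)
          D≢0 = λ eq → h≢h′ (sq-injective (diff≡0 eq))
          (Δ₁ , D₁ , ln) = line-exists l (Δ t t′) (D t t′) pair-box lattice (positive _ Δ≢0) (positive _ D≢0)
          (u , Δ≡ , D≡) = Line.multiple ln (Δ t t′) (D t t′) pair-box lattice
          (δ , δ′ , eq , δ∣ , δ′∣) = ∣ᶻ-split {D₁} (+ h -ᶻ + h′) (Line.1≤D₁ ln)
          absΔ≡ = trans (cong abs Δ≡) (ℤₚ.abs-* u Δ₁)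
      in (Δ₁ , δ , δ′) , record
        { line = subst (Line l Δ₁) (sym eq) ln
        ; δ∣ = δ∣
        ; δ′∣ = δ′∣ (+ h +ᶻ + h′) (S.divides u (trans (sym D-factors) D≡))
        ; Δ₁-short = ≤-trans (∣-pos-≤ (positive _ Δ≢0) (divides (abs u) absΔ≡)) Δ-short
        }

  Pair : Quad × Quad → Set
  Pair (t , t′) = SameClass t t′ × Primitive t × Primitive t′

  ∣-same-minuend : ∀ {d} x y z → d ∣ᶻ + x -ᶻ + y → d ∣ᶻ + x -ᶻ + z → d ∣ᶻ + y -ᶻ + z
  ∣-same-minuend x y z p q = ∣ᶻ-lin (-ᶻ + 1) (+ 1) p q (identity (+ x) (+ y) (+ z))
    where
    identity : ∀ x y z → y -ᶻ z ≡ (-ᶻ + 1) *ᶻ (x -ᶻ y) +ᶻ + 1 *ᶻ (x -ᶻ z)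
    identity = ℤ-Solver.solve-∀

  ∣-same-summand : ∀ {d} x y z → d ∣ᶻ + x +ᶻ + y → d ∣ᶻ + x +ᶻ + z → d ∣ᶻ + y -ᶻ + z
  ∣-same-summand x y z p q = ∣ᶻ-lin (+ 1) (-ᶻ + 1) p q (identity (+ x) (+ y) (+ z))
    where
    identity : ∀ x y z → y -ᶻ z ≡ + 1 *ᶻ (x +ᶻ y) +ᶻ (-ᶻ + 1) *ᶻ (x +ᶻ z)
    identity = ℤ-Solver.solve-∀

  ∣-same-subtrahend : ∀ {d} x y z → d ∣ᶻ + y -ᶻ + x → d ∣ᶻ + z -ᶻ + x → d ∣ᶻ + y -ᶻ + z
  ∣-same-subtrahend x y z p q = ∣ᶻ-lin (+ 1) (-ᶻ + 1) p q (identity (+ x) (+ y) (+ z))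
    where
    identity : ∀ x y z → y -ᶻ z ≡ + 1 *ᶻ (y -ᶻ x) +ᶻ (-ᶻ + 1) *ᶻ (z -ᶻ x)
    identity = ℤ-Solver.solve-∀

  same-class : ∀ {t t′} → SameClass t t′ → hOf t ≡ hOf t′ → (mOf t , hOf t) ≡ (mOf t′ , hOf t′)
  same-class same eq = cong₂ _,_ (same-h⇒same-m same eq) eq

  solution-bound : ℕ
  solution-bound = τ * τ * (4 * M * H)

  AtMost-equal-h : AtMost (solution-bound * (τ * 2)) (λ p → Pair p × hOf (proj₁ p) ≡ hOf (proj₂ p))
  AtMost-equal-h = AtMost-fiber _≟⁴_ (λ p t → proj₁ p ≡ t)
    (λ {p} ((same , _) , _) → proj₁ p , SameClass.sol same , refl)
    AtMost-Solution
    λ {t} _ → AtMost-injection proj₂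
      {Q = InClass (shift t) (mOf t , hOf t)}
      (λ { (((same , _ , prim) , h≡) , refl) →
        (SameClass.sol′ same , prim) , sym (SameClass.same-shift same) , sym (same-class same h≡) })
      (λ { (_ , refl) (_ , refl) refl → refl })
      (AtMost-InClass (shift t) (mOf t , hOf t))

  lcmOf : ℤ × ℕ × ℕ → ℕ
  lcmOf (_ , δ , δ′) = lcm δ δ′

  Split : Quad × Quad → ℤ × ℕ × ℕ → Set
  Split (t , t′) v = Σ (SameClass t t′) λ same → Splitting same v

  1≤lcmOf : ∀ {p v} → Split p v → 1 ≤ lcmOf v
  1≤lcmOf {v = _ , δ , δ′} (_ , split) = lcm-pos (pos-factorˡ {δ} refl 1≤δδ′) (pos-factorʳ {δ} refl 1≤δδ′)
    where
    1≤δδ′ = Line.1≤D₁ (Splitting.line split)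

  SparsePair : Quad × Quad → Set
  SparsePair p = Pair p × ∃ λ v → Split p v × H < lcmOf v

  -- Given t, the line fixes δδ′, which leaves τ pairs (δ, δ′). Then h′ ≡ h modulo δ and h′ ≡ -h
  -- modulo δ′ fix h′ modulo lcm(δ, δ′) > H, hence fix h′, and then m′; `AtMost-InClass` bounds the
  -- remaining choice of roots.
  AtMost-sparse : AtMost (solution-bound * τ * (τ * 2)) SparsePair
  AtMost-sparse = AtMost-fiber (≡-dec _≟⁴_ _≟²_) R label labels fiber
    where
    HasLine : Quad × ℕ × ℕ → Set
    HasLine (t , δ , δ′) = Solution t × ∃ λ Δ₁ → Line (shift t) Δ₁ (δ * δ′)
    R : Quad × Quad → Quad × ℕ × ℕ → Set
    R p (t , δ , δ′) = proj₁ p ≡ t × ∃ λ Δ₁ → Split p (Δ₁ , δ , δ′) × H < lcm δ δ′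
    label : ∀ {p} → SparsePair p → ∃ λ b → HasLine b × R p b
    label {p} ((same , _) , (Δ₁ , δ , δ′) , split , H<) =
      (proj₁ p , δ , δ′) , (SameClass.sol same , Δ₁ , Splitting.line (proj₂ split)) , refl , Δ₁ , split , H<
    labels : AtMost (solution-bound * τ) HasLine
    labels = AtMost-fiber _≟⁴_ (λ b t → proj₁ b ≡ t) (λ {b} (sol , _) → proj₁ b , sol , refl) AtMost-Solution
      λ {t} _ → AtMost-rebase λ { {.t , δ₀ , δ₀′} ((_ , _ , L₀) , refl) → AtMost-injection proj₂
        (λ { ((_ , _ , L) , refl) → line-unique L L₀ })
        (λ { (_ , refl) (_ , refl) refl → refl })
        (AtMost-factorisations τ-bd (Line.1≤D₁ L₀) (≤-trans (proj₂ (Line.box L₀)) (≤-trans HH≤r (m≤n*m r 4)))) }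
    fiber : ∀ {b} → HasLine b → AtMost (τ * 2) (λ p → SparsePair p × R p b)
    fiber {t , δ , δ′} _ = AtMost-rebase λ { {.t , t₀} (_ , refl , _ , split₀ , H<) → AtMost-injection proj₂
      {Q = InClass (shift t) (mOf t₀ , hOf t₀)}
      (λ { {_ , t′} (((_ , _ , prim) , _) , refl , _ , split , _) → into split₀ split H< prim })
      (λ { (_ , refl , _) (_ , refl , _) refl → refl })
      (AtMost-InClass (shift t) (mOf t₀ , hOf t₀)) }
      where
      into : ∀ {t₀ t′ Δ₀ Δ₁} → Split (t , t₀) (Δ₀ , δ , δ′) → Split (t , t′) (Δ₁ , δ , δ′) → H < lcm δ δ′ →
        Primitive t′ → InClass (shift t) (mOf t₀ , hOf t₀) t′
      into {t₀} {t′} (same₀ , split₀) (same , split) H< prim =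
        (S₁.sol′ , prim) , sym S₁.same-shift , same-class (sameClass S₁.sol′ S₀.sol′
          (trans (sym S₁.same-shift) S₀.same-shift) (trans (sym S₁.same-block) S₀.same-block)) h≡
        where
        module S₁ = SameClass same
        module S₀ = SameClass same₀
        h≡ : hOf t′ ≡ hOf t₀
        h≡ = cong-small (lcm-least-∣ᶻ _
            (∣-same-minuend (hOf t) (hOf t′) (hOf t₀) (Splitting.δ∣ split) (Splitting.δ∣ split₀))
            (∣-same-summand (hOf t) (hOf t′) (hOf t₀) (Splitting.δ′∣ split) (Splitting.δ′∣ split₀)))
          (≤-<-trans (Solution.h≤H S₁.sol′) H<) (≤-<-trans (Solution.h≤H S₀.sol′) H<)

  DensePair : Quad × Quad → Set
  DensePair p = Pair p × ∃ λ v → Split p v × lcmOf v ≤ H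

  offset : Quad → ℕ
  offset t = sOf t mod blockLength

  -- For d ≥ 1 this is the least multiple of d above n. It determines n within a class modulo d, and
  -- being positive and divisible by d it lets d be counted among its divisors.
  roundUp : ℕ → ℕ → ℕ
  roundUp n d = d * suc (n ÷ d)

  roundUp-≤ : ∀ n d → roundUp n d ≤ d + n
  roundUp-≤ n d = ≤-trans (≤-reflexive (*-suc d (n ÷ d))) (+-monoʳ-≤ d (≤-trans (≤-reflexive (*-comm d (n ÷ d))) (÷-*-≤ n d)))

  roundUp-injective : ∀ {m n d} → 1 ≤ d → d ∣ᶻ + m -ᶻ + n → roundUp m d ≡ roundUp n d → m ≡ n
  roundUp-injective {m} {n} {d} 1≤d d∣ eq =
    cong-÷ 1≤d d∣ (suc-injective (*-cancelˡ-≡ (suc (m ÷ d)) (suc (n ÷ d)) d {{>-nonZero 1≤d}} eq))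

  labelOf : Quad × Quad → ℤ × ℕ × ℕ → Label
  labelOf (t , t′) v = shift t , v , roundUp (offset t′) (abs (proj₁ v)) , roundUp (hOf t) (lcmOf v)

  isLabel : ∀ {p v} → Split p v → lcmOf v ≤ H → IsLabel (labelOf p v)
  isLabel {t , t′} {v@(Δ₁ , δ , δ′)} (same , split) L≤H =
    (n%ℕd<d (+ proj₁ t -ᶻ + proj₁ (proj₂ t)) r , latticeVector (Line.relation line)) ,
    ((pos-* (Line.1≤Δ₁ line) (s≤s z≤n) , Kx≤) , pos-* (1≤lcmOf {t , t′} {v} (same , split)) (s≤s z≤n) , y≤) ,
    m∣m*n _ , ∣-trans (m∣lcm[m,n] δ δ′) (m∣m*n _) , ∣-trans (n∣lcm[m,n] δ δ′) (m∣m*n _)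
    where
    open Splitting split using (line; Δ₁-short)
    B = 2 * M ÷ K
    Kx≤ : K * roundUp (offset t′) (abs Δ₁) ≤ 4 * M
    Kx≤ = begin
      K * roundUp (offset t′) (abs Δ₁)  ≤⟨ *-monoʳ-≤ K (roundUp-≤ (offset t′) (abs Δ₁)) ⟩
      K * (abs Δ₁ + offset t′)          ≤⟨ *-monoʳ-≤ K (+-mono-≤ Δ₁-short (≤-pred (mod-< (sOf t′) blockLength (s≤s z≤n)))) ⟩
      K * (B + B)                       ≡⟨ double K B ⟩
      2 * (B * K)                       ≤⟨ *-monoʳ-≤ 2 (÷-*-≤ (2 * M) K) ⟩
      2 * (2 * M)                       ≡⟨ four M ⟩
      4 * M                             ∎
      where
      open ≤-Reasoning
      double : ∀ K B → K * (B + B) ≡ 2 * (B * K)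
      double = solve-∀
      four : ∀ M → 2 * (2 * M) ≡ 4 * M
      four = solve-∀
    y≤ : roundUp (hOf t) (lcm δ δ′) ≤ 2 * H
    y≤ = ≤-trans (roundUp-≤ (hOf t) (lcm δ δ′)) (+-mono-≤ L≤H (≤-trans (Solution.h≤H (SameClass.sol same)) (≤-reflexive (sym (+-identityʳ H)))))

  -- The K blocks cancel the division by K in `factor-bound`. Label and block determine (m, h) for
  -- both members of the pair; the factor (2τ)² counts the roots that are left.
  AtMost-dense : AtMost (τ * τ * factor-bound * K * (τ * 2 * (τ * 2))) DensePair
  AtMost-dense = AtMost-fiber (≡-dec (≡-dec _≟_ _≟ᵛ_) _≟_) R label
    (AtMost-× (≡-dec _≟_ _≟ᵛ_) AtMost-IsLabel (AtMost-< K)) fiber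
    where
    R : Quad × Quad → Label × ℕ → Set
    R p (L , b) = block (proj₁ p) ≡ b × ∃ λ v → Split p v × labelOf p v ≡ L
    label : ∀ {p} → DensePair p → ∃ λ b → (IsLabel (proj₁ b) × proj₂ b < K) × R p b
    label {p} ((same , _) , v , split , L≤H) = (labelOf p v , block (proj₁ p)) ,
      (isLabel {p} split L≤H , block-< (SameClass.sol same)) , refl , v , split , refl
    into : ∀ {t₀ t₀′ t t′ v v₀} → Split (t₀ , t₀′) v₀ → Split (t , t′) v → block t ≡ block t₀ →
      labelOf (t , t′) v ≡ labelOf (t₀ , t₀′) v₀ → Primitive t → Primitive t′ →
      InClass (shift t₀) (mOf t₀ , hOf t₀) t × InClass (shift t₀) (mOf t₀′ , hOf t₀′) t′
    into {t₀} {t₀′} {t} {t′} {v@(Δ₁ , δ , δ′)} (same₀ , split₀) (same , split) block≡ label≡ prim prim′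
      with cong (λ L → proj₁ (proj₂ L)) label≡
    ... | refl = ((S₁.sol , prim) , shift≡ , same-class tt₀ h≡) ,
        ((S₁.sol′ , prim′) , trans (sym S₁.same-shift) shift≡ , same-class t′t₀′ h′≡)
      where
      module S₁ = SameClass same
      module S₀ = SameClass same₀
      shift≡ : shift t ≡ shift t₀
      shift≡ = cong proj₁ label≡
      tt₀ : SameClass t t₀
      tt₀ = sameClass S₁.sol S₀.sol shift≡ block≡
      t′t₀′ : SameClass t′ t₀′
      t′t₀′ = sameClass S₁.sol′ S₀.sol′ (trans (sym S₁.same-shift) (trans shift≡ S₀.same-shift))
        (trans (sym S₁.same-block) (trans block≡ S₀.same-block))
      -- The second members of the two pairs share λ and the block, so their difference vector lies
      -- on the same line. This fixes s′ first, then h′, and only with h′ known does the second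
      -- multiple in the label fix h.
      Δ₁∣s : abs Δ₁ ∣ᶻ Δ t′ t₀′
      Δ₁∣s = let (u , eq , _) = Line.multiple (Splitting.line split) (Δ t′ t₀′) (D t′ t₀′) (pair-box t′t₀′)
                   (subst (λ l → Relation l (Δ t′ t₀′) (D t′ t₀′)) (sym S₁.same-shift) (lattice t′t₀′))
             in ∣⇒∣ᶻ (Δ t′ t₀′) (divides (abs u) (trans (cong abs eq) (ℤₚ.abs-* u Δ₁)))
      Δ₁∣offset : abs Δ₁ ∣ᶻ + offset t′ -ᶻ + offset t₀′
      Δ₁∣offset = ∣ᶻ-* (+ 1) Δ₁∣s (trans (identity (+ offset t′) (+ offset t₀′) (+ (block t₀′ * blockLength)))
        (cong₂ (λ x y → + 1 *ᶻ (+ x -ᶻ + y))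
          (sym (trans (mod-÷ (sOf t′) blockLength) (cong (λ b → offset t′ + b * blockLength) (SameClass.same-block t′t₀′))))
          (sym (mod-÷ (sOf t₀′) blockLength))))
        where
        identity : ∀ x y z → x -ᶻ y ≡ + 1 *ᶻ ((x +ᶻ z) -ᶻ (y +ᶻ z))
        identity = ℤ-Solver.solve-∀
      offset≡ : offset t′ ≡ offset t₀′
      offset≡ = roundUp-injective (Line.1≤Δ₁ (Splitting.line split)) Δ₁∣offset (cong (λ L → proj₁ (proj₂ (proj₂ L))) label≡)
      s≡ : sOf t′ ≡ sOf t₀′
      s≡ = trans (mod-÷ (sOf t′) blockLength) (trans (cong₂ (λ o b → o + b * blockLength) offset≡ (SameClass.same-block t′t₀′))
        (sym (mod-÷ (sOf t₀′) blockLength)))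
      h′≡ : hOf t′ ≡ hOf t₀′
      h′≡ = same-s⇒same-h t′t₀′ (trans (cong (λ s → + s -ᶻ + sOf t₀′) s≡) (ℤₚ.+-inverseʳ (+ sOf t₀′)))
      h≡ : hOf t ≡ hOf t₀
      h≡ = roundUp-injective (1≤lcmOf {t , t′} {v} (same , split))
        (lcm-least-∣ᶻ _
          (∣-same-subtrahend (hOf t₀′) (hOf t) (hOf t₀) (subst (λ y → δ ∣ᶻ + hOf t -ᶻ + y) h′≡ (Splitting.δ∣ split)) (Splitting.δ∣ split₀))
          (∣-same-summand (hOf t₀′) (hOf t) (hOf t₀)
            (subst (λ y → δ′ ∣ᶻ + y) (trans (cong (λ y → hOf t + y) h′≡) (+-comm (hOf t) (hOf t₀′))) (Splitting.δ′∣ split))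
            (subst (λ y → δ′ ∣ᶻ + y) (+-comm (hOf t₀) (hOf t₀′)) (Splitting.δ′∣ split₀))))
        (cong (λ L → proj₂ (proj₂ (proj₂ L))) label≡)
    fiber : ∀ {b} → IsLabel (proj₁ b) × proj₂ b < K → AtMost (τ * 2 * (τ * 2)) (λ p → DensePair p × R p b)
    fiber {b} _ = AtMost-rebase λ { {t₀ , t₀′} (_ , block₀ , _ , split₀ , label₀) →
      AtMost-⊆ {Q = λ p → InClass (shift t₀) (mOf t₀ , hOf t₀) (proj₁ p) × InClass (shift t₀) (mOf t₀′ , hOf t₀′) (proj₂ p)}
        (λ { (((_ , prim , prim′) , _) , block₁ , _ , split , label₁) →
          into split₀ split (trans block₁ (sym block₀)) (trans label₁ (sym label₀)) prim prim′ })
        (AtMost-× _≟⁴_ (AtMost-InClass _ _) (AtMost-InClass _ _)) }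

  AtMost-Pair : AtMost (solution-bound * (τ * 2) + (solution-bound * τ * (τ * 2) + τ * τ * factor-bound * K * (τ * 2 * (τ * 2)))) Pair
  AtMost-Pair = AtMost-⊆ classify (AtMost-⊎ AtMost-equal-h (AtMost-⊎ AtMost-sparse AtMost-dense))
    where
    classify : ∀ {p} → Pair p → (Pair p × hOf (proj₁ p) ≡ hOf (proj₂ p)) ⊎ (SparsePair p ⊎ DensePair p)
    classify {t , t′} pair@(same , _) = by-h (hOf t ≟ hOf t′)
      where
      by-lcm : ∀ v → Split (t , t′) v → lcmOf v ≤ H ⊎ H < lcmOf v → SparsePair (t , t′) ⊎ DensePair (t , t′)
      by-lcm v split (inj₁ L≤H) = inj₂ (pair , v , split , L≤H)
      by-lcm v split (inj₂ H<L) = inj₁ (pair , v , split , H<L)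
      by-h : Dec (hOf t ≡ hOf t′) → (Pair (t , t′) × hOf t ≡ hOf t′) ⊎ (SparsePair (t , t′) ⊎ DensePair (t , t′))
      by-h (yes h≡) = inj₁ (pair , h≡)
      by-h (no h≢) = let (v , split) = splitting same h≢ in inj₂ (by-lcm v (same , split) (≤-<-connex (lcmOf v) H))

  -- The constant is 8 + 8 + 256: equal h gives 8τ³MH, a large lcm gives 8τ⁴MH, and the dense pairs
  -- give 256τ⁷MH.
  pair-bound : ∀ n → n * K ≤ 8 * M * (4 * H) * (τ * 2 * (τ * τ)) → 1 ≤ τ →
    solution-bound * (τ * 2) + (solution-bound * τ * (τ * 2) + τ * τ * n * K * (τ * 2 * (τ * 2))) ≤ 272 * τ ^ 7 * (M * H)
  pair-bound n nK≤ 1≤τ = begin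
    solution-bound * (τ * 2) + (solution-bound * τ * (τ * 2) + τ * τ * n * K * (τ * 2 * (τ * 2)))
      ≡⟨ cong₂ _+_ (first τ M H) (cong₂ _+_ (second τ M H) (third τ n K)) ⟩
    τ * τ * τ * E + (τ * τ * τ * τ * E + n * K * (4 * (τ * τ * τ * τ)))
      ≤⟨ +-mono-≤ (*-monoˡ-≤ E le₃) (+-mono-≤ (*-monoˡ-≤ E le₄) (*-monoˡ-≤ (4 * (τ * τ * τ * τ)) nK≤)) ⟩
    τ ^ 7 * E + (τ ^ 7 * E + 8 * M * (4 * H) * (τ * 2 * (τ * τ)) * (4 * (τ * τ * τ * τ)))
      ≡⟨ total τ M H ⟩
    272 * τ ^ 7 * (M * H) ∎
    where
    open ≤-Reasoning
    E = 8 * (M * H)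
    instance
      τ≢0 : NonZero τ
      τ≢0 = >-nonZero 1≤τ
    le₄ : τ * τ * τ * τ ≤ τ ^ 7
    le₄ = ≤-trans (m≤m*n (τ * τ * τ * τ) (τ * τ * τ) {{m*n≢0 (τ * τ) τ {{m*n≢0 τ τ}}}}) (≤-reflexive (seven τ))
      where
      seven : ∀ τ → τ * τ * τ * τ * (τ * τ * τ) ≡ τ * (τ * (τ * (τ * (τ * (τ * (τ * 1))))))
      seven = solve-∀
    le₃ : τ * τ * τ ≤ τ ^ 7
    le₃ = ≤-trans (m≤m*n (τ * τ * τ) τ) le₄
    first : ∀ τ M H → τ * τ * (4 * M * H) * (τ * 2) ≡ τ * τ * τ * (8 * (M * H))
    first = solve-∀
    second : ∀ τ M H → τ * τ * (4 * M * H) * τ * (τ * 2) ≡ τ * τ * τ * τ * (8 * (M * H))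
    second = solve-∀
    third : ∀ τ n K → τ * τ * n * K * (τ * 2 * (τ * 2)) ≡ n * K * (4 * (τ * τ * τ * τ))
    third = solve-∀
    total : ∀ τ M H → (τ * (τ * (τ * (τ * (τ * (τ * (τ * 1))))))) * (8 * (M * H)) + ((τ * (τ * (τ * (τ * (τ * (τ * (τ * 1))))))) * (8 * (M * H)) + 8 * M * (4 * H) * (τ * 2 * (τ * τ)) * (4 * (τ * τ * τ * τ))) ≡ 272 * (τ * (τ * (τ * (τ * (τ * (τ * (τ * 1))))))) * (M * H)
    total = solve-∀

  AtMost-primitive-Pair : 1 ≤ τ → AtMost (272 * τ ^ 7 * (M * H)) Pair
  AtMost-primitive-Pair 1≤τ = AtMost-weaken (pair-bound factor-bound (÷-*-≤ (8 * M * (4 * H) * (τ * 2 * (τ * τ))) K) 1≤τ) AtMost-Pair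

-- Reduction to primitive solutions

coprime-1 : ∀ {n} → Coprime n 1
coprime-1 (_ , d∣1) = ∣1⇒≡1 d∣1

content : ℕ → Quad → ℕ
content r (k₁ , k₂ , _) = gcd (gcd k₁ k₂) r

-- Blocks refer to the data after division by V, with the same K for every V. The definition takes
-- the unreduced quadruple, so that all solutions can be classified at once, before their common
-- factor is fixed.
reducedBlock : (K M V : ℕ) → Quad → ℕ
reducedBlock K M V (_ , _ , m , h) = (2 * (m ÷ V) + h ÷ V) ÷ suc (2 * (M ÷ V) ÷ K)

÷-exact : ∀ {n d} → 1 ≤ d → d ∣ n → n ≡ n ÷ d * d
÷-exact {d = d} 1≤d (divides q refl) = cong (_* d) (sym (*-÷ q d 1≤d))

module Reduction (r j M H K : ℕ) .{{_ : NonZero r}} (cop-j : Coprime r j)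
  (M≤r : M ≤ r) (HH≤r : H * H ≤ r) (1≤K : 1 ≤ K) (many-blocks : 8 * (H * H * M) < K * r)
  {τ : ℕ} (τ-bd : DivisorBound (4 * r) τ) (1≤τ : 1 ≤ τ) where

  private
    1≤r : 1 ≤ r
    1≤r = >-nonZero⁻¹ r

  open Solutions r 1 j M H coprime-1 cop-j using (Solution; module Solution; shift; IsRoot; module IsRoot; k₁-determined)

  -- If v divides k then squarePart v divides every m with k² ≡ jm (mod r).
  squarePart : ℕ → ℕ
  squarePart v = gcd (v * v) r

  blockOf : Quad → ℕ
  blockOf t = reducedBlock K M (squarePart (content r t)) t

  Collision : Quad × Quad → Set
  Collision (t , t′) = (Solution t × Solution t′) × shift t ≡ shift t′ × content r t ≡ content r t′ × blockOf t ≡ blockOf t′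

  module Fixed (v : ℕ) (v∣r : v ∣ r) where

    1≤v : 1 ≤ v
    1≤v = ∣-pos 1≤r v∣r
    V = squarePart v
    open GCDView (gcd-view (v * v) r 1≤r) renaming (a to c; b to r′; m≡ to vv≡; n≡ to r≡; coprime to c⊥r′)
    1≤V : 1 ≤ V
    1≤V = ∣-pos 1≤r (gcd[m,n]∣n (v * v) r)
    1≤r′ : 1 ≤ r′
    1≤r′ = pos-factorʳ {V} (sym r≡) 1≤r
    instance
      v≢0 : NonZero v
      v≢0 = >-nonZero 1≤v
      V≢0 : NonZero V
      V≢0 = >-nonZero 1≤V
      r′≢0 : NonZero r′
      r′≢0 = >-nonZero 1≤r′
    v∣V : v ∣ V
    v∣V = gcd-greatest (m∣m*n v) v∣r
    -- The quotient κ = k / v runs below r / v = ur′, whereas the reduced congruence sees it only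
    -- modulo r′: u is the number of lifts of one reduced root.
    u = V ÷ v
    V≡ : V ≡ u * v
    V≡ = ÷-exact 1≤v v∣V
    r≡uv : r ≡ u * r′ * v
    r≡uv = trans r≡ (trans (cong (_* r′) V≡) (swap u v r′))
      where
      swap : ∀ u v r → u * v * r ≡ u * r * v
      swap = solve-∀
    r′∣r : r′ ∣ r
    r′∣r = divides V r≡
    V∣r : V ∣ r
    V∣r = gcd[m,n]∣n (v * v) r
    u≤v : u ≤ v
    u≤v = ∣-pos-≤ 1≤v (*-cancelʳ-∣ v (subst (_∣ v * v) V≡ (gcd[m,n]∣m (v * v) r)))

    M′ = M ÷ V
    H′ = H ÷ V

    r′V≡ : r′ * V ≡ r
    r′V≡ = trans (*-comm r′ V) (sym r≡)

    M′≤r′ : M′ ≤ r′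
    M′≤r′ = *-cancelʳ-≤ M′ r′ V (≤-trans (÷-*-≤ M V) (≤-trans M≤r (≤-reflexive (sym r′V≡))))

    H′V≤H : H′ * V ≤ H
    H′V≤H = ÷-*-≤ H V

    H′≤H : H′ ≤ H
    H′≤H = ≤-trans (m≤m*n H′ V) H′V≤H

    H′H′≤r′ : H′ * H′ ≤ r′
    H′H′≤r′ = *-cancelʳ-≤ (H′ * H′) r′ V (begin
      H′ * H′ * V     ≡⟨ *-assoc H′ H′ V ⟩
      H′ * (H′ * V)   ≤⟨ *-mono-≤ H′≤H H′V≤H ⟩
      H * H           ≤⟨ HH≤r ⟩
      r               ≡⟨ r′V≡ ⟨
      r′ * V          ∎)
      where open ≤-Reasoning

    many-blocks′ : 8 * (H′ * H′ * M′) < K * r′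
    many-blocks′ = *-cancelʳ-< V _ (K * r′) (begin-strict
      8 * (H′ * H′ * M′) * V     ≡⟨ rearrange H′ M′ V ⟩
      8 * (H′ * H′ * (M′ * V))   ≤⟨ *-monoʳ-≤ 8 (*-mono-≤ (*-mono-≤ H′≤H H′≤H) (÷-*-≤ M V)) ⟩
      8 * (H * H * M)            <⟨ many-blocks ⟩
      K * r                      ≡⟨ cong (K *_) (sym r′V≡) ⟩
      K * (r′ * V)               ≡⟨ *-assoc K r′ V ⟨
      K * r′ * V                 ∎)
      where
      open ≤-Reasoning
      rearrange : ∀ H M V → 8 * (H * H * M) * V ≡ 8 * (H * H * (M * V))
      rearrange = solve-∀

    τ-bd′ : DivisorBound (4 * r′) τ
    τ-bd′ n 1≤n n≤ = τ-bd n 1≤n (≤-trans n≤ (*-monoʳ-≤ 4 (∣-pos-≤ 1≤r r′∣r)))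

    cop-c′ : Coprime r′ c
    cop-c′ = Coprimality.sym c⊥r′

    cop-j′ : Coprime r′ j
    cop-j′ = Coprime-∣ r′∣r cop-j

    open Pairs r′ c j M′ H′ K cop-c′ cop-j′ M′≤r′ H′H′≤r′ 1≤K many-blocks′ τ-bd′ using (Pair; SameClass; sameClass; AtMost-primitive-Pair)
    module R = Solutions r′ c j M′ H′ cop-c′ cop-j′

    reduce : Quad → Quad
    reduce (k₁ , k₂ , m , h) = (k₁ ÷ v) mod r′ , (k₂ ÷ v) mod r′ , m ÷ V , h ÷ V

    record Reducible (k : ℕ) : Set where
      constructor reducible
      field
        v∣k : v ∣ k
        k<r : k < r
      digit-< : (k ÷ v) ÷ r′ < u
      digit-< = ÷-< r′ 1≤r′ (*-cancelʳ-< v _ (u * r′) (subst₂ _<_ (÷-exact 1≤v v∣k) r≡uv k<r))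
      k≡ : k ≡ ((k ÷ v) mod r′ + (k ÷ v) ÷ r′ * r′) * v
      k≡ = trans (÷-exact 1≤v v∣k) (cong (_* v) (mod-÷ (k ÷ v) r′))

    mod-∣ : ∀ k → r′ ∣ᶻ + (k mod r′) -ᶻ + k
    mod-∣ k = S.divides (-ᶻ + (k ÷ r′)) (trans (cong (λ x → + (k mod r′) -ᶻ x)
      (trans (cong +_ (mod-÷ k r′)) (cong (λ x → + (k mod r′) +ᶻ x) (ℤₚ.pos-* (k ÷ r′) r′))))
      (identity (+ (k mod r′)) (+ (k ÷ r′)) (+ r′)))
      where
      identity : ∀ x y z → x -ᶻ (x +ᶻ y *ᶻ z) ≡ -ᶻ y *ᶻ z
      identity = ℤ-Solver.solve-∀

    V∣root : ∀ {m k} → v ∣ k → IsRoot m k → V ∣ m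
    V∣root {m} {k} v∣k root = ∣ᶻ⇒∣ (∣ᶻ-cancel (Coprime-∣ V∣r cop-j) (+ m)
      (∣ᶻ-lin (+ 1) (-ᶻ + 1) V∣kk (∣-∣ᶻ-trans V∣r (IsRoot.root-∣ root)) (identity (+ j) (+ k) (+ m))))
      where
      V∣kk : V ∣ᶻ + 1 *ᶻ (+ k *ᶻ + k)
      V∣kk = ∣⇒∣ᶻ _ (subst (V ∣_) (sym (trans (ℤₚ.abs-* (+ 1) (+ k *ᶻ + k)) (trans (+-identityʳ _) (ℤₚ.abs-* (+ k) (+ k)))))
        (∣-trans (gcd[m,n]∣m (v * v) r) (*-pres-∣ v∣k v∣k)))
      identity : ∀ j k m → j *ᶻ m ≡ + 1 *ᶻ (+ 1 *ᶻ (k *ᶻ k)) +ᶻ (-ᶻ + 1) *ᶻ (+ 1 *ᶻ (k *ᶻ k) -ᶻ j *ᶻ m)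
      identity = ℤ-Solver.solve-∀

    reduce-root : ∀ {m k} → v ∣ k → V ∣ m → IsRoot m k → R.IsRoot (m ÷ V) ((k ÷ v) mod r′)
    reduce-root {m} {k} v∣k V∣m root = R.isRoot
      (∣ᶻ-lin (+ 1) (+ c *ᶻ (+ (κ mod r′) +ᶻ + κ)) unreduced (mod-∣ κ) (identity (+ c) (+ j) (+ κ) (+ (κ mod r′)) (+ (m ÷ V))))
      where
      κ = k ÷ v
      factored : + 1 *ᶻ (+ k *ᶻ + k) -ᶻ + j *ᶻ + m ≡ + V *ᶻ (+ c *ᶻ (+ κ *ᶻ + κ) -ᶻ + j *ᶻ + (m ÷ V))
      factored = begin
        + 1 *ᶻ (+ k *ᶻ + k) -ᶻ + j *ᶻ + m
          ≡⟨ cong₂ (λ x y → + 1 *ᶻ (x *ᶻ x) -ᶻ + j *ᶻ y)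
              (trans (cong +_ (÷-exact 1≤v v∣k)) (ℤₚ.pos-* κ v)) (trans (cong +_ (÷-exact 1≤V V∣m)) (ℤₚ.pos-* (m ÷ V) V)) ⟩
        + 1 *ᶻ ((+ κ *ᶻ + v) *ᶻ (+ κ *ᶻ + v)) -ᶻ + j *ᶻ (+ (m ÷ V) *ᶻ + V)
          ≡⟨ regroup (+ κ) (+ v) (+ j) (+ (m ÷ V)) (+ V) ⟩
        (+ v *ᶻ + v) *ᶻ (+ κ *ᶻ + κ) -ᶻ + V *ᶻ (+ j *ᶻ + (m ÷ V))
          ≡⟨ cong (λ x → x *ᶻ (+ κ *ᶻ + κ) -ᶻ + V *ᶻ (+ j *ᶻ + (m ÷ V)))
              (trans (sym (ℤₚ.pos-* v v)) (trans (cong +_ vv≡) (ℤₚ.pos-* V c))) ⟩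
        (+ V *ᶻ + c) *ᶻ (+ κ *ᶻ + κ) -ᶻ + V *ᶻ (+ j *ᶻ + (m ÷ V))
          ≡⟨ extract (+ V) (+ c) (+ κ) (+ j *ᶻ + (m ÷ V)) ⟩
        + V *ᶻ (+ c *ᶻ (+ κ *ᶻ + κ) -ᶻ + j *ᶻ + (m ÷ V)) ∎
        where
        open ≡-Reasoning
        regroup : ∀ κ v j m V → + 1 *ᶻ ((κ *ᶻ v) *ᶻ (κ *ᶻ v)) -ᶻ j *ᶻ (m *ᶻ V) ≡ (v *ᶻ v) *ᶻ (κ *ᶻ κ) -ᶻ V *ᶻ (j *ᶻ m)
        regroup = ℤ-Solver.solve-∀
        extract : ∀ V c κ x → (V *ᶻ c) *ᶻ (κ *ᶻ κ) -ᶻ V *ᶻ x ≡ V *ᶻ (c *ᶻ (κ *ᶻ κ) -ᶻ x)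
        extract = ℤ-Solver.solve-∀
      unreduced : r′ ∣ᶻ + c *ᶻ (+ κ *ᶻ + κ) -ᶻ + j *ᶻ + (m ÷ V)
      unreduced = S.*-cancelˡ-∣ (+ V) (subst₂ S._∣_ (trans (cong +_ r≡) (ℤₚ.pos-* V r′)) factored (IsRoot.root-∣ root))
      identity : ∀ c j k x m → c *ᶻ (x *ᶻ x) -ᶻ j *ᶻ m ≡
        + 1 *ᶻ (c *ᶻ (k *ᶻ k) -ᶻ j *ᶻ m) +ᶻ (c *ᶻ (x +ᶻ k)) *ᶻ (x -ᶻ k)
      identity = ℤ-Solver.solve-∀

    module _ {t : Quad} (sol : Solution t) (content≡ : content r t ≡ v) where

      open Solution sol

      v∣k₁k₂ : v ∣ gcd k₁ k₂
      v∣k₁k₂ = subst (_∣ gcd k₁ k₂) content≡ (gcd[m,n]∣m (gcd k₁ k₂) r)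

      reducible₁ : Reducible k₁
      reducible₁ = reducible (∣-trans v∣k₁k₂ (gcd[m,n]∣m k₁ k₂)) k₁<
      reducible₂ : Reducible k₂
      reducible₂ = reducible (∣-trans v∣k₁k₂ (gcd[m,n]∣n k₁ k₂)) k₂<

      V∣m : V ∣ m
      V∣m = V∣root (Reducible.v∣k reducible₂) root₂
      V∣h : V ∣ h
      V∣h = ∣m+n∣m⇒∣n (V∣root (Reducible.v∣k reducible₁) root₁) V∣m

      m+h÷ : (m + h) ÷ V ≡ m ÷ V + h ÷ V
      m+h÷ = *-cancelʳ-≡ ((m + h) ÷ V) (m ÷ V + h ÷ V) V (begin
        (m + h) ÷ V * V       ≡⟨ ÷-exact 1≤V (∣m∣n⇒∣m+n V∣m V∣h) ⟨
        m + h                 ≡⟨ cong₂ _+_ (÷-exact 1≤V V∣m) (÷-exact 1≤V V∣h) ⟩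
        m ÷ V * V + h ÷ V * V ≡⟨ *-distribʳ-+ V (m ÷ V) (h ÷ V) ⟨
        (m ÷ V + h ÷ V) * V   ∎)
        where open ≡-Reasoning

      reduce-solution : R.Solution (reduce t)
      reduce-solution = R.solution
        (mod-< (k₁ ÷ v) r′ 1≤r′) (mod-< (k₂ ÷ v) r′ 1≤r′)
        (pos-factorˡ {m ÷ V} (sym (÷-exact 1≤V V∣m)) 1≤m)
        (subst (_≤ M′) m+h÷ (÷-greatest V 1≤V (≤-trans (÷-*-≤ (m + h) V) m+h≤M)))
        (pos-factorˡ {h ÷ V} (sym (÷-exact 1≤V V∣h)) 1≤h)
        (÷-greatest V 1≤V (≤-trans (÷-*-≤ h V) h≤H))
        (subst (λ y → R.IsRoot y ((k₁ ÷ v) mod r′)) m+h÷ (reduce-root (Reducible.v∣k reducible₁) (∣m∣n⇒∣m+n V∣m V∣h) root₁))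
        (reduce-root (Reducible.v∣k reducible₂) V∣m root₂)

      -- If d divides r′ and both reduced roots, then dv divides k₁, k₂ and r = ur′v, hence their
      -- gcd v.
      reduce-primitive : R.Primitive (reduce t)
      reduce-primitive {d} d∣₁ d∣₂ d∣r′ = ∣1⇒≡1 (*-cancelʳ-∣ v (subst (d * v ∣_) (trans content≡ (sym (*-identityˡ v)))
        (gcd-greatest (gcd-greatest (lift reducible₁ d∣₁) (lift reducible₂ d∣₂))
          (subst (d * v ∣_) (sym r≡uv) (*-monoˡ-∣ v (∣n⇒∣m*n u d∣r′))))))
        where
        lift : ∀ {k} → Reducible k → d ∣ (k ÷ v) mod r′ → d * v ∣ k
        lift {k} red d∣ = subst (d * v ∣_) (sym (Reducible.k≡ red)) (*-monoˡ-∣ v (∣m∣n⇒∣m+n d∣ (∣n⇒∣m*n ((k ÷ v) ÷ r′) d∣r′)))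

    reduce-shift : ∀ {t t′} → Solution t → Solution t′ → content r t ≡ v → content r t′ ≡ v →
      shift t ≡ shift t′ → R.shift (reduce t) ≡ R.shift (reduce t′)
    reduce-shift {t@(k₁ , k₂ , _)} {t′@(k₃ , k₄ , _)} sol sol′ ct ct′ eq =
      ∣⇒%ℕ-≡ (+ (κ k₁ mod r′) -ᶻ + (κ k₂ mod r′)) (+ (κ k₃ mod r′) -ᶻ + (κ k₄ mod r′)) r′
        (∣ᶻ-lin (+ 1) (+ 1) (∣ᶻ-lin (+ 1) (-ᶻ + 1) (mod-∣ (κ k₁)) (mod-∣ (κ k₂)) refl)
          (∣ᶻ-lin₃ (-ᶻ + 1) (+ 1) (+ 1) (mod-∣ (κ k₃)) (mod-∣ (κ k₄)) r′∣κ refl)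
          (identity (+ (κ k₁ mod r′)) (+ (κ k₂ mod r′)) (+ (κ k₃ mod r′)) (+ (κ k₄ mod r′)) (+ κ k₁) (+ κ k₂) (+ κ k₃) (+ κ k₄)))
      where
      κ : ℕ → ℕ
      κ k = k ÷ v
      cast : ∀ {k} → Reducible k → + k ≡ + v *ᶻ + κ k
      cast {k} red = trans (cong +_ (trans (÷-exact 1≤v (Reducible.v∣k red)) (*-comm (κ k) v))) (ℤₚ.pos-* v (κ k))
      expand : (+ k₁ -ᶻ + k₂) -ᶻ (+ k₃ -ᶻ + k₄) ≡ + v *ᶻ ((+ κ k₁ -ᶻ + κ k₂) -ᶻ (+ κ k₃ -ᶻ + κ k₄))
      expand = trans (cong₂ _-ᶻ_ (cong₂ _-ᶻ_ (cast (reducible₁ sol ct)) (cast (reducible₂ sol ct)))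
        (cong₂ _-ᶻ_ (cast (reducible₁ sol′ ct′)) (cast (reducible₂ sol′ ct′))))
        (distribute (+ v) (+ κ k₁) (+ κ k₂) (+ κ k₃) (+ κ k₄))
        where
        distribute : ∀ v a b c d → (v *ᶻ a -ᶻ v *ᶻ b) -ᶻ (v *ᶻ c -ᶻ v *ᶻ d) ≡ v *ᶻ ((a -ᶻ b) -ᶻ (c -ᶻ d))
        distribute = ℤ-Solver.solve-∀
      r′∣κ : r′ ∣ᶻ (+ κ k₁ -ᶻ + κ k₂) -ᶻ (+ κ k₃ -ᶻ + κ k₄)
      r′∣κ = ∣-∣ᶻ-trans (n∣m*n u) (S.*-cancelˡ-∣ (+ v) (subst₂ S._∣_
        (trans (cong +_ (trans r≡uv (*-comm (u * r′) v))) (ℤₚ.pos-* v (u * r′))) expand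
        (%ℕ-≡⇒∣ (+ k₁ -ᶻ + k₂) (+ k₃ -ᶻ + k₄) r eq)))
      identity : ∀ x₁ x₂ x₃ x₄ a b c d → (x₁ -ᶻ x₂) -ᶻ (x₃ -ᶻ x₄) ≡
        + 1 *ᶻ (+ 1 *ᶻ (x₁ -ᶻ a) +ᶻ (-ᶻ + 1) *ᶻ (x₂ -ᶻ b))
        +ᶻ + 1 *ᶻ ((-ᶻ + 1) *ᶻ (x₃ -ᶻ c) +ᶻ + 1 *ᶻ (x₄ -ᶻ d) +ᶻ + 1 *ᶻ ((a -ᶻ b) -ᶻ (c -ᶻ d)))
      identity = ℤ-Solver.solve-∀

    digit : ℕ → ℕ
    digit k = (k ÷ v) ÷ r′

    CollisionAt : Quad × Quad → Set
    CollisionAt p = Collision p × content r (proj₁ p) ≡ v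

    -- The recorded quotients by r′ restore k₁, k₂ and k₃; the fourth root follows from the equality
    -- of differences modulo r.
    encode : Quad × Quad → (Quad × Quad) × ℕ × ℕ × ℕ
    encode (t@(k₁ , k₂ , _) , t′@(k₃ , _)) = (reduce t , reduce t′) , digit k₁ , digit k₂ , digit k₃

    encode-into : ∀ {p} → CollisionAt p →
      Pair (proj₁ (encode p)) × digit (proj₁ (proj₁ p)) < u × digit (proj₁ (proj₂ (proj₁ p))) < u × digit (proj₁ (proj₂ p)) < u
    encode-into {t , t′} (((sol , sol′) , shift≡ , content≡ , block≡) , refl) =
      (sameClass (reduce-solution sol refl) (reduce-solution sol′ (sym content≡))
          (reduce-shift sol sol′ refl (sym content≡) shift≡)
          (trans block≡ (cong (λ w → reducedBlock K M (squarePart w) t′) (sym content≡))) ,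
        reduce-primitive sol refl , reduce-primitive sol′ (sym content≡)) ,
      Reducible.digit-< (reducible₁ sol refl) , Reducible.digit-< (reducible₂ sol refl) ,
      Reducible.digit-< (reducible₁ sol′ (sym content≡))

    recover : ∀ {k k′} → Reducible k → Reducible k′ → (k ÷ v) mod r′ ≡ (k′ ÷ v) mod r′ → digit k ≡ digit k′ → k ≡ k′
    recover red red′ eq deq = trans (Reducible.k≡ red) (trans (cong₂ (λ x y → (x + y * r′) * v) eq deq) (sym (Reducible.k≡ red′)))

    recover-mh : ∀ {m m′} → V ∣ m → V ∣ m′ → m ÷ V ≡ m′ ÷ V → m ≡ m′
    recover-mh V∣m V∣m′ eq = trans (÷-exact 1≤V V∣m) (trans (cong (_* V) eq) (sym (÷-exact 1≤V V∣m′)))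

    k₂-determined : ∀ k₁ {k₂ k₂′} → k₂ < r → k₂′ < r → (+ k₁ -ᶻ + k₂) %ℕ r ≡ (+ k₁ -ᶻ + k₂′) %ℕ r → k₂ ≡ k₂′
    k₂-determined k₁ {k₂} {k₂′} k₂< k₂′< eq = cong-small
      (∣ᶻ-* (-ᶻ + 1) (%ℕ-≡⇒∣ (+ k₁ -ᶻ + k₂) (+ k₁ -ᶻ + k₂′) r eq) (identity (+ k₁) (+ k₂) (+ k₂′))) k₂< k₂′<
      where
      identity : ∀ x y z → y -ᶻ z ≡ (-ᶻ + 1) *ᶻ ((x -ᶻ y) -ᶻ (x -ᶻ z))
      identity = ℤ-Solver.solve-∀

    encode-injective : ∀ {p q} → CollisionAt p → CollisionAt q → encode p ≡ encode q → p ≡ q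
    encode-injective {t@(k₁ , k₂ , m , h) , t′@(k₃ , k₄ , m′ , h′)} {w@(l₁ , l₂ , n , g) , w′@(l₃ , l₄ , n′ , g′)}
      (((sol , sol′) , shift≡ , content≡ , _) , ct) (((wol , wol′) , wshift≡ , wcontent≡ , _) , cw) eq = cong₂ _,_ t≡w t′≡w′
      where
      ct′ : content r t′ ≡ v
      ct′ = trans (sym content≡) ct
      cw′ : content r w′ ≡ v
      cw′ = trans (sym wcontent≡) cw
      k₁≡ : k₁ ≡ l₁
      k₁≡ = recover (reducible₁ sol ct) (reducible₁ wol cw) (cong (λ e → proj₁ (proj₁ (proj₁ e))) eq) (cong (λ e → proj₁ (proj₂ e)) eq)
      k₂≡ : k₂ ≡ l₂
      k₂≡ = recover (reducible₂ sol ct) (reducible₂ wol cw) (cong (λ e → proj₁ (proj₂ (proj₁ (proj₁ e)))) eq) (cong (λ e → proj₁ (proj₂ (proj₂ e))) eq)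
      k₃≡ : k₃ ≡ l₃
      k₃≡ = recover (reducible₁ sol′ ct′) (reducible₁ wol′ cw′) (cong (λ e → proj₁ (proj₂ (proj₁ e))) eq) (cong (λ e → proj₂ (proj₂ (proj₂ e))) eq)
      k₄≡ : k₄ ≡ l₄
      k₄≡ = k₂-determined k₃ (Solution.k₂< sol′) (Solution.k₂< wol′)
        (trans (sym shift≡) (trans (cong₂ (λ x y → (+ x -ᶻ + y) %ℕ r) k₁≡ k₂≡)
          (trans wshift≡ (cong (λ x → (+ x -ᶻ + l₄) %ℕ r) (sym k₃≡)))))
      mh≡ : (m , h) ≡ (n , g)
      mh≡ = cong₂ _,_ (recover-mh (V∣m sol ct) (V∣m wol cw) (cong (λ e → proj₁ (proj₂ (proj₂ (proj₁ (proj₁ e))))) eq))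
        (recover-mh (V∣h sol ct) (V∣h wol cw) (cong (λ e → proj₂ (proj₂ (proj₂ (proj₁ (proj₁ e))))) eq))
      mh′≡ : (m′ , h′) ≡ (n′ , g′)
      mh′≡ = cong₂ _,_ (recover-mh (V∣m sol′ ct′) (V∣m wol′ cw′) (cong (λ e → proj₁ (proj₂ (proj₂ (proj₂ (proj₁ e))))) eq))
        (recover-mh (V∣h sol′ ct′) (V∣h wol′ cw′) (cong (λ e → proj₂ (proj₂ (proj₂ (proj₂ (proj₁ e))))) eq))
      t≡w : t ≡ w
      t≡w = cong₂ _,_ k₁≡ (cong₂ _,_ k₂≡ mh≡)
      t′≡w′ : t′ ≡ w′
      t′≡w′ = cong₂ _,_ k₃≡ (cong₂ _,_ k₄≡ mh′≡)

    -- From u ≤ v and uv = V one gets u³ ≤ u²v² = V², and M′V ≤ M, H′V ≤ H absorb this factor.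
    lifts-bound : 272 * τ ^ 7 * (M′ * H′) * (u * (u * u)) ≤ 272 * τ ^ 7 * (M * H)
    lifts-bound = begin
      272 * τ ^ 7 * (M′ * H′) * (u * (u * u))     ≤⟨ *-monoʳ-≤ (272 * τ ^ 7 * (M′ * H′)) cube ⟩
      272 * τ ^ 7 * (M′ * H′) * (V * V)           ≡⟨ rearrange (272 * τ ^ 7) M′ H′ V ⟩
      272 * τ ^ 7 * ((M′ * V) * (H′ * V))         ≤⟨ *-monoʳ-≤ (272 * τ ^ 7) (*-mono-≤ (÷-*-≤ M V) H′V≤H) ⟩
      272 * τ ^ 7 * (M * H)                       ∎
      where
      open ≤-Reasoning
      rearrange : ∀ x a b V → x * (a * b) * (V * V) ≡ x * ((a * V) * (b * V))
      rearrange = solve-∀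
      cube : u * (u * u) ≤ V * V
      cube = begin
        u * (u * u)         ≡⟨ *-assoc u u u ⟨
        u * u * u           ≤⟨ *-monoʳ-≤ (u * u) (≤-trans u≤v (m≤m*n v v)) ⟩
        u * u * (v * v)     ≡⟨ swap u v ⟩
        u * v * (u * v)     ≡⟨ cong₂ _*_ V≡ V≡ ⟨
        V * V               ∎
        where
        swap : ∀ u v → u * u * (v * v) ≡ u * v * (u * v)
        swap = solve-∀

    AtMost-CollisionAt : AtMost (272 * τ ^ 7 * (M * H)) CollisionAt
    AtMost-CollisionAt = AtMost-weaken lifts-bound (AtMost-injection encode encode-into encode-injective
      (AtMost-× (≡-dec _≟⁴_ _≟⁴_) (AtMost-primitive-Pair 1≤τ) (AtMost-× _≟_ (AtMost-< u) (AtMost-× _≟_ (AtMost-< u) (AtMost-< u)))))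

  AtMost-Collision : AtMost (τ * (272 * τ ^ 7 * (M * H))) Collision
  AtMost-Collision = AtMost-fiber _≟_ (λ p v → content r (proj₁ p) ≡ v)
    (λ {p} _ → content r (proj₁ p) , gcd[m,n]∣n (gcd (proj₁ (proj₁ p)) (proj₁ (proj₂ (proj₁ p)))) r , refl)
    (τ-bd r 1≤r (m≤n*m r 4))
    λ {v} v∣r → Fixed.AtMost-CollisionAt v v∣r

-- The divisor bound

*-^ : ∀ m n k → (m * n) ^ k ≡ m ^ k * n ^ k
*-^ m n zero = refl
*-^ m n (suc k) = trans (cong (m * n *_) (*-^ m n k)) (interchange m n (m ^ k) (n ^ k))
  where
  interchange : ∀ m n x y → m * n * (x * y) ≡ m * x * (n * y)
  interchange = solve-∀

-- Submultiplicativity for arbitrary a and b, so it applies to a list of primes with repetitions.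
AtMost-divisors-* : ∀ {x y a b} → 1 ≤ a * b → AtMost x (_∣ a) → AtMost y (_∣ b) → AtMost (x * y) (_∣ (a * b))
AtMost-divisors-* {x} {y} {a} {b} 1≤ab bd-a bd-b =
  AtMost-weaken (≤-reflexive (*-identityʳ (x * y)))
    (AtMost-fiber (≡-dec _≟_ _≟_) (λ δ f → proj₁ f * proj₂ f ≡ δ) label (AtMost-× _≟_ bd-a bd-b)
      λ _ → AtMost-subsingleton λ { (_ , refl) (_ , refl) → refl })
  where
  label : ∀ {δ} → δ ∣ a * b → ∃ λ f → (proj₁ f ∣ a × proj₂ f ∣ b) × proj₁ f * proj₂ f ≡ δ
  label {δ} δ∣ab =
    let (d , d′ , eq , d∣a , d′∣) = ∣ᶻ-split {δ} (+ a) (∣-pos 1≤ab δ∣ab)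
    in (d , d′) , (∣ᶻ⇒∣ d∣a , ∣ᶻ⇒∣ (d′∣ (+ b) (∣⇒∣ᶻ _ (subst (δ ∣_) (sym (ℤₚ.abs-* (+ a) (+ b))) δ∣ab)))) , eq

AtMost-divisors-1 : AtMost 1 (_∣ 1)
AtMost-divisors-1 = AtMost-subsingleton λ x∣1 y∣1 → trans (∣1⇒≡1 x∣1) (sym (∣1⇒≡1 y∣1))

AtMost-divisors-prime : ∀ {p} → Prime p → AtMost 2 (_∣ p)
AtMost-divisors-prime {p} pp = AtMost-⊆ (prime⇒irreducible pp)
  (AtMost-⊎ (AtMost-subsingleton {P = _≡ 1} λ { refl refl → refl }) (AtMost-subsingleton {P = _≡ p} λ { refl refl → refl }))

module _ {p : ℕ} (pp : Prime p) where

  private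
    instance
      p≢0 : NonZero p
      p≢0 = prime⇒nonZero pp

  ∤⇒coprime : ∀ {q} → ¬ p ∣ q → Coprime q p
  ∤⇒coprime p∤q (d∣q , d∣p) = go (prime⇒irreducible pp d∣p)
    where
    go : _ ⊎ _ → _
    go (inj₁ d≡1) = d≡1
    go (inj₂ refl) = contradiction d∣q p∤q

  coprime-^ : ∀ {q} a → Coprime q p → q ∣ p ^ a → q ≡ 1
  coprime-^ zero cop q∣1 = ∣1⇒≡1 q∣1
  coprime-^ (suc a) cop q∣ = coprime-^ a cop (coprime-divisor cop q∣)

  divisors-p^ : ∀ {δ} a → δ ∣ p ^ suc a → δ ∣ p ^ a ⊎ δ ≡ p ^ suc a
  divisors-p^ {δ} a δ∣@(divides q eq) with p ∣? q
  ... | yes (divides q′ refl) = inj₁ (divides q′ (*-cancelˡ-≡ (p ^ a) (q′ * δ) p (trans eq (swap q′ p δ))))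
    where
    swap : ∀ q p δ → q * p * δ ≡ p * (q * δ)
    swap = solve-∀
  ... | no p∤q = inj₂ (sym (trans eq (trans (cong (_* δ) (coprime-^ (suc a) (∤⇒coprime p∤q) (divides δ (trans eq (*-comm q δ))))) (+-identityʳ δ))))

  AtMost-divisors-p^ : ∀ a → AtMost (suc a) (_∣ p ^ a)
  AtMost-divisors-p^ zero = AtMost-divisors-1
  AtMost-divisors-p^ (suc a) = AtMost-weaken (≤-reflexive (+-comm (suc a) 1))
    (AtMost-⊆ (divisors-p^ a) (AtMost-⊎ (AtMost-divisors-p^ a) (AtMost-subsingleton {P = _≡ p ^ suc a} λ { refl refl → refl })))

suc≤2^ : ∀ n → suc n ≤ 2 ^ n
suc≤2^ zero = s≤s z≤n
suc≤2^ (suc n) = ≤-trans (+-mono-≤ {1} (m^n>0 2 n) (suc≤2^ n)) (≤-reflexive (cong (_+_ (2 ^ n)) (sym (+-identityʳ (2 ^ n)))))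

-- With b = ⌊a / N⌋ one has a + 1 ≤ (b + 1)N ≤ 2^b N, and bN ≤ a.
poly≤exp : ∀ N → 1 ≤ N → ∀ a → suc a ^ N ≤ N ^ N * 2 ^ a
poly≤exp N 1≤N a = begin
  suc a ^ N               ≤⟨ ^-monoˡ-≤ N (<-suc÷-* a N 1≤N) ⟩
  (suc b * N) ^ N         ≤⟨ ^-monoˡ-≤ N (*-monoˡ-≤ N (suc≤2^ b)) ⟩
  (2 ^ b * N) ^ N         ≡⟨ *-^ (2 ^ b) N N ⟩
  (2 ^ b) ^ N * N ^ N     ≡⟨ cong (_* N ^ N) (^-*-assoc 2 b N) ⟩
  2 ^ (b * N) * N ^ N     ≤⟨ *-monoˡ-≤ (N ^ N) (^-monoʳ-≤ 2 (÷-*-≤ a N)) ⟩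
  2 ^ a * N ^ N           ≡⟨ *-comm (2 ^ a) (N ^ N) ⟩
  N ^ N * 2 ^ a           ∎
  where
  open ≤-Reasoning
  b = a ÷ N

strip : ∀ B n → 2 ≤ B → 1 ≤ n → ∃₂ λ a n′ → n ≡ B ^ a * n′ × ¬ B ∣ n′
strip B n 2≤B 1≤n = go n 1≤n (<-wellFounded n)
  where
  go : ∀ n → 1 ≤ n → Acc _<_ n → ∃₂ λ a n′ → n ≡ B ^ a * n′ × ¬ B ∣ n′
  go n 1≤n (acc rec) with B ∣? n
  ... | no B∤n = 0 , n , sym (+-identityʳ n) , B∤n
  ... | yes (divides q refl) with go q (pos-factorˡ {q} refl 1≤n)
    (rec (m<m*n q B {{>-nonZero (pos-factorˡ {q} refl 1≤n)}} 2≤B))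
  ...   | a , n′ , refl , B∤n′ = suc a , n′ , trans (*-comm (B ^ a * n′) B) (sym (*-assoc B (B ^ a) n′)) , B∤n′

module _ (N : ℕ) (1≤N : 1 ≤ N) where

  FewDivisors : ℕ → ℕ → Set
  FewDivisors C n = ∃ λ d → AtMost d (_∣ n) × d ^ N ≤ C * n

  -- Each further prime p at most doubles the number of divisors, and 2^N ≤ p pays for that without
  -- a constant.
  product-of-large-primes : ∀ {B} ps → 2 ^ N ≤ B → All Prime ps → All (B ≤_) ps → FewDivisors 1 (product ps)
  product-of-large-primes [] _ _ _ = 1 , AtMost-divisors-1 , ≤-reflexive (^-zeroˡ N)
  product-of-large-primes {B} (p ∷ ps) 2^N≤B (pp ∷ pps) (B≤p ∷ B≤ps) with product-of-large-primes ps 2^N≤B pps B≤ps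
  ... | d , bd , d^N≤ = 2 * d , AtMost-divisors-* 1≤ (AtMost-divisors-prime pp) bd , (begin
      (2 * d) ^ N               ≡⟨ *-^ 2 d N ⟩
      2 ^ N * d ^ N             ≤⟨ *-mono-≤ (≤-trans 2^N≤B B≤p) d^N≤ ⟩
      p * (1 * product ps)      ≡⟨ cong (p *_) (+-identityʳ (product ps)) ⟩
      p * product ps            ≡⟨ +-identityʳ (p * product ps) ⟨
      1 * (p * product ps)      ∎)
    where
    open ≤-Reasoning
    1≤product : ∀ {qs} → All Prime qs → 1 ≤ product qs
    1≤product [] = ≤-refl
    1≤product (qp ∷ qps) = pos-* (>-nonZero⁻¹ _ {{prime⇒nonZero qp}}) (1≤product qps)
    1≤ : 1 ≤ p * product ps
    1≤ = 1≤product (pp ∷ pps)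

  rough-large : ∀ B → 2 ^ N ≤ B → ∀ n → 1 ≤ n → B Rough n → FewDivisors 1 n
  rough-large B 2^N≤B n 1≤n rough = subst (FewDivisors 1) (sym isFactorisation)
    (product-of-large-primes factors 2^N≤B factorsPrime (large factors factorsPrime (subst (B Rough_) isFactorisation rough)))
    where
    open PrimeFactorisation (factorise n {{>-nonZero 1≤n}})
    large : ∀ ps → All Prime ps → B Rough (product ps) → All (B ≤_) ps
    large [] [] _ = []
    large (p ∷ ps) (pp ∷ pps) rough =
      rough⇒≤ {{prime⇒nonTrivial pp}} (rough∧∣⇒rough rough (m∣m*n (product ps))) ∷
      large ps pps (rough∧∣⇒rough rough (n∣m*n p))

  -- The full power B^a is taken out. If a > 0, then B divides a B-rough number, hence is prime and
  -- B^a has a + 1 divisors; a composite B only occurs with a = 0. The factor N^N is that of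
  -- `poly≤exp`.
  rough-step : ∀ {B C} → 2 ≤ B → (∀ n → 1 ≤ n → suc B Rough n → FewDivisors C n) →
    ∀ n → 1 ≤ n → B Rough n → FewDivisors (N ^ N * C) n
  rough-step {B} {C} 2≤B few n 1≤n rough with strip B n 2≤B 1≤n
  ... | a , n′ , refl , B∤n′ with few n′ (pos-factorʳ {B ^ a} refl 1≤n) (∤⇒rough-suc B∤n′ (rough∧∣⇒rough rough (n∣m*n (B ^ a))))
  ...   | d , bd , d^N≤ = suc a * d , AtMost-divisors-* 1≤n (powers a rough) bd , (begin
      (suc a * d) ^ N                   ≡⟨ *-^ (suc a) d N ⟩
      suc a ^ N * d ^ N                 ≤⟨ *-mono-≤ (≤-trans (poly≤exp N 1≤N a) (*-monoʳ-≤ (N ^ N) (^-monoˡ-≤ a 2≤B))) d^N≤ ⟩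
      N ^ N * B ^ a * (C * n′)          ≡⟨ interchange (N ^ N) (B ^ a) C n′ ⟩
      N ^ N * C * (B ^ a * n′)          ∎)
    where
    open ≤-Reasoning
    interchange : ∀ x y C n → x * y * (C * n) ≡ x * C * (y * n)
    interchange = solve-∀
    powers : ∀ a → B Rough (B ^ a * n′) → AtMost (suc a) (_∣ B ^ a)
    powers zero _ = AtMost-divisors-1
    powers (suc a) rough = AtMost-divisors-p^ (rough∧∣⇒prime {{n>1⇒nonTrivial 2≤B}} rough
      (∣m⇒∣m*n n′ (m∣m*n (B ^ a)))) (suc a)

  -- `k` steps suffice to raise B to the threshold 2^N, and each step costs a factor N^N; so the
  -- constant depends on N only.
  few-divisors-rough : ∀ k B → 2 ≤ B → 2 ^ N ≤ B + k → ∃ λ C → ∀ n → 1 ≤ n → B Rough n → FewDivisors C n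
  few-divisors-rough zero B 2≤B le = 1 , rough-large B (subst (2 ^ N ≤_) (+-identityʳ B) le)
  few-divisors-rough (suc k) B 2≤B le =
    let (C , few) = few-divisors-rough k (suc B) (m≤n⇒m≤1+n 2≤B) (subst (2 ^ N ≤_) (+-suc B k) le)
    in N ^ N * C , rough-step 2≤B few

  divisor-bound : ∃ λ C → ∀ n → 1 ≤ n → FewDivisors C n
  divisor-bound =
    let (C , few) = few-divisors-rough (2 ^ N) 2 ≤-refl (m≤n+m (2 ^ N) 2)
    in C , λ n 1≤n → few n 1≤n 2-rough

  uniform-divisor-bound : ∃ λ C → ∀ R → ∃ λ τ → DivisorBound R τ × τ ^ N ≤ suc (C * R)
  uniform-divisor-bound = C , go
    where
    C = proj₁ divisor-bound
    0^≤ : ∀ k → 0 ^ k ≤ 1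
    0^≤ zero = ≤-refl
    0^≤ (suc _) = z≤n
    go : ∀ R → ∃ λ τ → DivisorBound R τ × τ ^ N ≤ suc (C * R)
    go zero = 0 , (λ n 1≤n n≤0 → contradiction (≤-trans 1≤n n≤0) λ ()) , ≤-trans (0^≤ N) (s≤s z≤n)
    go (suc R) with go R | proj₂ divisor-bound (suc R) (s≤s z≤n)
    ... | τ , bd , τ^N≤ | d , bd′ , d^N≤ = τ ⊔ d , bound , power (≤-total τ d)
      where
      bound : DivisorBound (suc R) (τ ⊔ d)
      bound n 1≤n n≤ = by (m≤n⇒m<n∨m≡n n≤)
        where
        by : n < suc R ⊎ n ≡ suc R → AtMost (τ ⊔ d) (_∣ n)
        by (inj₁ n<) = AtMost-weaken (m≤m⊔n τ d) (bd n 1≤n (≤-pred n<))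
        by (inj₂ refl) = AtMost-weaken (m≤n⊔m τ d) bd′
      power : τ ≤ d ⊎ d ≤ τ → (τ ⊔ d) ^ N ≤ suc (C * suc R)
      power (inj₁ τ≤d) = ≤-trans (≤-reflexive (cong (_^ N) (m≤n⇒m⊔n≡n τ≤d))) (≤-trans d^N≤ (n≤1+n _))
      power (inj₂ d≤τ) = ≤-trans (≤-reflexive (cong (_^ N) (m≥n⇒m⊔n≡m d≤τ)))
        (≤-trans τ^N≤ (s≤s (*-monoʳ-≤ C (n≤1+n R))))

-- Sums and the Cauchy–Schwarz inequality

module Sums where

  private variable
    A B : Set

  𝟙 : Bool → ℕ
  𝟙 true = 1
  𝟙 false = 0

  ∑ : List A → (A → ℕ) → ℕ
  ∑ [] f = 0
  ∑ (x ∷ xs) f = f x + ∑ xs f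

  ∑-mono : ∀ (xs : List A) {f g} → (∀ x → f x ≤ g x) → ∑ xs f ≤ ∑ xs g
  ∑-mono [] le = z≤n
  ∑-mono (x ∷ xs) le = +-mono-≤ (le x) (∑-mono xs le)

  ∑-mono-∈ : ∀ (xs : List A) {f g} → (∀ {x} → x ∈ xs → f x ≤ g x) → ∑ xs f ≤ ∑ xs g
  ∑-mono-∈ [] le = z≤n
  ∑-mono-∈ (x ∷ xs) le = +-mono-≤ (le (here refl)) (∑-mono-∈ xs (λ x∈ → le (there x∈)))

  ∑-cong : ∀ (xs : List A) {f g} → (∀ x → f x ≡ g x) → ∑ xs f ≡ ∑ xs g
  ∑-cong [] eq = refl
  ∑-cong (x ∷ xs) eq = cong₂ _+_ (eq x) (∑-cong xs eq)

  ∑-zero : ∀ (xs : List A) → ∑ xs (λ _ → 0) ≡ 0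
  ∑-zero [] = refl
  ∑-zero (x ∷ xs) = ∑-zero xs

  ∑-const : ∀ (xs : List A) n → ∑ xs (λ _ → n) ≡ length xs * n
  ∑-const [] n = refl
  ∑-const (x ∷ xs) n = cong (λ z → n + z) (∑-const xs n)

  ∑-+ : ∀ (xs : List A) f g → ∑ xs (λ x → f x + g x) ≡ ∑ xs f + ∑ xs g
  ∑-+ [] f g = refl
  ∑-+ (x ∷ xs) f g = trans (cong (λ z → f x + g x + z) (∑-+ xs f g)) (interchange (f x) (g x) (∑ xs f) (∑ xs g))
    where
    interchange : ∀ a b c d → a + b + (c + d) ≡ a + c + (b + d)
    interchange = solve-∀

  ∑-*ˡ : ∀ (xs : List A) n f → ∑ xs (λ x → n * f x) ≡ n * ∑ xs f
  ∑-*ˡ [] n f = sym (*-zeroʳ n)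
  ∑-*ˡ (x ∷ xs) n f = trans (cong (λ z → n * f x + z) (∑-*ˡ xs n f)) (sym (*-distribˡ-+ n (f x) (∑ xs f)))

  ∑-*ʳ : ∀ (xs : List A) n f → ∑ xs (λ x → f x * n) ≡ ∑ xs f * n
  ∑-*ʳ xs n f = trans (∑-cong xs (λ x → *-comm (f x) n)) (trans (∑-*ˡ xs n f) (*-comm n (∑ xs f)))

  ∑-swap : ∀ (xs : List A) (ys : List B) (f : A → B → ℕ) → ∑ xs (λ x → ∑ ys (f x)) ≡ ∑ ys (λ y → ∑ xs (λ x → f x y))
  ∑-swap [] ys f = sym (∑-zero ys)
  ∑-swap (x ∷ xs) ys f = trans (cong (λ z → ∑ ys (f x) + z) (∑-swap xs ys f)) (sym (∑-+ ys (f x) (λ y → ∑ xs (λ x → f x y))))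

  ∑-++ : ∀ (xs ys : List A) f → ∑ (xs ++ ys) f ≡ ∑ xs f + ∑ ys f
  ∑-++ [] ys f = refl
  ∑-++ (x ∷ xs) ys f = trans (cong (λ z → f x + z) (∑-++ xs ys f)) (sym (+-assoc (f x) (∑ xs f) (∑ ys f)))

  ∑-map : ∀ (xs : List A) (g : A → B) f → ∑ (map g xs) f ≡ ∑ xs (λ x → f (g x))
  ∑-map [] g f = refl
  ∑-map (x ∷ xs) g f = cong (λ z → f (g x) + z) (∑-map xs g f)

  ∑-cartesianProduct : ∀ (xs : List A) (ys : List B) f → ∑ (cartesianProduct xs ys) f ≡ ∑ xs (λ x → ∑ ys (λ y → f (x , y)))
  ∑-cartesianProduct [] ys f = refl
  ∑-cartesianProduct (x ∷ xs) ys f = trans (∑-++ (map (x ,_) ys) (cartesianProduct xs ys) f)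
    (cong₂ _+_ (∑-map ys (x ,_) f) (∑-cartesianProduct xs ys f))

  length-filterᵇ : ∀ p (xs : List A) → length (filterᵇ p xs) ≡ ∑ xs (λ x → 𝟙 (p x))
  length-filterᵇ p [] = refl
  length-filterᵇ p (x ∷ xs) with p x
  ... | true = cong suc (length-filterᵇ p xs)
  ... | false = length-filterᵇ p xs

  ∑< : ℕ → (ℕ → ℕ) → ℕ
  ∑< zero f = 0
  ∑< (suc n) f = f n + ∑< n f

  ∑<-mono : ∀ n {f g} → (∀ k → f k ≤ g k) → ∑< n f ≤ ∑< n g
  ∑<-mono zero le = z≤n
  ∑<-mono (suc n) le = +-mono-≤ (le n) (∑<-mono n le)

  ∑<-+ : ∀ n f g → ∑< n (λ k → f k + g k) ≡ ∑< n f + ∑< n g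
  ∑<-+ zero f g = refl
  ∑<-+ (suc n) f g = trans (cong (λ z → f n + g n + z) (∑<-+ n f g)) (interchange (f n) (g n) (∑< n f) (∑< n g))
    where
    interchange : ∀ a b c d → a + b + (c + d) ≡ a + c + (b + d)
    interchange = solve-∀

  ∑<-*ˡ : ∀ n c f → ∑< n (λ k → c * f k) ≡ c * ∑< n f
  ∑<-*ˡ zero c f = sym (*-zeroʳ c)
  ∑<-*ˡ (suc n) c f = trans (cong (λ z → c * f n + z) (∑<-*ˡ n c f)) (sym (*-distribˡ-+ c (f n) (∑< n f)))

  ∑<-swap : ∀ n (xs : List A) (f : ℕ → A → ℕ) → ∑< n (λ k → ∑ xs (f k)) ≡ ∑ xs (λ x → ∑< n (λ k → f k x))
  ∑<-swap zero xs f = sym (∑-zero xs)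
  ∑<-swap (suc n) xs f = trans (cong (λ z → ∑ xs (f n) + z) (∑<-swap n xs f)) (sym (∑-+ xs (f n) (λ x → ∑< n (λ k → f k x))))

  ≡ᵇ-refl : ∀ n → (n ≡ᵇ n) ≡ true
  ≡ᵇ-refl zero = refl
  ≡ᵇ-refl (suc n) = ≡ᵇ-refl n

  ≢⇒≡ᵇ-false : ∀ m n → m ≢ n → (m ≡ᵇ n) ≡ false
  ≢⇒≡ᵇ-false zero zero m≢n = contradiction refl m≢n
  ≢⇒≡ᵇ-false zero (suc n) _ = refl
  ≢⇒≡ᵇ-false (suc m) zero _ = refl
  ≢⇒≡ᵇ-false (suc m) (suc n) m≢n = ≢⇒≡ᵇ-false m n (λ eq → m≢n (cong suc eq))

  ∑<-delta-outside : ∀ n k (f : ℕ → ℕ) → n ≤ k → ∑< n (λ x → 𝟙 (k ≡ᵇ x) * f x) ≡ 0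
  ∑<-delta-outside zero k f _ = refl
  ∑<-delta-outside (suc n) k f n<k = cong₂ _+_
    (cong (λ b → 𝟙 b * f n) (≢⇒≡ᵇ-false k n (λ eq → <⇒≢ n<k (sym eq)))) (∑<-delta-outside n k f (<⇒≤ n<k))

  ∑<-delta : ∀ n k (f : ℕ → ℕ) → k < n → ∑< n (λ x → 𝟙 (k ≡ᵇ x) * f x) ≡ f k
  ∑<-delta (suc n) k f k<1+n with m≤n⇒m<n∨m≡n (≤-pred k<1+n)
  ... | inj₁ k<n = cong₂ _+_ (cong (λ b → 𝟙 b * f n) (≢⇒≡ᵇ-false k n (<⇒≢ k<n))) (∑<-delta n k f k<n)
  ... | inj₂ refl = trans (cong₂ _+_ (cong (λ b → 𝟙 b * f k) (≡ᵇ-refl k)) (∑<-delta-outside k k f ≤-refl))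
    (trans (+-identityʳ (f k + 0)) (+-identityʳ (f k)))

  AM-GM : ∀ a b → 2 * (a * b) ≤ a * a + b * b
  AM-GM a b = go (≤-total a b)
    where
    go′ : ∀ a b → a ≤ b → 2 * (a * b) ≤ a * a + b * b
    go′ a b a≤b = subst (λ b → 2 * (a * b) ≤ a * a + b * b) (m+[n∸m]≡n a≤b)
      (≤-trans (m≤m+n (2 * (a * (a + d))) (d * d)) (≤-reflexive (expand a d)))
      where
      d = b ∸ a
      expand : ∀ a d → 2 * (a * (a + d)) + d * d ≡ a * a + (a + d) * (a + d)
      expand = solve-∀
    go : a ≤ b ⊎ b ≤ a → 2 * (a * b) ≤ a * a + b * b
    go (inj₁ a≤b) = go′ a b a≤b
    go (inj₂ b≤a) = subst₂ _≤_ (cong (2 *_) (*-comm b a)) (+-comm (b * b) (a * a)) (go′ b a b≤a)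

  module _ {A : Set} (xs : List A) (n : ℕ) where

    -- A scalar product in disguise: by `correlation-mass` it is the sum over k of the weighted
    -- sizes of the fibres of f and g over k.
    correlation : (f g : A → ℕ) (v w : A → ℕ) → ℕ
    correlation f g v w = ∑ xs λ x → ∑ xs λ y → v x * w y * 𝟙 (f x ≡ᵇ g y)

    private
      mass : (f v : A → ℕ) → ℕ → ℕ
      mass f v k = ∑ xs λ x → v x * 𝟙 (f x ≡ᵇ k)

      ≡ᵇ-sym : ∀ k l → (k ≡ᵇ l) ≡ (l ≡ᵇ k)
      ≡ᵇ-sym zero zero = refl
      ≡ᵇ-sym zero (suc l) = refl
      ≡ᵇ-sym (suc k) zero = refl
      ≡ᵇ-sym (suc k) (suc l) = ≡ᵇ-sym k l

    correlation-mass : ∀ f g v w → (∀ x → f x < n) → correlation f g v w ≡ ∑< n (λ k → mass f v k * mass g w k)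
    correlation-mass f g v w f< = sym (begin
      ∑< n (λ k → mass f v k * mass g w k)
        ≡⟨ ∑<-cong n (λ k → sym (∑-*ʳ xs (mass g w k) (λ x → v x * 𝟙 (f x ≡ᵇ k)))) ⟩
      ∑< n (λ k → ∑ xs λ x → v x * 𝟙 (f x ≡ᵇ k) * mass g w k)
        ≡⟨ ∑<-swap n xs (λ k x → v x * 𝟙 (f x ≡ᵇ k) * mass g w k) ⟩
      ∑ xs (λ x → ∑< n λ k → v x * 𝟙 (f x ≡ᵇ k) * mass g w k)
        ≡⟨ ∑-cong xs (λ x → trans (∑<-cong n (λ k → *-assoc (v x) (𝟙 (f x ≡ᵇ k)) (mass g w k)))
            (trans (∑<-*ˡ n (v x) (λ k → 𝟙 (f x ≡ᵇ k) * mass g w k)) (cong (v x *_) (∑<-delta n (f x) (mass g w) (f< x))))) ⟩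
      ∑ xs (λ x → v x * mass g w (f x))
        ≡⟨ ∑-cong xs (λ x → trans (sym (∑-*ˡ xs (v x) (λ y → w y * 𝟙 (g y ≡ᵇ f x))))
            (∑-cong xs (λ y → trans (sym (*-assoc (v x) (w y) _)) (cong (λ b → v x * w y * 𝟙 b) (≡ᵇ-sym (g y) (f x)))))) ⟩
      correlation f g v w ∎)
      where
      open ≡-Reasoning
      ∑<-cong : ∀ m {f g} → (∀ k → f k ≡ g k) → ∑< m f ≡ ∑< m g
      ∑<-cong zero eq = refl
      ∑<-cong (suc m) eq = cong₂ _+_ (eq m) (∑<-cong m eq)

    -- The inequality 2ab ≤ a² + b² is applied to the two fibres over each k. In this form
    -- Cauchy-Schwarz needs no square roots.
    polarisation : ∀ f g v w → (∀ x → f x < n) → (∀ x → g x < n) →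
      2 * correlation f g v w ≤ correlation f f v v + correlation g g w w
    polarisation f g v w f< g< = begin
      2 * correlation f g v w                                            ≡⟨ cong (2 *_) (correlation-mass f g v w f<) ⟩
      2 * ∑< n (λ k → mass f v k * mass g w k)                           ≡⟨ ∑<-*ˡ n 2 (λ k → mass f v k * mass g w k) ⟨
      ∑< n (λ k → 2 * (mass f v k * mass g w k))                         ≤⟨ ∑<-mono n (λ k → AM-GM (mass f v k) (mass g w k)) ⟩
      ∑< n (λ k → mass f v k * mass f v k + mass g w k * mass g w k)     ≡⟨ ∑<-+ n (λ k → mass f v k * mass f v k) (λ k → mass g w k * mass g w k) ⟩
      ∑< n (λ k → mass f v k * mass f v k) + ∑< n (λ k → mass g w k * mass g w k)
        ≡⟨ cong₂ _+_ (correlation-mass f f v v f<) (correlation-mass g g w w g<) ⟨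
      correlation f f v v + correlation g g w w                          ∎
      where open ≤-Reasoning

  module _ {B : Set} (_≟ᴮ_ : DecidableEquality B) where

    δ : B → B → ℕ
    δ a b = 𝟙 (does (a ≟ᴮ b))

    δ-refl : ∀ a → δ a a ≡ 1
    δ-refl a with a ≟ᴮ a
    ... | yes _ = refl
    ... | no a≢a = contradiction refl a≢a

    δ-≢ : ∀ {a b} → a ≢ b → δ a b ≡ 0
    δ-≢ {a} {b} a≢b with a ≟ᴮ b
    ... | yes a≡b = contradiction a≡b a≢b
    ... | no _ = refl

    δ-≤1 : ∀ a b → δ a b ≤ 1
    δ-≤1 a b with a ≟ᴮ b
    ... | yes _ = s≤s z≤n
    ... | no _ = z≤n

    ∑-δ-≥1 : ∀ bs {a} → a ∈ bs → 1 ≤ ∑ bs (δ a)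
    ∑-δ-≥1 (b ∷ bs) (here refl) = ≤-trans (≤-reflexive (sym (δ-refl b))) (m≤m+n _ _)
    ∑-δ-≥1 (b ∷ bs) (there a∈) = ≤-trans (∑-δ-≥1 bs a∈) (m≤n+m _ _)

    ∑-δ-fresh : ∀ bs {a} → All (a ≢_) bs → ∑ bs (δ a) ≡ 0
    ∑-δ-fresh [] [] = refl
    ∑-δ-fresh (b ∷ bs) (a≢b ∷ ne) = cong₂ _+_ (δ-≢ a≢b) (∑-δ-fresh bs ne)

    ∑-δ-≤1 : ∀ bs → Unique bs → ∀ a → ∑ bs (δ a) ≤ 1
    ∑-δ-≤1 [] _ a = z≤n
    ∑-δ-≤1 (b ∷ bs) (ne ∷ u) a = go (a ≟ᴮ b)
      where
      go : Dec (a ≡ b) → δ a b + ∑ bs (δ a) ≤ 1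
      go (yes refl) = ≤-reflexive (cong₂ _+_ (δ-refl a) (∑-δ-fresh bs ne))
      go (no a≢b) = ≤-trans (≤-reflexive (cong (_+ ∑ bs (δ a)) (δ-≢ a≢b))) (∑-δ-≤1 bs u a)

    ∑-δδ : ∀ bs → Unique bs → ∀ a a′ → ∑ bs (λ b → δ a b * δ a′ b) ≤ δ a a′
    ∑-δδ bs u a a′ = go (a ≟ᴮ a′)
      where
      disjoint : a ≢ a′ → ∀ b → δ a b * δ a′ b ≡ 0
      disjoint a≢a′ b = by (a ≟ᴮ b)
        where
        by : Dec (a ≡ b) → δ a b * δ a′ b ≡ 0
        by (yes refl) = trans (cong (δ a a *_) (δ-≢ (λ eq → a≢a′ (sym eq)))) (*-zeroʳ (δ a a))
        by (no a≢b) = cong (_* δ a′ b) (δ-≢ a≢b)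
      go : Dec (a ≡ a′) → ∑ bs (λ b → δ a b * δ a′ b) ≤ δ a a′
      go (yes refl) = ≤-trans (∑-mono bs λ b → ≤-trans (*-monoʳ-≤ (δ a b) (δ-≤1 a b)) (≤-reflexive (*-identityʳ (δ a b))))
        (≤-trans (∑-δ-≤1 bs u a) (≤-reflexive (sym (δ-refl a))))
      go (no a≢a′) = ≤-trans (≤-reflexive (trans (∑-cong bs (disjoint a≢a′)) (∑-zero bs))) z≤n

  -- Cauchy–Schwarz: refining the coincidence of keys by a classification β costs
  -- at most the number of classes.
  module _ {A B : Set} (_≟ᴮ_ : DecidableEquality B) (xs : List A) (n : ℕ) (key : A → ℕ) (key< : ∀ x → key x < n)
    (β : A → B) (bs : List B) (unique : Unique bs) (β∈ : ∀ {x} → x ∈ xs → β x ∈ bs) where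

    private
      w : B → A → ℕ
      w b x = δ _≟ᴮ_ (β x) b
      K = length bs
      C : B → B → ℕ
      C b b′ = correlation xs n key key (w b) (w b′)

    classify-≤ : ∑ xs (λ x → ∑ xs λ y → 𝟙 (key x ≡ᵇ key y)) ≤
      length bs * ∑ xs (λ x → ∑ xs λ y → 𝟙 (key x ≡ᵇ key y) * δ _≟ᴮ_ (β x) (β y))
    classify-≤ = *-cancelˡ-≤ 2 (begin
      2 * ∑ xs (λ x → ∑ xs λ y → 𝟙 (key x ≡ᵇ key y))
        -- Every element has its class in `bs`, so the sum of the indicators over `bs` is at least
        -- 1; it is inserted once for x and once for y.
        ≤⟨ *-monoʳ-≤ 2 (∑-mono-∈ xs λ {x} x∈ → ∑-mono-∈ xs λ {y} y∈ → insert x∈ y∈) ⟩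
      2 * ∑ xs (λ x → ∑ xs λ y → ∑ bs λ b → ∑ bs λ b′ → w b x * w b′ y * 𝟙 (key x ≡ᵇ key y))
        ≡⟨ cong (2 *_) exchange ⟩
      2 * ∑ bs (λ b → ∑ bs λ b′ → C b b′)
        ≡⟨ trans (∑-cong bs (λ b → ∑-*ˡ bs 2 (C b))) (∑-*ˡ bs 2 (λ b → ∑ bs (C b))) ⟨
      ∑ bs (λ b → ∑ bs λ b′ → 2 * C b b′)
        ≤⟨ ∑-mono bs (λ b → ∑-mono bs λ b′ → polarisation xs n key key (w b) (w b′) key< key<) ⟩
      ∑ bs (λ b → ∑ bs λ b′ → C b b + C b′ b′)
        ≡⟨ ∑-cong bs (λ b → trans (∑-+ bs (λ _ → C b b) (λ b′ → C b′ b′)) (cong (_+ D) (∑-const bs (C b b)))) ⟩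
      ∑ bs (λ b → K * C b b + D)
        ≡⟨ trans (∑-+ bs (λ b → K * C b b) (λ _ → D)) (cong₂ _+_ (∑-*ˡ bs K (λ b → C b b)) (∑-const bs D)) ⟩
      K * D + K * D
        ≡⟨ cong (λ z → K * D + z) (+-identityʳ (K * D)) ⟨
      2 * (K * D)
        ≤⟨ *-monoʳ-≤ 2 (*-monoʳ-≤ K diagonal) ⟩
      2 * (K * ∑ xs (λ x → ∑ xs λ y → 𝟙 (key x ≡ᵇ key y) * δ _≟ᴮ_ (β x) (β y))) ∎)
      where
      open ≤-Reasoning
      D = ∑ bs (λ b → C b b)
      F : B → B → A → A → ℕ
      F b b′ x y = w b x * w b′ y * 𝟙 (key x ≡ᵇ key y)

      insert : ∀ {x y} → x ∈ xs → y ∈ xs → 𝟙 (key x ≡ᵇ key y) ≤ ∑ bs λ b → ∑ bs λ b′ → w b x * w b′ y * 𝟙 (key x ≡ᵇ key y)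
      insert {x} {y} x∈ y∈ = begin
        κ                                                     ≡⟨ +-identityʳ κ ⟨
        1 * 1 * κ                                             ≤⟨ *-monoˡ-≤ κ (*-mono-≤ (∑-δ-≥1 _≟ᴮ_ bs (β∈ x∈)) (∑-δ-≥1 _≟ᴮ_ bs (β∈ y∈))) ⟩
        ∑ bs (δ _≟ᴮ_ (β x)) * ∑ bs (δ _≟ᴮ_ (β y)) * κ         ≡⟨ cong (_* κ) (sym (∑-*ʳ bs Y (δ _≟ᴮ_ (β x)))) ⟩
        ∑ bs (λ b → w b x * Y) * κ                            ≡⟨ sym (∑-*ʳ bs κ (λ b → w b x * Y)) ⟩
        ∑ bs (λ b → w b x * Y * κ)
          ≡⟨ ∑-cong bs (λ b → trans (cong (_* κ) (sym (∑-*ˡ bs (w b x) (δ _≟ᴮ_ (β y))))) (sym (∑-*ʳ bs κ (λ b′ → w b x * w b′ y)))) ⟩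
        ∑ bs (λ b → ∑ bs λ b′ → w b x * w b′ y * κ)           ∎
        where
        κ = 𝟙 (key x ≡ᵇ key y)
        Y = ∑ bs (δ _≟ᴮ_ (β y))

      exchange : ∑ xs (λ x → ∑ xs λ y → ∑ bs λ b → ∑ bs λ b′ → w b x * w b′ y * 𝟙 (key x ≡ᵇ key y)) ≡ ∑ bs (λ b → ∑ bs λ b′ → C b b′)
      exchange = trans
        (∑-cong xs (λ x → trans (∑-swap xs bs (λ y b → ∑ bs λ b′ → F b b′ x y)) (∑-cong bs (λ b → ∑-swap xs bs (λ y b′ → F b b′ x y)))))
        (trans (∑-swap xs bs (λ x b → ∑ bs λ b′ → ∑ xs λ y → F b b′ x y))
          (∑-cong bs (λ b → ∑-swap xs bs (λ x b′ → ∑ xs λ y → F b b′ x y))))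

      diagonal : D ≤ ∑ xs (λ x → ∑ xs λ y → 𝟙 (key x ≡ᵇ key y) * δ _≟ᴮ_ (β x) (β y))
      diagonal = begin
        D ≡⟨ trans (∑-swap bs xs (λ b x → ∑ xs λ y → F b b x y)) (∑-cong xs (λ x → ∑-swap bs xs (λ b y → F b b x y))) ⟩
        ∑ xs (λ x → ∑ xs λ y → ∑ bs λ b → w b x * w b y * 𝟙 (key x ≡ᵇ key y))
          ≤⟨ ∑-mono xs (λ x → ∑-mono xs λ y → ≤-trans (≤-reflexive (∑-*ʳ bs (𝟙 (key x ≡ᵇ key y)) (λ b → w b x * w b y)))
              (≤-trans (*-monoˡ-≤ (𝟙 (key x ≡ᵇ key y)) (∑-δδ _≟ᴮ_ bs unique (β x) (β y)))
                (≤-reflexive (*-comm (δ _≟ᴮ_ (β x) (β y)) (𝟙 (key x ≡ᵇ key y)))))) ⟩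
        ∑ xs (λ x → ∑ xs λ y → 𝟙 (key x ≡ᵇ key y) * δ _≟ᴮ_ (β x) (β y)) ∎

open Sums

-- The energies

∈-filterᵇ⁻ : ∀ {A : Set} (p : A → Bool) xs {x} → x ∈ filterᵇ p xs → x ∈ xs × T (p x)
∈-filterᵇ⁻ p xs = ∈-filter⁻ (λ x → T? (p x))

AtMost-list : ∀ {A : Set} {P : A → Set} {n} → AtMost n P → ∀ xs → Unique xs → (∀ {x} → x ∈ xs → P x) → length xs ≤ n
AtMost-list bd xs u p = bd xs u (All.tabulate p)

𝟙-mono : ∀ {p q} → (T p → T q) → 𝟙 p ≤ 𝟙 q
𝟙-mono {false} _ = z≤n
𝟙-mono {true} {true} _ = ≤-refl
𝟙-mono {true} {false} f = contradiction (f _) λ ()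

𝟙-∧ : ∀ p q → 𝟙 (p ∧ q) ≡ 𝟙 p * 𝟙 q
𝟙-∧ true q = sym (+-identityʳ (𝟙 q))
𝟙-∧ false q = refl

T-does : ∀ {A : Set} (d : Dec A) → T (does d) → A
T-does (yes a) _ = a

data Any : Bool → Set where
  any : ∀ {σ} → Any σ

AtMost-Bool : AtMost 2 Any
AtMost-Bool = AtMost-⊆ (λ {σ} _ → by σ)
  (AtMost-⊎ (AtMost-subsingleton {P = _≡ true} λ { refl refl → refl }) (AtMost-subsingleton {P = _≡ false} λ { refl refl → refl }))
  where
  by : ∀ σ → σ ≡ true ⊎ σ ≡ false
  by true = inj₁ refl
  by false = inj₂ refl

-- This is r(H³M² / r + HM); all bounds are multiplied by r to remain in ℕ.
main : ℕ → ℕ → ℕ → ℕ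
main r M H = H ^ 3 * M ^ 2 + H * M * r

-- The identity MH(8r + 8H²M) = 8 · `main` turns the number of blocks into the two terms of the
-- bound.
blocks-arithmetic : ∀ c τ K M H r → K * r ≤ r + 8 * (H * H * M) →
  2 * (τ * K) * (2 * (τ * (c * τ ^ 7 * (M * H)))) * r ≤ 32 * c * τ ^ 9 * main r M H
blocks-arithmetic c τ K M H r Kr≤ = begin
  2 * (τ * K) * (2 * (τ * (c * τ ^ 7 * (M * H)))) * r         ≡⟨ regroup τ K (c * τ ^ 7) M H r ⟩
  4 * (τ * τ * (c * τ ^ 7)) * (M * H) * (K * r)               ≤⟨ *-monoʳ-≤ (4 * (τ * τ * (c * τ ^ 7)) * (M * H)) (≤-trans Kr≤ (+-monoˡ-≤ (8 * (H * H * M)) (m≤n*m r 8))) ⟩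
  4 * (τ * τ * (c * τ ^ 7)) * (M * H) * (8 * r + 8 * (H * H * M)) ≡⟨ final c τ (τ ^ 7) M H r ⟩
  32 * c * τ ^ 9 * main r M H                                 ∎
  where
  open ≤-Reasoning
  regroup : ∀ τ K x M H r → 2 * (τ * K) * (2 * (τ * (x * (M * H)))) * r ≡ 4 * (τ * τ * x) * (M * H) * (K * r)
  regroup = solve-∀
  final : ∀ c τ T M H r → 4 * (τ * τ * (c * T)) * (M * H) * (8 * r + 8 * (H * H * M)) ≡
    32 * c * (τ * (τ * T)) * (H * (H * (H * 1)) * (M * (M * 1)) + H * M * r)
  final = solve-∀

-- If r ≤ HM, then MH² · r ≤ H³M², the first term of `main`.
trivial-arithmetic : ∀ c τ M H r → 1 ≤ c → 1 ≤ τ → r ≤ H * M →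
  2 * (τ * τ * (4 * M * H)) * (2 * (2 * H)) * r ≤ 32 * c * τ ^ 9 * main r M H
trivial-arithmetic c τ M H r 1≤c 1≤τ r≤HM = begin
  2 * (τ * τ * (4 * M * H)) * (2 * (2 * H)) * r         ≤⟨ *-monoʳ-≤ (2 * (τ * τ * (4 * M * H)) * (2 * (2 * H))) r≤HM ⟩
  2 * (τ * τ * (4 * M * H)) * (2 * (2 * H)) * (H * M)   ≡⟨ regroup τ M H ⟩
  32 * 1 * (τ * τ) * (H ^ 3 * M ^ 2)                    ≤⟨ *-mono-≤ (*-mono-≤ (*-monoʳ-≤ 32 1≤c) power) (m≤m+n (H ^ 3 * M ^ 2) (H * M * r)) ⟩
  32 * c * τ ^ 9 * main r M H                           ∎
  where
  open ≤-Reasoning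
  regroup : ∀ τ M H → 2 * (τ * τ * (4 * M * H)) * (2 * (2 * H)) * (H * M) ≡ 32 * 1 * (τ * τ) * (H * (H * (H * 1)) * (M * (M * 1)))
  regroup = solve-∀
  power : τ * τ ≤ τ ^ 9
  power = ≤-trans (≤-reflexive (cong (τ *_) (sym (*-identityʳ τ)))) (^-monoʳ-≤ τ {{>-nonZero 1≤τ}} {2} {9} (s≤s (s≤s z≤n)))

fourth-arithmetic : ∀ c τ M H X →
  2 * (τ * τ * (4 * M * H)) * (2 * (τ * τ * (4 * M * H))) * (c * τ ^ 9 * X) ≡ 64 * c * τ ^ 13 * (H ^ 2 * M ^ 2 * X)
fourth-arithmetic c τ M H X = regroup c τ (τ ^ 9) M H X
  where
  regroup : ∀ c τ T M H X → 2 * (τ * τ * (4 * M * H)) * (2 * (τ * τ * (4 * M * H))) * (c * T * X) ≡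
    64 * c * (τ * (τ * (τ * (τ * T)))) * (H * (H * 1) * (M * (M * 1)) * X)
  regroup = solve-∀

-- From the energies to oriented solutions

module Admissible (r₀ j M H : ℕ) (cop-j : Coprime (suc r₀) j) (M≤r : M ≤ suc r₀)
  {τ : ℕ} (τ-bd : DivisorBound (4 * suc r₀) τ) (1≤τ : 1 ≤ τ) where

  r : ℕ
  r = suc r₀

  open Solutions r 1 j M H coprime-1 cop-j
  open Counting τ-bd

  pts : List Pt
  pts = points r j M

  pts-unique : Unique pts
  pts-unique = Unique.filter⁺ _ (Unique.cartesianProduct⁺ (Unique.map⁺ suc-injective (Unique.upTo⁺ M)) (Unique.upTo⁺ r))

  adms : List (Pt × Pt)
  adms = adm r j M H

  adms-unique : Unique adms
  adms-unique = Unique.filter⁺ _ (Unique.cartesianProduct⁺ pts-unique pts-unique)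

  IsPoint : Pt → Set
  IsPoint (m , k) = (1 ≤ m × m ≤ M) × k < r × IsRoot m k

  point : ∀ {p} → p ∈ pts → IsPoint p
  point {m , k} p∈ =
    let (p∈× , cond) = ∈-filterᵇ⁻ _ (cartesianProduct (map suc (upTo M)) (upTo r)) p∈
        (m∈ , k∈) = ∈-cartesianProduct⁻ (map suc (upTo M)) (upTo r) p∈×
        (m₀ , m₀∈ , m≡) = ∈-map⁻ suc m∈
        (1≤m , root) = Equivalence.to T-∧ cond
    in (≤ᵇ⇒≤ 1 m 1≤m , subst (_≤ M) (sym m≡) (∈-upTo⁻ m₀∈)) , ∈-upTo⁻ k∈ ,
      isRoot (∣ᶻ-* (+ 1) (%ℕ-≡⇒∣ (+ (k * k)) (+ (j * m)) r (≡ᵇ⇒≡ _ _ root))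
        (trans (cong₂ (λ x y → + 1 *ᶻ x -ᶻ y) (sym (ℤₚ.pos-* k k)) (sym (ℤₚ.pos-* j m))) (identity (+ (k * k)) (+ (j * m)))))
    where
    identity : ∀ x y → + 1 *ᶻ x -ᶻ y ≡ + 1 *ᶻ (x -ᶻ y)
    identity = ℤ-Solver.solve-∀

  -- A solution requires h ≥ 1, so a pair with m₁ < m₂ is entered with its two points exchanged. The
  -- two directions account for the factors 2 below.
  orient : Bool → Pt × Pt → Quad
  orient true ((m₁ , k₁) , (m₂ , k₂)) = k₁ , k₂ , m₂ , m₁ ∸ m₂
  orient false ((m₁ , k₁) , (m₂ , k₂)) = k₂ , k₁ , m₁ , m₂ ∸ m₁

  descending : Pt × Pt → Bool
  descending ((m₁ , _) , (m₂ , _)) = m₂ <ᵇ m₁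

  -- The order makes truncated subtraction cancellable in `orient-injective`.
  Ordered : Bool → Pt × Pt → Set
  Ordered true ((m₁ , _) , (m₂ , _)) = m₂ ≤ m₁
  Ordered false ((m₁ , _) , (m₂ , _)) = m₁ ≤ m₂

  Oriented : Bool → Pt × Pt → Set
  Oriented σ a = Solution (orient σ a) × Ordered σ a

  orient-injective : ∀ σ {a b} → Ordered σ a → Ordered σ b → orient σ a ≡ orient σ b → a ≡ b
  orient-injective true {(m₁ , k₁) , (m₂ , k₂)} {(n₁ , l₁) , (n₂ , l₂)} o o′ eq with
    cong proj₁ eq | cong (λ t → proj₁ (proj₂ t)) eq | cong (λ t → proj₁ (proj₂ (proj₂ t))) eq
  ... | refl | refl | refl = cong (λ m → (m , k₁) , (m₂ , k₂)) (∸-cancelʳ-≡ o o′ (cong (λ t → proj₂ (proj₂ (proj₂ t))) eq))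
  orient-injective false {(m₁ , k₁) , (m₂ , k₂)} {(n₁ , l₁) , (n₂ , l₂)} o o′ eq with
    cong proj₁ eq | cong (λ t → proj₁ (proj₂ t)) eq | cong (λ t → proj₁ (proj₂ (proj₂ t))) eq
  ... | refl | refl | refl = cong (λ m → (m₁ , k₁) , (m , k₂)) (∸-cancelʳ-≡ o o′ (cong (λ t → proj₂ (proj₂ (proj₂ t))) eq))

  private
    solve-order : ∀ {m n k l} → IsPoint (m , k) → IsPoint (n , l) → m < n → ∣ m - n ∣ ≤ H → Solution (l , k , m , n ∸ m)
    solve-order {m} {n} {k} {l} ((1≤m , m≤M) , k< , root) ((1≤n , n≤M) , l< , root′) m<n d≤H = solution
      l< k< 1≤m (subst (_≤ M) (sym m+d≡n) n≤M) (m<n⇒0<n∸m m<n) (subst (_≤ H) (m≤n⇒∣m-n∣≡n∸m (<⇒≤ m<n)) d≤H)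
      (subst (λ x → IsRoot x l) (sym m+d≡n) root′) root
      where
      m+d≡n : m + (n ∸ m) ≡ n
      m+d≡n = m+[n∸m]≡n (<⇒≤ m<n)

  oriented : ∀ {a} → a ∈ adms → Oriented (descending a) a
  oriented {a@((m₁ , k₁) , (m₂ , k₂))} a∈ = by (m₂ <ᵇ m₁) refl
    where
    split = ∈-filterᵇ⁻ _ (cartesianProduct pts pts) a∈
    pq = ∈-cartesianProduct⁻ pts pts (proj₁ split)
    cond = Equivalence.to T-∧ (proj₂ split)
    by : ∀ b → (m₂ <ᵇ m₁) ≡ b → Oriented b a
    by true eq = let m₂<m₁ = <ᵇ⇒< m₂ m₁ (subst T (sym eq) _) in
      solve-order (point (proj₂ pq)) (point (proj₁ pq)) m₂<m₁ (subst (_≤ H) (∣-∣-comm m₁ m₂) (≤ᵇ⇒≤ _ H (proj₂ cond))) , <⇒≤ m₂<m₁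
    by false eq = let m₁<m₂ = ≤∧≢⇒< (≮⇒≥ λ m₂<m₁ → subst T eq (<⇒<ᵇ m₂<m₁))
                                   (λ m₁≡m₂ → <⇒≢ (≤ᵇ⇒≤ 1 _ (proj₁ cond)) (sym (m≡n⇒∣m-n∣≡0 m₁≡m₂))) in
      solve-order (point (proj₁ pq)) (point (proj₂ pq)) m₁<m₂ (≤ᵇ⇒≤ _ H (proj₂ cond)) , <⇒≤ m₁<m₂

  IsAdm : Pt × Pt → Set
  IsAdm a = ∃ λ σ → Oriented σ a


  key : Pt × Pt → ℕ
  key a = dif a %ℕ r

  key< : ∀ a → key a < r
  key< a = n%ℕd<d (dif a) r

  orient-shift : ∀ σ {a b} → key a ≡ key b → shift (orient σ a) ≡ shift (orient σ b)
  orient-shift true eq = eq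
  orient-shift false {(_ , k₁) , (_ , k₂)} {(_ , l₁) , (_ , l₂)} eq = ∣⇒%ℕ-≡ (+ k₂ -ᶻ + k₁) (+ l₂ -ᶻ + l₁) r
    (∣ᶻ-* (-ᶻ + 1) (%ℕ-≡⇒∣ (+ k₁ -ᶻ + k₂) (+ l₁ -ᶻ + l₂) r eq) (identity (+ k₁) (+ k₂) (+ l₁) (+ l₂)))
    where
    identity : ∀ a b c d → (b -ᶻ a) -ᶻ (d -ᶻ c) ≡ (-ᶻ + 1) *ᶻ ((a -ᶻ b) -ᶻ (c -ᶻ d))
    identity = ℤ-Solver.solve-∀

  adm-bound : ℕ
  adm-bound = 2 * (τ * τ * (4 * M * H))

  AtMost-IsAdm : AtMost adm-bound IsAdm
  AtMost-IsAdm = AtMost-fiber Bool._≟_ (λ a σ → Oriented σ a) (λ { {a} (σ , o) → σ , any , o }) AtMost-Bool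
    λ {σ} _ → AtMost-injection (orient σ) (λ (_ , sol , _) → sol)
      (λ (_ , _ , o) (_ , _ , o′) → orient-injective σ o o′) AtMost-Solution

  adms-length : length adms ≤ adm-bound
  adms-length = AtMost-list AtMost-IsAdm adms adms-unique (λ {a} a∈ → descending a , oriented a∈)

  -- Because r is a successor, the test in `E₂` computes to the comparison of keys, and only the
  -- product list has to be unfolded.
  coincidences : ∑ adms (λ a → ∑ adms λ b → 𝟙 (key a ≡ᵇ key b)) ≡ E₂ r j M H
  coincidences = sym (trans (length-filterᵇ _ (cartesianProduct adms adms)) (∑-cartesianProduct adms adms _))

  -- This is the estimate Σ f² ≤ max f · Σ f: for each a there are two directions for b and, by
  -- `AtMost-shift`, 2H solutions in each.
  E₂-≤-trivial : E₂ r j M H ≤ adm-bound * (2 * (2 * H))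
  E₂-≤-trivial = AtMost-list bound (filterᵇ _ (cartesianProduct adms adms)) (Unique.filter⁺ _ (Unique.cartesianProduct⁺ adms-unique adms-unique)) into
    where
    open Classes r 1 j M H coprime-1 cop-j τ-bd using (AtMost-shift)
    Same : (Pt × Pt) × (Pt × Pt) → Set
    Same (a , b) = (IsAdm a × IsAdm b) × key a ≡ key b
    into : ∀ {x} → x ∈ filterᵇ (λ { (a , b) → dif a ≡ℤ[ r ]ᵇ dif b }) (cartesianProduct adms adms) → Same x
    into {a , b} x∈ =
      let (ab∈ , cond) = ∈-filterᵇ⁻ _ (cartesianProduct adms adms) x∈
          (a∈ , b∈) = ∈-cartesianProduct⁻ adms adms ab∈
      in ((descending a , oriented a∈) , (descending b , oriented b∈)) , ≡ᵇ⇒≡ (key a) (key b) cond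
    _≟ᴾ_ : DecidableEquality (Pt × Pt)
    _≟ᴾ_ = ≡-dec _≟²_ _≟²_
    bound : AtMost (adm-bound * (2 * (2 * H))) Same
    bound = AtMost-fiber _≟ᴾ_ (λ x a → proj₁ x ≡ a) (λ {x} ((p , _) , _) → proj₁ x , p , refl) AtMost-IsAdm
      λ {a} _ → AtMost-fiber Bool._≟_ (λ x σ → Oriented σ (proj₂ x)) (λ { (((_ , σ , o) , _) , _) → σ , any , o }) AtMost-Bool
        λ {σ} _ → AtMost-injection (λ x → orient σ (proj₂ x))
          (λ { {_ , b} (((_ , eq) , refl) , sol , _) → sol , orient-shift σ {b} {a} (sym eq) })
          (λ { ((_ , refl) , _ , o) ((_ , refl) , _ , o′) eq → cong (a ,_) (orient-injective σ o o′ eq) })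
          (AtMost-shift M≤r (shift (orient σ a)))

  module Classification (content block : Quad → ℕ) {K n : ℕ} (content∣r : ∀ t → content t ∣ r)
    (block<K : ∀ {t} → Solution t → block t < K)
    (collisions : AtMost n (λ ((t , t′) : Quad × Quad) →
      (Solution t × Solution t′) × shift t ≡ shift t′ × content t ≡ content t′ × block t ≡ block t′)) where

    Collision : Quad × Quad → Set
    Collision (t , t′) = (Solution t × Solution t′) × shift t ≡ shift t′ × content t ≡ content t′ × block t ≡ block t′

    Class : Set
    Class = Bool × ℕ × ℕ

    _≟ᶜ_ : DecidableEquality Class
    _≟ᶜ_ = ≡-dec Bool._≟_ _≟²_

    quad : Pt × Pt → Quad
    quad a = orient (descending a) a

    class : Pt × Pt → Class
    class a = descending a , content (quad a) , block (quad a)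

    classes : List Class
    classes = deduplicate _≟ᶜ_ (map class adms)

    IsClass : Class → Set
    IsClass (σ , v , b) = Any σ × v ∣ r × b < K

    classes-length : length classes ≤ 2 * (τ * K)
    classes-length = AtMost-list {P = IsClass} (AtMost-× Bool._≟_ AtMost-Bool (AtMost-× _≟_ (τ-bd r 1≤r (m≤n*m r 4)) (AtMost-< K)))
      classes (DecUnique.deduplicate-! _≟ᶜ_ (map class adms))
      λ b∈ → let (a , a∈ , eq) = ∈-map⁻ class (∈-deduplicate⁻ _≟ᶜ_ (map class adms) b∈) in subst IsClass (sym eq) (isClass a∈)
      where
      isClass : ∀ {a} → a ∈ adms → IsClass (class a)
      isClass {a} a∈ = any , content∣r (quad a) , block<K (proj₁ (oriented a∈))

    together : (Pt × Pt) × (Pt × Pt) → Bool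
    together (a , b) = (key a ≡ᵇ key b) ∧ does (class a ≟ᶜ class b)

    Together : (Pt × Pt) × (Pt × Pt) → Set
    Together (a , b) = ∃ λ σ → Ordered σ a × Ordered σ b × Collision (orient σ a , orient σ b)

    together-length : length (filterᵇ together (cartesianProduct adms adms)) ≤ 2 * n
    together-length = AtMost-list {P = Together} bound (filterᵇ together (cartesianProduct adms adms))
      (Unique.filter⁺ _ (Unique.cartesianProduct⁺ adms-unique adms-unique)) into
      where
      bound : AtMost (2 * n) Together
      bound = AtMost-fiber Bool._≟_ (λ (a , b) σ → Ordered σ a × Ordered σ b × Collision (orient σ a , orient σ b))
        (λ (σ , p) → σ , any , p) AtMost-Bool
        λ {σ} _ → AtMost-injection (λ (a , b) → orient σ a , orient σ b) (λ (_ , _ , _ , c) → c)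
          (λ { (_ , oa , ob , _) (_ , oa′ , ob′ , _) eq →
            cong₂ _,_ (orient-injective σ oa oa′ (cong proj₁ eq)) (orient-injective σ ob ob′ (cong proj₂ eq)) })
          collisions
      collide : ∀ {a b} → Oriented (descending a) a → Oriented (descending b) b → key a ≡ key b →
        descending a ≡ descending b → content (quad a) ≡ content (quad b) → block (quad a) ≡ block (quad b) → Together (a , b)
      collide {a} {b} (sol , o) (sol′ , o′) key≡ σ≡ content≡ block≡ =
        descending a , o , subst (λ σ → Ordered σ b) (sym σ≡) o′ ,
        (sol , subst (λ σ → Solution (orient σ b)) (sym σ≡) sol′) , orient-shift (descending a) {a} {b} key≡ ,
        trans content≡ (cong (λ σ → content (orient σ b)) (sym σ≡)) ,
        trans block≡ (cong (λ σ → block (orient σ b)) (sym σ≡))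
      into : ∀ {x} → x ∈ filterᵇ together (cartesianProduct adms adms) → Together x
      into {a , b} x∈ =
        let (ab∈ , cond) = ∈-filterᵇ⁻ together (cartesianProduct adms adms) x∈
            (a∈ , b∈) = ∈-cartesianProduct⁻ adms adms ab∈
            (key≡ , class≡) = Equivalence.to T-∧ cond
            eq = T-does (class a ≟ᶜ class b) class≡
        in collide (oriented a∈) (oriented b∈) (≡ᵇ⇒≡ (key a) (key b) key≡)
             (cong proj₁ eq) (cong (λ c → proj₁ (proj₂ c)) eq) (cong (λ c → proj₂ (proj₂ c)) eq)

    E₂-≤-classes : E₂ r j M H ≤ 2 * (τ * K) * (2 * n)
    E₂-≤-classes = begin
      E₂ r j M H
        ≡⟨ coincidences ⟨
      ∑ adms (λ a → ∑ adms λ b → 𝟙 (key a ≡ᵇ key b))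
        ≤⟨ classify-≤ _≟ᶜ_ adms r key key< class classes (DecUnique.deduplicate-! _≟ᶜ_ (map class adms))
            (λ a∈ → ∈-deduplicate⁺ _≟ᶜ_ (∈-map⁺ class a∈)) ⟩
      length classes * ∑ adms (λ a → ∑ adms λ b → 𝟙 (key a ≡ᵇ key b) * δ _≟ᶜ_ (class a) (class b))
        ≡⟨ cong (length classes *_) (trans (length-filterᵇ together (cartesianProduct adms adms))
            (trans (∑-cartesianProduct adms adms (λ x → 𝟙 (together x)))
              (∑-cong adms λ a → ∑-cong adms λ b → 𝟙-∧ (key a ≡ᵇ key b) (does (class a ≟ᶜ class b))))) ⟨
      length classes * length (filterᵇ together (cartesianProduct adms adms))
        ≤⟨ *-mono-≤ classes-length together-length ⟩
      2 * (τ * K) * (2 * n) ∎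
      where open ≤-Reasoning

  module Blocks (K : ℕ) (1≤K : 1 ≤ K) (HH≤r : H * H ≤ r) (many-blocks : 8 * (H * H * M) < K * r) where

    open Reduction r j M H K cop-j M≤r HH≤r 1≤K many-blocks τ-bd 1≤τ using (AtMost-Collision; blockOf; squarePart)

    block<K : ∀ t V → 1 ≤ V → Solution t → reducedBlock K M V t < K
    block<K (_ , _ , m , h) V 1≤V sol = ÷-< (suc (2 * (M ÷ V) ÷ K)) (s≤s z≤n)
      (≤-<-trans (begin
        2 * (m ÷ V) + h ÷ V         ≤⟨ +-monoʳ-≤ (2 * (m ÷ V)) (m≤n*m (h ÷ V) 2) ⟩
        2 * (m ÷ V) + 2 * (h ÷ V)   ≡⟨ *-distribˡ-+ 2 (m ÷ V) (h ÷ V) ⟨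
        2 * (m ÷ V + h ÷ V)         ≤⟨ *-monoʳ-≤ 2 {m ÷ V + h ÷ V} (÷-greatest {m ÷ V + h ÷ V} V 1≤V (≤-trans
          (≤-reflexive (*-distribʳ-+ V (m ÷ V) (h ÷ V)))
          (≤-trans (+-mono-≤ (÷-*-≤ m V) (÷-*-≤ h V)) (Solution.m+h≤M sol)))) ⟩
        2 * (M ÷ V)                 ∎)
      (subst (2 * (M ÷ V) <_) (*-comm (suc (2 * (M ÷ V) ÷ K)) K) (<-suc÷-* (2 * (M ÷ V)) K 1≤K)))
      where open ≤-Reasoning

    E₂-≤-blocks : E₂ r j M H ≤ 2 * (τ * K) * (2 * (τ * (272 * τ ^ 7 * (M * H))))
    E₂-≤-blocks = Classification.E₂-≤-classes (content r) blockOf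
      (λ t → gcd[m,n]∣n (gcd (proj₁ t) (proj₁ (proj₂ t))) r)
      (λ {t} sol → block<K t (squarePart (content r t)) (∣-pos 1≤r (gcd[m,n]∣n (content r t * content r t) r)) sol)
      AtMost-Collision

  E₂-bound : H ≤ M → E₂ r j M H * r ≤ 32 * 272 * τ ^ 9 * main r M H
  E₂-bound H≤M = by (≤-<-connex (H * H) r)
    where
    X : ℕ
    X = 8 * (H * H * M)
    by : H * H ≤ r ⊎ r < H * H → E₂ r j M H * r ≤ 32 * 272 * τ ^ 9 * main r M H
    by (inj₁ HH≤r) = ≤-trans
      -- 1 + ⌊X / r⌋ is the least K with X < Kr, and it satisfies Kr ≤ r + X.
      (*-monoˡ-≤ r (Blocks.E₂-≤-blocks (suc (X ÷ r)) (s≤s z≤n) HH≤r (<-suc÷-* X r 1≤r)))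
      (blocks-arithmetic 272 τ (suc (X ÷ r)) M H r (+-monoʳ-≤ r (÷-*-≤ X r)))
    by (inj₂ r<HH) = ≤-trans (*-monoˡ-≤ r E₂-≤-trivial)
      (trivial-arithmetic 272 τ M H r (s≤s z≤n) 1≤τ (≤-trans (<⇒≤ r<HH) (*-monoʳ-≤ H H≤M)))

  module _ (b d : Pt × Pt) where

    translate : Pt × Pt → ℕ
    translate c = (dif c +ᶻ dif d -ᶻ dif b) %ℕ r

    translate-key : ∀ {a c} → (dif a +ᶻ dif b) %ℕ r ≡ (dif c +ᶻ dif d) %ℕ r → key a ≡ translate c
    translate-key {a} {c} eq = ∣⇒%ℕ-≡ (dif a) (dif c +ᶻ dif d -ᶻ dif b) r
      (∣ᶻ-* (+ 1) (%ℕ-≡⇒∣ (dif a +ᶻ dif b) (dif c +ᶻ dif d) r eq) (identity (dif a) (dif b) (dif c) (dif d)))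
      where
      identity : ∀ a b c d → a -ᶻ (c +ᶻ d -ᶻ b) ≡ + 1 *ᶻ ((a +ᶻ b) -ᶻ (c +ᶻ d))
      identity = ℤ-Solver.solve-∀

    key-translate : ∀ {a c} → translate a ≡ translate c → key a ≡ key c
    key-translate {a} {c} eq = ∣⇒%ℕ-≡ (dif a) (dif c) r
      (∣ᶻ-* (+ 1) (%ℕ-≡⇒∣ (dif a +ᶻ dif d -ᶻ dif b) (dif c +ᶻ dif d -ᶻ dif b) r eq) (identity (dif a) (dif b) (dif c) (dif d)))
      where
      identity : ∀ a b c d → a -ᶻ c ≡ + 1 *ᶻ ((a +ᶻ d -ᶻ b) -ᶻ (c +ᶻ d -ᶻ b))
      identity = ℤ-Solver.solve-∀

    -- For fixed b and d the equation compares `key a` with `translate c`. Translation keeps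
    -- distinct residues distinct, so both self-correlations are at most E₂, and `polarisation`
    -- bounds the mixed one by their mean.
    translated-≤ : ∑ adms (λ a → ∑ adms λ c → 𝟙 ((dif a +ᶻ dif b) %ℕ r ≡ᵇ (dif c +ᶻ dif d) %ℕ r)) ≤ E₂ r j M H
    translated-≤ = *-cancelˡ-≤ 2 (begin
      2 * ∑ adms (λ a → ∑ adms λ c → 𝟙 ((dif a +ᶻ dif b) %ℕ r ≡ᵇ (dif c +ᶻ dif d) %ℕ r))
        ≤⟨ *-monoʳ-≤ 2 (∑-mono adms λ a → ∑-mono adms λ c → ≤-trans
            (𝟙-mono λ t → ≡⇒≡ᵇ (key a) (translate c) (translate-key {a} {c} (≡ᵇ⇒≡ _ _ t)))
            (≤-reflexive (sym (+-identityʳ (𝟙 (key a ≡ᵇ translate c)))))) ⟩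
      2 * correlation adms r key translate one one
        ≤⟨ polarisation adms r key translate one one key< (λ c → n%ℕd<d (dif c +ᶻ dif d -ᶻ dif b) r) ⟩
      correlation adms r key key one one + correlation adms r translate translate one one
        ≤⟨ +-mono-≤ (drop key (λ t → t)) (drop translate (λ {a} {c} t →
            ≡⇒≡ᵇ (key a) (key c) (key-translate {a} {c} (≡ᵇ⇒≡ _ _ t)))) ⟩
      E₂ r j M H + E₂ r j M H
        ≡⟨ cong (λ e → E₂ r j M H + e) (sym (+-identityʳ (E₂ r j M H))) ⟩
      2 * E₂ r j M H ∎)
      where
      open ≤-Reasoning
      one : Pt × Pt → ℕ
      one _ = 1
      drop : ∀ f → (∀ {a c} → T (f a ≡ᵇ f c) → T (key a ≡ᵇ key c)) → correlation adms r f f one one ≤ E₂ r j M H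
      drop f imp = ≤-trans (∑-mono adms λ a → ∑-mono adms λ c →
          ≤-trans (≤-reflexive (+-identityʳ (𝟙 (f a ≡ᵇ f c)))) (𝟙-mono (imp {a} {c})))
        (≤-reflexive coincidences)

  E₄-≤ : E₄ r j M H ≤ length adms * (length adms * E₂ r j M H)
  E₄-≤ = begin
    E₄ r j M H
      ≡⟨ length-filterᵇ _ (cartesianProduct pairs pairs) ⟩
    ∑ (cartesianProduct pairs pairs) _
      ≡⟨ trans (∑-cartesianProduct pairs pairs _) (trans (∑-cartesianProduct adms adms _)
          (∑-cong adms λ a → ∑-cong adms λ b → ∑-cartesianProduct adms adms _)) ⟩
    ∑ adms (λ a → ∑ adms λ b → ∑ adms λ c → ∑ adms λ d → F a b c d)
      ≡⟨ trans (∑-swap adms adms (λ a b → ∑ adms λ c → ∑ adms λ d → F a b c d))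
          (∑-cong adms λ b → trans (∑-cong adms λ a → ∑-swap adms adms (F a b)) (∑-swap adms adms (λ a d → ∑ adms λ c → F a b c d))) ⟩
    ∑ adms (λ b → ∑ adms λ d → ∑ adms λ a → ∑ adms λ c → F a b c d)
      ≤⟨ ∑-mono adms (λ b → ∑-mono adms λ d → translated-≤ b d) ⟩
    ∑ adms (λ b → ∑ adms λ d → E₂ r j M H)
      ≡⟨ trans (∑-cong adms λ b → ∑-const adms (E₂ r j M H)) (∑-const adms (length adms * E₂ r j M H)) ⟩
    length adms * (length adms * E₂ r j M H) ∎
    where
    open ≤-Reasoning
    pairs = cartesianProduct adms adms
    F : Pt × Pt → Pt × Pt → Pt × Pt → Pt × Pt → ℕ
    F a b c d = 𝟙 ((dif a +ᶻ dif b) %ℕ r ≡ᵇ (dif c +ᶻ dif d) %ℕ r)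

  E₄-bound : H ≤ M → E₄ r j M H * r ≤ 64 * (32 * 272) * τ ^ 13 * (H ^ 2 * M ^ 2 * main r M H)
  E₄-bound H≤M = begin
    E₄ r j M H * r
      ≤⟨ *-monoˡ-≤ r E₄-≤ ⟩
    length adms * (length adms * E₂ r j M H) * r
      ≤⟨ *-monoˡ-≤ r (*-mono-≤ adms-length (*-monoˡ-≤ (E₂ r j M H) adms-length)) ⟩
    adm-bound * (adm-bound * E₂ r j M H) * r
      ≡⟨ assoc adm-bound (E₂ r j M H) r ⟩
    adm-bound * adm-bound * (E₂ r j M H * r)
      ≤⟨ *-monoʳ-≤ (adm-bound * adm-bound) (E₂-bound H≤M) ⟩
    adm-bound * adm-bound * (32 * 272 * τ ^ 9 * main r M H)
      ≡⟨ fourth-arithmetic (32 * 272) τ M H (main r M H) ⟩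
    64 * (32 * 272) * τ ^ 13 * (H ^ 2 * M ^ 2 * main r M H) ∎
    where
    open ≤-Reasoning
    assoc : ∀ a e r → a * (a * e) * r ≡ a * a * (e * r)
    assoc = solve-∀

-- The q-th power turns τ¹³ into τ^(13q), which is at most linear in r: 1 + 4Cr ≤ Dr ≤ D^q r^p,
-- since p, q ≥ 1.
root-extraction : ∀ q p r A τ C E X → 1 ≤ p → 1 ≤ q → 1 ≤ r → E ≤ A * τ ^ 13 * X → τ ^ (13 * q) ≤ suc (C * (4 * r)) →
  E ^ q ≤ (A * suc (4 * C)) ^ q * X ^ q * r ^ p
root-extraction q p r A τ C E X 1≤p 1≤q 1≤r E≤ τ≤ = begin
  E ^ q                                             ≤⟨ ^-monoˡ-≤ q E≤ ⟩
  (A * τ ^ 13 * X) ^ q                              ≡⟨ trans (*-^ (A * τ ^ 13) X q) (cong (_* X ^ q) (*-^ A (τ ^ 13) q)) ⟩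
  A ^ q * (τ ^ 13) ^ q * X ^ q                      ≡⟨ cong (λ y → A ^ q * y * X ^ q) (^-*-assoc τ 13 q) ⟩
  A ^ q * τ ^ (13 * q) * X ^ q                      ≤⟨ *-monoˡ-≤ (X ^ q) (*-monoʳ-≤ (A ^ q) power) ⟩
  A ^ q * (D ^ q * r ^ p) * X ^ q                   ≡⟨ regroup (A ^ q) (D ^ q) (r ^ p) (X ^ q) ⟩
  A ^ q * D ^ q * X ^ q * r ^ p                     ≡⟨ cong (λ y → y * X ^ q * r ^ p) (*-^ A D q) ⟨
  (A * D) ^ q * X ^ q * r ^ p                       ∎
  where
  open ≤-Reasoning
  D = suc (4 * C)
  regroup : ∀ a d s x → a * (d * s) * x ≡ a * d * x * s
  regroup = solve-∀
  ^1 : ∀ {x n} → 1 ≤ x → 1 ≤ n → x ≤ x ^ n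
  ^1 {x} {n} 1≤x 1≤n = subst (_≤ x ^ n) (*-identityʳ x) (^-monoʳ-≤ x {{>-nonZero 1≤x}} 1≤n)
  linear : suc (C * (4 * r)) ≤ D * r
  linear = begin
    1 + C * (4 * r)   ≤⟨ +-monoˡ-≤ (C * (4 * r)) 1≤r ⟩
    r + C * (4 * r)   ≡⟨ expand C r ⟩
    D * r             ∎
    where
    expand : ∀ C r → r + C * (4 * r) ≡ (1 + 4 * C) * r
    expand = solve-∀
  power : τ ^ (13 * q) ≤ D ^ q * r ^ p
  power = ≤-trans τ≤ (≤-trans linear (*-mono-≤ (^1 (s≤s z≤n) 1≤q) (^1 1≤r 1≤p)))

-- Here ε = p/q, and each estimate has been multiplied by r and raised to the power q to become an
-- inequality in ℕ. A positive real ε is covered by any positive rational below it.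
theorem1p5 : (p q : ℕ) → 1 ≤ p → 1 ≤ q →
    Σ ℕ (λ C → (r j M H : ℕ) → gcd r j ≡ 1 → 1 ≤ H → H ≤ M → M ≤ r →
    ((E₂ r j M H * r) ^ q ≤ C ^ q * (H ^ 3 * M ^ 2 + H * M * r) ^ q * r ^ p)
    × ((E₄ r j M H * r) ^ q ≤ C ^ q * (H ^ 2 * M ^ 2 * (H ^ 3 * M ^ 2 + H * M * r)) ^ q * r ^ p))
theorem1p5 p q 1≤p 1≤q = A * suc (4 * C) , bounds
  where
  A = 64 * (32 * 272)
  -- The exponent 13q is dictated by E₄, whose bound contains τ¹³ = τ⁹ · τ⁴; E₂ needs only τ⁹.
  divisors = uniform-divisor-bound (13 * q) (≤-trans 1≤q (m≤n*m q 13))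
  C = proj₁ divisors
  bounds : (r j M H : ℕ) → gcd r j ≡ 1 → 1 ≤ H → H ≤ M → M ≤ r →
    ((E₂ r j M H * r) ^ q ≤ (A * suc (4 * C)) ^ q * (H ^ 3 * M ^ 2 + H * M * r) ^ q * r ^ p)
    × ((E₄ r j M H * r) ^ q ≤ (A * suc (4 * C)) ^ q * (H ^ 2 * M ^ 2 * (H ^ 3 * M ^ 2 + H * M * r)) ^ q * r ^ p)
  bounds zero j M H _ 1≤H H≤M M≤0 = contradiction (≤-trans 1≤H (≤-trans H≤M M≤0)) λ ()
  bounds r@(suc r₀) j M H gcd≡1 1≤H H≤M M≤r =
    root-extraction q p r A τ C (E₂ r j M H * r) (main r M H) 1≤p 1≤q (s≤s z≤n)
      (≤-trans (E₂-bound H≤M) (*-monoˡ-≤ (main r M H) (*-mono-≤ (m≤n*m (32 * 272) 64) power))) τ-power ,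
    root-extraction q p r A τ C (E₄ r j M H * r) (H ^ 2 * M ^ 2 * main r M H) 1≤p 1≤q (s≤s z≤n) (E₄-bound H≤M) τ-power
    where
    uniform = proj₂ divisors (4 * r)
    τ = proj₁ uniform
    τ-bd = proj₁ (proj₂ uniform)
    τ-power = proj₂ (proj₂ uniform)
    1≤τ : 1 ≤ τ
    1≤τ = τ-bd 1 ≤-refl (s≤s z≤n) (1 ∷ []) ([] ∷ []) (∣-refl ∷ [])
    open Admissible r₀ j M H (Coprimality.gcd≡1⇒coprime gcd≡1) M≤r τ-bd 1≤τ using (E₂-bound; E₄-bound)
    power : τ ^ 9 ≤ τ ^ 13
    power = ^-monoʳ-≤ τ {{>-nonZero 1≤τ}} (m≤m+n 9 4)
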